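{- Let $1\le \ell_1\le\dots\le\ell_r\le n$ and $T\in B(\varpi_{\ell_r})\otimes\cdots\otimes B(\varpi_{\ell_1})$. (a) If $T$ is not semistandard, then $\Psi_T=0$. (b) For every $\ell\in[n]$ with $\ell\ge \ell_r$, in $H$ one has $$\Psi_T\,X^{\varpi_\ell}=\sum_{C\in B(\varpi_\ell)}X^{C}\,\Psi_{C\otimes T}.$$ (c) For every $\lambda\in(\mathbb Z^n_{\ge0})_+$, $$\mathbf 1_0\,X^{\lambda}=\sum_{T\in B(\lambda)}X^{T}\,\Psi_T .$$
   Context: Fix $n\ge1$, $[n]=\{1,\dots,n\}$. $S_n$ is the symmetric group with simple transpositions $s_i=(i,i+1)$, $i\in[n-1]$, and length function $\ell(\cdot)$. $S_n$ acts on $\mathbb Z^n$ by permuting coordinates; $\varepsilon_1,\dots,\varepsilon_n$ is the standard basis, $(\cdot,\cdot)$ the bilinear form with $(\varepsilon_i,\varepsilon_j)=\delta_{ij}$, $\alpha_i=\varepsilon_i-\varepsilon_{i+1}$, and $\varpi_k=\varepsilon_1+\dots+\varepsilon_k$ for $k\in[n]$. $(\mathbb Z^n_{\ge0})_+=\{\lambda\in\mathbb Z^n_{\ge0}:\lambda_1\ge\dots\ge\lambda_n\}$. For $\lambda\in\mathbb Z^n$, $S_{n,\lambda}=\{w\in S_n:w\lambda=\lambda\}$. The affine Hecke algebra $H$ is the $\mathbb Z[t^{\pm1}]$-algebra with generators $T_1,\dots,T_{n-1},X_1^{\pm1},\dots,X_n^{\pm1}$ and relations $T_i^2=(t-1)T_i+t$,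 $T_iT_{i+1}T_i=T_{i+1}T_iT_{i+1}$, $T_iT_j=T_jT_i$ for $|i-j|>1$, $X_iX_j=X_jX_i$, $T_iX_iT_i=tX_{i+1}$, and $T_iX_j=X_jT_i$ for $j\notin\{i,i+1\}$ (so $T_i$ is invertible, $tT_i^{ -1}=T_i+1-t$). For $w\in S_n$ with reduced expression $w=s_{i_1}\cdots s_{i_m}$, $T_w=T_{i_1}\cdots T_{i_m}$ (well defined). For $\mu\in\mathbb Z^n$, $X^\mu=X_1^{\mu_1}\cdots X_n^{\mu_n}$. $H_n$ is the subalgebra generated by $T_1,\dots,T_{n-1}$, with basis $\{T_w\}_{w\in S_n}$; for $\lambda\in\mathbb Z^n$, $H_{n,\lambda}$ is the $\mathbb Z[t^{\pm1}]$-span of $\{T_w:w\in S_{n,\lambda}\}$, $\mathbf 1_\lambda=\sum_{w\in S_{n,\lambda}}T_w$, and $\mathbf 1_0=\sum_{w\in S_n}T_w$. Columns: a column of length $\ell$ is $C=(c_1,\dots,c_\ell)$ with $1\le c_1<\dots<c_\ell\le n$ (identified with the subset $\{c_1,\dots,c_\ell\}$); $B(\varpi_\ell)$ is the set of these. If $[n]\setminus C=\{c^c_{\ell+1}<\dots<c^c_n\}$, $u_C\in S_n$ is the permutation with $u_C(k)=c_k$ for $k\le \ell$ and $u_C(k)=c^c_k$ for $k>\ell$. $X^C=X_{c_1}\cdots X_{c_\ell}$. The column $(1,\dots,\ell)$ is called highest weight. Tableaux: for $1\le\ell_1\le\dots\le\ell_r\le n$, $B(\varpi_{\ell_r})\otimes\cdots\otimes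 B(\varpi_{\ell_1})$ is the set of $T=C_r\otimes\cdots\otimes C_1$ with $C_i\in B(\varpi_{\ell_i})$, viewed as a filling of the Young diagram of $\lambda=\varpi_{\ell_r}+\dots+\varpi_{\ell_1}$ with columns $C_r,\dots,C_1$ from left to right (each written top to bottom). $T$ is semistandard if entries weakly increase along each row from left to right. Every $\lambda\in(\mathbb Z^n_{\ge0})_+$ is uniquely $\varpi_{\ell_r}+\dots+\varpi_{\ell_1}$ with $\ell_1\le\dots\le\ell_r$ (column lengths); $B(\lambda)\subseteq B(\varpi_{\ell_r})\otimes\cdots\otimes B(\varpi_{\ell_1})$ is the set of semistandard ones. $X^T=\prod_i X^{C_i}$. For $C\in B(\varpi_\ell)$ with $\ell\ge\ell_r$, $C\otimes T$ means $C\otimes C_r\otimes\cdots\otimes C_1$. Definition of $\Psi$: every $h\in H_n$ can be written uniquely as $h=\sum_{F\in B(\varpi_\ell)}T_{u_F}h_F$ with $h_F\in H_{n,\varpi_\ell}$. Define $\Psi_T\in H_n$ recursively: for a single column $C\in B(\varpi_\ell)$, $\Psi_C=t^{\ell(u_C)}(T_{u_C^{ -1}})^{ -1}\mathbf 1_{\varpi_\ell}$; for $T=C\otimes S$ with $C\in B(\varpi_\ell)$ and $S\in B(\varpi_{\ell_r})\otimes\cdots\otimes B(\varpi_{\ell_1})$, $\ell_r\le\ell$, write $\Psi_S=\sum_{E\in B(\varpi_\ell)}T_{u_E}h_{E,S}$ with $h_{E,S}\in H_{n,\varpi_\ell}$ and set $\Psi_T=t^{\ell(u_C)}(T_{u_C^{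 -1}})^{ -1}h_{C,S}$. -}

module Defs where

open import Algebra.Bundles using (Ring)
import Algebra.Properties.CommutativeMonoid.Sum
import Algebra.Properties.Ring
import Algebra.Properties.Semiring.Exp
open import Data.Bool.Base using (true; false; if_then_else_)
open import Data.Empty using (⊥-elim)
open import Data.Fin.Base as Fin using (Fin; zero; suc; toℕ; inject₁; fromℕ; fromℕ<; punchIn; punchOut)
import Data.Fin.Induction as Fin
open import Data.Fin.Permutation as Perm using (Permutation′; _⟨$⟩ʳ_; _⟨$⟩ˡ_; transpose; insert; flip)
import Data.Fin.Properties as Fin
open import Data.Integer.Base as ℤ using (ℤ; +_; -[1+_]; 0ℤ; 1ℤ)
import Data.Integer.Properties as ℤ
open import Data.List.Base using (List; []; _∷_; length; _++_; map; allFin; cartesianProductWith; filter; foldr; applyUpTo; tabulate)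
open import Data.List.Membership.Propositional using (_∈_)
import Data.List.Membership.Propositional.Properties as ∈
import Data.List.Properties as List
open import Data.List.Relation.Unary.All as All using (All; []; _∷_)
import Data.List.Relation.Unary.All.Properties as All
open import Data.List.Relation.Unary.AllPairs as AllPairs using (AllPairs; []; _∷_)
import Data.List.Relation.Unary.AllPairs.Properties as AllPairs
open import Data.List.Relation.Unary.Any as Any using (Any; here; there)
import Data.List.Relation.Unary.Any.Properties as Any
open import Data.List.Relation.Unary.Linked using (Linked)
import Data.List.Relation.Unary.Linked.Properties as Linked
open import Data.List.Relation.Unary.Unique.Propositional using (Unique)
import Data.List.Relation.Unary.Unique.Propositional.Properties as Unique
open import Data.Nat.Base as ℕ using (ℕ; zero; suc; z≤n; s≤s)
import Data.Nat.Properties as ℕ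
open import Data.Product.Base using (∃; _×_; _,_; proj₁; proj₂)
open import Data.Sum.Base using (_⊎_; inj₁; inj₂)
open import Function.Base using (_∘_; case_of_)
open import Level using (0ℓ)
open import Relation.Binary.Definitions using (tri<; tri≈; tri>; DecidableEquality)
open import Relation.Binary.PropositionalEquality using (_≡_; _≢_; _≗_; refl; sym; trans; cong; cong₂; subst; subst₂; setoid; module ≡-Reasoning)
import Relation.Binary.Reasoning.Setoid
open import Relation.Nullary using (¬_; Dec; does; yes; no)
open import Relation.Nullary.Decidable using (dec-true; dec-false; map′; _×-dec_; _→-dec_)
open import Relation.Unary using (Decidable)

private module Sum = Algebra.Properties.CommutativeMonoid.Sum ℕ.+-0-commutativeMonoid

-- The letters 1, …, n are Fin n, so everything is indexed from zero; in
-- particular simple i is the transposition of the letters i+1 and i+2.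

simple : ∀ {m} → Fin m → Permutation′ (suc m)
simple i = transpose (inject₁ i) (suc i)

-- A permutation of suc n letters is determined by the image j of zero and by
-- the permutation of the remaining letters, relabelled in increasing order.

permutations : ∀ n → List (Permutation′ n)
permutations zero    = Perm.id ∷ []
permutations (suc n) = cartesianProductWith (insert zero) (allFin (suc n)) (permutations n)

insert-cong : ∀ {n} j {π ρ : Permutation′ n} → π Perm.≈ ρ → insert zero j π Perm.≈ insert zero j ρ
insert-cong j e zero    = refl
insert-cong j e (suc i) = cong (punchIn j) (e i)

insert-injective : ∀ {n} {j k} {π ρ : Permutation′ n} → insert zero j π Perm.≈ insert zero k ρ → j ≡ k × π Perm.≈ ρ
insert-injective {j = j} e with e zero
... | refl = refl , λ i → Fin.punchIn-injective j _ _ (e (suc i))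

permutations-complete : ∀ {n} (w : Permutation′ n) → Any (w Perm.≈_) (permutations n)
permutations-complete {zero}  w = here λ ()
permutations-complete {suc n} w =
  Any.cartesianProductWith⁺ (insert zero) combine (∈.∈-allFin (w ⟨$⟩ʳ zero)) (permutations-complete (Perm.remove zero w))
  where
  combine : ∀ {j ρ} → w ⟨$⟩ʳ zero ≡ j → Perm.remove zero w Perm.≈ ρ → w Perm.≈ insert zero j ρ
  combine {ρ = ρ} refl e i = trans (sym (Perm.insert-remove zero w i)) (insert-cong (w ⟨$⟩ʳ zero) {Perm.remove zero w} {ρ} e i)

permutations-distinct : ∀ n → AllPairs (λ w v → ¬ w Perm.≈ v) (permutations n)
permutations-distinct zero    = [] ∷ []
permutations-distinct (suc n) = go (Unique.allFin⁺ (suc n))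
  where
  ps = permutations n
  row : ∀ j → AllPairs (λ w v → ¬ w Perm.≈ v) (map (insert zero j) ps)
  row j = AllPairs.map⁺ (AllPairs.map (λ {π} {ρ} ne e → ne (proj₂ (insert-injective {π = π} {ρ = ρ} e))) (permutations-distinct n))
  go : ∀ {js} → Unique js → AllPairs (λ w v → ¬ w Perm.≈ v) (cartesianProductWith (insert zero) js ps)
  go [] = []
  go {j ∷ js} (j∉ ∷ u) = AllPairs.++⁺ (row j) (go u)
    (All.map⁺ (All.tabulate λ {π} _ →
      All.cartesianProductWith⁺ (setoid _) (setoid _) (insert zero) js ps λ {k} {ρ} k∈ _ e →
        All.lookup j∉ k∈ (proj₁ (insert-injective {π = π} {ρ = ρ} e))))

-- Column n ℓ is B(ϖ_ℓ): a column is given by its indicator word, listing for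
-- each letter in increasing order whether it occurs.  The sequence
-- c₁ < … < c_ℓ is recovered by entry, which is a bijection onto the strictly
-- increasing sequences.

data Column : ℕ → ℕ → Set where
  []   : Column 0 0
  take : ∀ {n ℓ} → Column n ℓ → Column (suc n) (suc ℓ)
  skip : ∀ {n ℓ} → Column n ℓ → Column (suc n) ℓ

entry : ∀ {n ℓ} → Column n ℓ → Fin ℓ → Fin n
entry (take C) zero    = zero
entry (take C) (suc k) = suc (entry C k)
entry (skip C) k       = suc (entry C k)

entry-increasing : ∀ {n ℓ} (C : Column n ℓ) {j k} → j Fin.< k → entry C j Fin.< entry C k
entry-increasing (take C) {zero}  {suc k} _         = s≤s z≤n
entry-increasing (take C) {suc j} {suc k} (s≤s j<k) = s≤s (entry-increasing C j<k)
entry-increasing (skip C) j<k                       = s≤s (entry-increasing C j<k)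

entry-injective : ∀ {n ℓ} (C D : Column n ℓ) → entry C ≗ entry D → C ≡ D
entry-injective []       []       e = refl
entry-injective (take C) (take D) e = cong take (entry-injective C D (Fin.suc-injective ∘ e ∘ suc))
entry-injective (skip C) (skip D) e = cong skip (entry-injective C D (Fin.suc-injective ∘ e))
entry-injective (take C) (skip D) e = case e zero of λ ()
entry-injective (skip C) (take D) e = case e zero of λ ()

private
  lower : ∀ {k n} (f : Fin k → Fin (suc n)) → (∀ x → zero ≢ f x) → Fin k → Fin n
  lower f ne x = punchOut (ne x)

entry-surjective : ∀ {n ℓ} (f : Fin ℓ → Fin n) → (∀ {j k} → j Fin.< k → f j Fin.< f k) → ∃ λ C → entry C ≗ f
entry-surjective {zero}  {zero}  f inc = [] , λ ()
entry-surjective {zero}  {suc ℓ} f inc = ⊥-elim (Fin.¬Fin0 (f zero))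
entry-surjective {suc n} {zero}  f inc with entry-surjective {n} {zero} (λ ()) (λ {})
... | C , _ = skip C , λ ()
entry-surjective {suc n} {suc ℓ} f inc with f zero Fin.≟ zero
... | yes f0≡0 = take C , λ { zero → sym f0≡0 ; (suc k) → trans (cong suc (e k)) (Fin.punchIn-punchOut (ne k)) }
  where
  ne : ∀ k → zero ≢ f (suc k)
  ne k z = ℕ.n≮0 (subst (toℕ (f zero) ℕ.<_) (cong toℕ (sym z)) (inc {zero} {suc k} (s≤s z≤n)))
  g = lower (f ∘ suc) ne
  rec = entry-surjective g λ {j} {k} j<k →
    ℕ.s<s⁻¹ (subst₂ Fin._<_ (sym (Fin.punchIn-punchOut (ne j))) (sym (Fin.punchIn-punchOut (ne k))) (inc (s≤s j<k)))
  C = proj₁ rec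
  e = proj₂ rec
... | no f0≢0 = skip C , λ k → trans (cong suc (e k)) (Fin.punchIn-punchOut (ne k))
  where
  ne : ∀ k → zero ≢ f k
  ne zero    z = f0≢0 (sym z)
  ne (suc k) z = ℕ.n≮0 (subst (toℕ (f zero) ℕ.<_) (cong toℕ (sym z)) (inc {zero} {suc k} (s≤s z≤n)))
  g = lower f ne
  rec = entry-surjective g λ {j} {k} j<k →
    ℕ.s<s⁻¹ (subst₂ Fin._<_ (sym (Fin.punchIn-punchOut (ne j))) (sym (Fin.punchIn-punchOut (ne k))) (inc j<k))
  C = proj₁ rec
  e = proj₂ rec

columns : ∀ n ℓ → List (Column n ℓ)
columns zero    zero    = [] ∷ []
columns zero    (suc ℓ) = []
columns (suc n) zero    = map skip (columns n zero)
columns (suc n) (suc ℓ) = map take (columns n ℓ) ++ map skip (columns n (suc ℓ))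

columns-complete : ∀ {n ℓ} (C : Column n ℓ) → C ∈ columns n ℓ
columns-complete []                   = here refl
columns-complete (take C)             = ∈.∈-++⁺ˡ (∈.∈-map⁺ take (columns-complete C))
columns-complete {ℓ = zero}  (skip C) = ∈.∈-map⁺ skip (columns-complete C)
columns-complete {suc n} {suc ℓ} (skip C) = ∈.∈-++⁺ʳ (map take (columns n ℓ)) (∈.∈-map⁺ skip (columns-complete C))

private
  take-inj : ∀ {n ℓ} {C D : Column n ℓ} → take C ≡ take D → C ≡ D
  take-inj refl = refl
  skip-inj : ∀ {n ℓ} {C D : Column n ℓ} → skip C ≡ skip D → C ≡ D
  skip-inj refl = refl

columns-unique : ∀ n ℓ → Unique (columns n ℓ)
columns-unique zero    zero    = [] ∷ []
columns-unique zero    (suc ℓ) = []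
columns-unique (suc n) zero    = Unique.map⁺ skip-inj (columns-unique n zero)
columns-unique (suc n) (suc ℓ) = Unique.++⁺ (Unique.map⁺ take-inj (columns-unique n ℓ)) (Unique.map⁺ skip-inj (columns-unique n (suc ℓ)))
  λ (p , q) → case (∈.∈-map⁻ take p , ∈.∈-map⁻ skip q) of λ { ((_ , _ , refl) , (_ , _ , ())) }

_≟ᶜ_ : ∀ {n ℓ} → DecidableEquality (Column n ℓ)
[]     ≟ᶜ []     = yes refl
take C ≟ᶜ take D = map′ (cong take) take-inj (C ≟ᶜ D)
take C ≟ᶜ skip D = no λ ()
skip C ≟ᶜ take D = no λ ()
skip C ≟ᶜ skip D = map′ (cong skip) skip-inj (C ≟ᶜ D)

length≤ : ∀ {n ℓ} → Column n ℓ → ℓ ℕ.≤ n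
length≤ []       = z≤n
length≤ (take C) = s≤s (length≤ C)
length≤ (skip C) = ℕ.m≤n⇒m≤1+n (length≤ C)

pos : ∀ {n ℓ} → Column n ℓ → Fin (suc n)
pos C = fromℕ< (s≤s (length≤ C))

toℕ-pos : ∀ {n ℓ} (C : Column n ℓ) → toℕ (pos C) ≡ ℓ
toℕ-pos C = Fin.toℕ-fromℕ< (s≤s (length≤ C))

-- u C is the permutation u_C; it is pinned down by u-entry and u-increasing.

u : ∀ {n ℓ} → Column n ℓ → Permutation′ n
u []       = Perm.id
u (take C) = insert zero zero (u C)
u (skip C) = insert (pos C) zero (u C)

punchIn-< : ∀ {n} (p : Fin (suc n)) (x : Fin n) → toℕ x ℕ.< toℕ p → toℕ (punchIn p x) ≡ toℕ x
punchIn-< (suc p) zero    _       = refl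
punchIn-< (suc p) (suc x) (s≤s l) = cong suc (punchIn-< p x l)

punchIn-≥ : ∀ {n} (p : Fin (suc n)) (x : Fin n) → toℕ p ℕ.≤ toℕ x → toℕ (punchIn p x) ≡ suc (toℕ x)
punchIn-≥ zero    x       _       = refl
punchIn-≥ (suc p) (suc x) (s≤s l) = cong suc (punchIn-≥ p x l)

punchIn-mono-< : ∀ {n} (p : Fin (suc n)) {x y : Fin n} → x Fin.< y → punchIn p x Fin.< punchIn p y
punchIn-mono-< p {x} {y} l = ℕ.≤∧≢⇒< (Fin.punchIn-mono-≤ p x y (ℕ.<⇒≤ l))
  λ e → ℕ.<⇒≢ l (cong toℕ (Fin.punchIn-injective p x y (Fin.toℕ-injective e)))

u⁻¹-entry : ∀ {n ℓ} (C : Column n ℓ) k → toℕ (u C ⟨$⟩ˡ entry C k) ≡ toℕ k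
u⁻¹-entry (take C) zero    = refl
u⁻¹-entry (take C) (suc k) = cong suc (u⁻¹-entry C k)
u⁻¹-entry (skip C) k       = trans (punchIn-< (pos C) _ (subst₂ ℕ._<_ (sym (u⁻¹-entry C k)) (sym (toℕ-pos C)) (Fin.toℕ<n k))) (u⁻¹-entry C k)

u-entry : ∀ {n ℓ} (C : Column n ℓ) k → u C ⟨$⟩ʳ Fin.inject≤ k (length≤ C) ≡ entry C k
u-entry C k = trans (cong (u C ⟨$⟩ʳ_) (Fin.toℕ-injective (trans (Fin.toℕ-inject≤ k _) (sym (u⁻¹-entry C k))))) (Perm.inverseʳ (u C))

u-increasing : ∀ {n ℓ} (C : Column n ℓ) {x y} → ℓ ℕ.≤ toℕ x → x Fin.< y → u C ⟨$⟩ʳ x Fin.< u C ⟨$⟩ʳ y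
u-increasing (take C) {suc x} {suc y} (s≤s l) (s≤s x<y) = s≤s (u-increasing C l x<y)
u-increasing {suc n} {ℓ} (skip C) {x} {y} l x<y with pos C Fin.≟ x | pos C Fin.≟ y
... | yes refl | yes refl = ⊥-elim (Fin.<-irrefl refl x<y)
... | yes _    | no _     = s≤s z≤n
... | no p≢x   | yes refl = ⊥-elim (ℕ.<⇒≱ x<y (subst (ℕ._≤ toℕ x) (sym (toℕ-pos C)) l))
... | no p≢x   | no p≢y   = s≤s (u-increasing C ℓ≤x′ x′<y′)
  where
  x′ = punchOut p≢x
  y′ = punchOut p≢y
  ex : punchIn (pos C) x′ ≡ x
  ex = Fin.punchIn-punchOut p≢x
  ey : punchIn (pos C) y′ ≡ y
  ey = Fin.punchIn-punchOut p≢y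
  ℓ≤x′ : ℓ ℕ.≤ toℕ x′
  ℓ≤x′ = ℕ.≮⇒≥ λ x′<ℓ → p≢x (Fin.toℕ-injective (ℕ.≤-antisym
    (ℕ.≤-trans (ℕ.≤-reflexive (toℕ-pos C)) l)
    (ℕ.≤-trans (ℕ.≤-reflexive (trans (cong toℕ (sym ex)) (punchIn-< (pos C) x′ (subst (toℕ x′ ℕ.<_) (sym (toℕ-pos C)) x′<ℓ))))
      (ℕ.≤-trans (ℕ.<⇒≤ x′<ℓ) (ℕ.≤-reflexive (sym (toℕ-pos C)))))))
  x′<y′ : x′ Fin.< y′
  x′<y′ = ℕ.≤∧≢⇒< (Fin.punchIn-cancel-≤ (pos C) x′ y′ (subst₂ Fin._≤_ (sym ex) (sym ey) (ℕ.<⇒≤ x<y)))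
    λ e → ℕ.<⇒≢ x<y (cong toℕ (trans (sym ex) (trans (cong (punchIn (pos C)) (Fin.toℕ-injective e)) ey)))

highest : ∀ {n ℓ} → ℓ ℕ.≤ n → Column n ℓ
highest {zero}  z≤n     = []
highest {suc n} z≤n     = skip (highest z≤n)
highest (s≤s p)         = take (highest p)

u⁻¹-highest : ∀ {n ℓ} (p : ℓ ℕ.≤ n) x → u (highest p) ⟨$⟩ˡ x ≡ x
u⁻¹-highest {suc n} z≤n     zero    = refl
u⁻¹-highest {suc n} z≤n     (suc x) = cong suc (u⁻¹-highest z≤n x)
u⁻¹-highest         (s≤s p) zero    = refl
u⁻¹-highest         (s≤s p) (suc x) = cong suc (u⁻¹-highest p x)

private
  s-zero : ∀ {m} (i : Fin m) → simple (suc i) ⟨$⟩ʳ zero ≡ zero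
  s-zero i = Perm.lift₀-transpose (inject₁ i) (suc i) zero
  s-suc : ∀ {m} (i : Fin m) x → simple (suc i) ⟨$⟩ʳ suc x ≡ suc (simple i ⟨$⟩ʳ x)
  s-suc i x = Perm.lift₀-transpose (inject₁ i) (suc i) (suc x)

-- How left multiplication by simple i moves a minimal coset representative u F.

data Step {m ℓ} (i : Fin m) (F : Column (suc m) ℓ) : Set where
  up   : ∀ (G : Column (suc m) ℓ) → (∀ x → u G ⟨$⟩ˡ x ≡ u F ⟨$⟩ˡ (simple i ⟨$⟩ʳ x)) → u F ⟨$⟩ˡ inject₁ i Fin.< u F ⟨$⟩ˡ suc i → Step i F
  down : ∀ (G : Column (suc m) ℓ) → (∀ x → u G ⟨$⟩ˡ x ≡ u F ⟨$⟩ˡ (simple i ⟨$⟩ʳ x)) → u F ⟨$⟩ˡ suc i Fin.< u F ⟨$⟩ˡ inject₁ i → Step i F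
  stay : ∀ j → u F ⟨$⟩ˡ inject₁ i ≡ inject₁ j → u F ⟨$⟩ˡ suc i ≡ suc j → suc (toℕ j) ≢ ℓ → Step i F

step : ∀ {m ℓ} (i : Fin m) (F : Column (suc m) ℓ) → Step i F
step zero (take (take G)) = stay zero refl refl λ ()
step zero (take (skip G)) = up (skip (take G)) (λ { zero → refl ; (suc zero) → refl ; (suc (suc x)) → refl }) (s≤s z≤n)
step zero (skip (take G)) = down (take (skip G)) (λ { zero → refl ; (suc zero) → refl ; (suc (suc x)) → refl }) (s≤s z≤n)
step {suc m} {ℓ} zero (skip (skip G)) = stay (pos G)
  (Fin.toℕ-injective (trans (toℕ-pos (skip G)) (sym (trans (Fin.toℕ-inject₁ (pos G)) (toℕ-pos G)))))
  (Fin.toℕ-injective (punchIn-≥ (pos (skip G)) (pos G) (ℕ.≤-reflexive (trans (toℕ-pos (skip G)) (sym (toℕ-pos G))))))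
  (λ e → ℕ.1+n≢n (trans e (sym (toℕ-pos G))))
step (suc i) (take F) with step i F
... | up G e l = up (take G) (λ { zero → sym (cong (u (take F) ⟨$⟩ˡ_) (s-zero i)) ; (suc x) → trans (cong suc (e x)) (sym (cong (u (take F) ⟨$⟩ˡ_) (s-suc i x))) }) (s≤s l)
... | down G e l = down (take G) (λ { zero → sym (cong (u (take F) ⟨$⟩ˡ_) (s-zero i)) ; (suc x) → trans (cong suc (e x)) (sym (cong (u (take F) ⟨$⟩ˡ_) (s-suc i x))) }) (s≤s l)
... | stay j p q r = stay (suc j) (cong suc p) (cong suc q) (r ∘ ℕ.suc-injective)
step {suc m} {ℓ} (suc i) (skip F) with step i F
... | up G e l = up (skip G) (λ { zero → sym (cong (u (skip F) ⟨$⟩ˡ_) (s-zero i)) ; (suc x) → trans (cong (punchIn (pos F)) (e x)) (sym (cong (u (skip F) ⟨$⟩ˡ_) (s-suc i x))) }) (punchIn-mono-< (pos F) l)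
... | down G e l = down (skip G) (λ { zero → sym (cong (u (skip F) ⟨$⟩ˡ_) (s-zero i)) ; (suc x) → trans (cong (punchIn (pos F)) (e x)) (sym (cong (u (skip F) ⟨$⟩ˡ_) (s-suc i x))) }) (punchIn-mono-< (pos F) l)
... | stay j p q r with ℕ.<-cmp (suc (toℕ j)) ℓ
...   | tri≈ _ e _ = ⊥-elim (r e)
...   | tri< l _ _ = stay (inject₁ j)
        (trans (cong (punchIn (pos F)) p) (Fin.toℕ-injective (trans (punchIn-< (pos F) (inject₁ j) (subst₂ ℕ._<_ (sym (Fin.toℕ-inject₁ j)) (sym (toℕ-pos F)) (ℕ.<-trans (ℕ.n<1+n _) l))) (sym (Fin.toℕ-inject₁ (inject₁ j))))))
        (trans (cong (punchIn (pos F)) q) (Fin.toℕ-injective (trans (punchIn-< (pos F) (suc j) (subst (suc (toℕ j) ℕ.<_) (sym (toℕ-pos F)) l)) (cong suc (sym (Fin.toℕ-inject₁ j))))))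
        (λ e → r (trans (cong suc (sym (Fin.toℕ-inject₁ j))) e))
...   | tri> _ _ g = stay (suc j)
        (trans (cong (punchIn (pos F)) p) (Fin.toℕ-injective (punchIn-≥ (pos F) (inject₁ j) (subst₂ ℕ._≤_ (sym (toℕ-pos F)) (sym (Fin.toℕ-inject₁ j)) (ℕ.s≤s⁻¹ g)))))
        (trans (cong (punchIn (pos F)) q) (Fin.toℕ-injective (punchIn-≥ (pos F) (suc j) (subst (ℕ._≤ suc (toℕ j)) (sym (toℕ-pos F)) (ℕ.<⇒≤ g)))))
        (λ e → ℕ.<⇒≢ (ℕ.<-trans g (ℕ.n<1+n _)) (sym e))

module SymmetricGroup (m : ℕ) where

  n : ℕ
  n = suc m

  S : Set
  S = Permutation′ n

  infix 4 _≈ₛ_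
  _≈ₛ_ : S → S → Set
  _≈ₛ_ = Perm._≈_

  -- The group law is composition of functions; stdlib's _∘ₚ_ is diagrammatic.
  infixr 9 _∙_
  _∙_ : S → S → S
  u ∙ v = v Perm.∘ₚ u

  s : Fin m → S
  s = simple

  Word : Set
  Word = List (Fin m)

  ⟦_⟧ : Word → S
  ⟦ [] ⟧     = Perm.id
  ⟦ i ∷ a ⟧  = s i ∙ ⟦ a ⟧

  record ReducedExpression (w : S) : Set where
    field
      word    : Word
      word-≈  : ⟦ word ⟧ ≈ₛ w
      minimal : ∀ a → ⟦ a ⟧ ≈ₛ w → length word ℕ.≤ length a

  private
    i≢1+i : ∀ (i : Fin m) → inject₁ i ≢ suc i
    i≢1+i i e = ℕ.1+n≢n (sym (trans (sym (Fin.toℕ-inject₁ i)) (cong toℕ e)))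

    i<1+i : ∀ (i : Fin m) → inject₁ i Fin.< suc i
    i<1+i i = s≤s (ℕ.≤-reflexive (Fin.toℕ-inject₁ i))

  s-i : ∀ i → s i ⟨$⟩ʳ inject₁ i ≡ suc i
  s-i i rewrite dec-true (inject₁ i Fin.≟ inject₁ i) refl = refl

  s-1+i : ∀ i → s i ⟨$⟩ʳ suc i ≡ inject₁ i
  s-1+i i rewrite dec-false (suc i Fin.≟ inject₁ i) (i≢1+i i ∘ sym) | dec-true (suc i Fin.≟ suc i) refl = refl

  s-fix : ∀ i {x} → x ≢ inject₁ i → x ≢ suc i → s i ⟨$⟩ʳ x ≡ x
  s-fix i {x} p q rewrite dec-false (x Fin.≟ inject₁ i) p | dec-false (x Fin.≟ suc i) q = refl

  data View (i : Fin m) : Fin n → Set where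
    at-i   : View i (inject₁ i)
    at-1+i : View i (suc i)
    other  : ∀ {x} → x ≢ inject₁ i → x ≢ suc i → View i x

  view : ∀ i x → View i x
  view i x with x Fin.≟ inject₁ i
  ... | yes refl = at-i
  ... | no p with x Fin.≟ suc i
  ...   | yes refl = at-1+i
  ...   | no q = other p q

  s-invol : ∀ i x → s i ⟨$⟩ʳ (s i ⟨$⟩ʳ x) ≡ x
  s-invol i x with view i x
  ... | at-i = trans (cong (s i ⟨$⟩ʳ_) (s-i i)) (s-1+i i)
  ... | at-1+i = trans (cong (s i ⟨$⟩ʳ_) (s-1+i i)) (s-i i)
  ... | other p q = trans (cong (s i ⟨$⟩ʳ_) (s-fix i p q)) (s-fix i p q)

  s-inv : ∀ i x → s i ⟨$⟩ˡ x ≡ s i ⟨$⟩ʳ x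
  s-inv i x = trans (cong (s i ⟨$⟩ˡ_) (sym (s-invol i x))) (Perm.inverseˡ (s i))

  s-inj : ∀ i {x y} → s i ⟨$⟩ʳ x ≡ s i ⟨$⟩ʳ y → x ≡ y
  s-inj i {x} {y} e = trans (sym (s-invol i x)) (trans (cong (s i ⟨$⟩ʳ_) e) (s-invol i y))

  s-mono : ∀ i {a b} → a Fin.< b → ¬ (a ≡ inject₁ i × b ≡ suc i) → s i ⟨$⟩ʳ a Fin.< s i ⟨$⟩ʳ b
  s-mono i {a} {b} a<b ne with view i a | view i b
  ... | at-i | at-i = ⊥-elim (Fin.<-irrefl refl a<b)
  ... | at-i | at-1+i = ⊥-elim (ne (refl , refl))
  ... | at-i | other p q rewrite s-i i | s-fix i p q =
        ℕ.≤∧≢⇒< (subst (ℕ._< toℕ b) (Fin.toℕ-inject₁ i) a<b) (q ∘ sym ∘ Fin.toℕ-injective)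
  ... | at-1+i | at-i = ⊥-elim (Fin.<-asym a<b (i<1+i i))
  ... | at-1+i | at-1+i = ⊥-elim (Fin.<-irrefl refl a<b)
  ... | at-1+i | other p q rewrite s-1+i i | s-fix i p q = ℕ.<-trans (i<1+i i) a<b
  ... | other p q | at-i rewrite s-i i | s-fix i p q = ℕ.<-trans a<b (i<1+i i)
  ... | other p q | at-1+i rewrite s-1+i i | s-fix i p q =
        ℕ.≤∧≢⇒< (subst (toℕ a ℕ.≤_) (sym (Fin.toℕ-inject₁ i)) (ℕ.s≤s⁻¹ a<b)) (p ∘ Fin.toℕ-injective)
  ... | other p q | other p' q' rewrite s-fix i p q | s-fix i p' q' = a<b

  ≈ₛ-sym : ∀ {u v} → u ≈ₛ v → v ≈ₛ u
  ≈ₛ-sym e x = sym (e x)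
  ≈ₛ-trans : ∀ {u v w} → u ≈ₛ v → v ≈ₛ w → u ≈ₛ w
  ≈ₛ-trans e f x = trans (e x) (f x)

  ∙-congˡ : ∀ u {v w} → v ≈ₛ w → u ∙ v ≈ₛ u ∙ w
  ∙-congˡ u e x = cong (u ⟨$⟩ʳ_) (e x)

  inverse-cong : ∀ {u v : S} → u ≈ₛ v → ∀ x → u ⟨$⟩ˡ x ≡ v ⟨$⟩ˡ x
  inverse-cong {u} {v} e x = trans (cong (u ⟨$⟩ˡ_) (sym (trans (e _) (Perm.inverseʳ v)))) (Perm.inverseˡ u)

  ss : ∀ i w → s i ∙ (s i ∙ w) ≈ₛ w
  ss i w x = s-invol i _

  𝟙[_] : ∀ {P : Set} → Dec P → ℕ
  𝟙[ d ] = if does d then 1 else 0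

  isInversion : (Fin n → Fin n) → Fin n → Fin n → ℕ
  isInversion f x y = 𝟙[ x Fin.<? y ] ℕ.* 𝟙[ f y Fin.<? f x ]

  inversions : (Fin n → Fin n) → ℕ
  inversions f = Sum.sum λ x → Sum.sum λ y → isInversion f x y

  inv : S → ℕ
  inv w = inversions (w ⟨$⟩ʳ_)

  inversions-cong : ∀ {f g} → f ≗ g → inversions f ≡ inversions g
  inversions-cong {f} {g} e = Sum.sum-cong-≗ λ x → Sum.sum-cong-≗ λ y → cong₂ (λ c d → 𝟙[ x Fin.<? y ] ℕ.* 𝟙[ c Fin.<? d ]) (e y) (e x)

  sum-bump : ∀ {k} {f g : Fin k → ℕ} p → g p ≡ suc (f p) → (∀ x → x ≢ p → g x ≡ f x) → Sum.sum g ≡ suc (Sum.sum f)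
  sum-bump zero e h = cong₂ ℕ._+_ e (Sum.sum-cong-≗ λ x → h (suc x) λ ())
  sum-bump {f = f} (suc p) e h = trans (cong₂ ℕ._+_ (h zero λ ()) (sum-bump p e λ x q → h (suc x) (q ∘ Fin.suc-injective))) (ℕ.+-suc (f zero) _)

  𝟙-yes : ∀ {P : Set} (d : Dec P) → P → 𝟙[ d ] ≡ 1
  𝟙-yes d p rewrite dec-true d p = refl
  𝟙-no : ∀ {P : Set} (d : Dec P) → ¬ P → 𝟙[ d ] ≡ 0
  𝟙-no d p rewrite dec-false d p = refl
  𝟙-iff : ∀ {P Q : Set} (d : Dec P) (e : Dec Q) → (P → Q) → (Q → P) → 𝟙[ d ] ≡ 𝟙[ e ]
  𝟙-iff (yes p) e f g = sym (𝟙-yes e (f p))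
  𝟙-iff (no p) e f g = sym (𝟙-no e (p ∘ g))

  gate : ∀ {P : Set} (d : Dec P) {c e : ℕ} → (P → c ≡ e) → 𝟙[ d ] ℕ.* c ≡ 𝟙[ d ] ℕ.* e
  gate (yes p) h = cong (1 ℕ.*_) (h p)
  gate (no _)  h = refl

  w-inj : ∀ (w : S) {x y} → w ⟨$⟩ʳ x ≡ w ⟨$⟩ʳ y → x ≡ y
  w-inj w e = trans (sym (Perm.inverseˡ w)) (trans (cong (w ⟨$⟩ˡ_) e) (Perm.inverseˡ w))

  Ascent : Fin m → S → Set
  Ascent i w = w ⟨$⟩ˡ inject₁ i Fin.< w ⟨$⟩ˡ suc i

  Descent : Fin m → S → Set
  Descent i w = w ⟨$⟩ˡ suc i Fin.< w ⟨$⟩ˡ inject₁ i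

  ascent? : ∀ i w → Ascent i w ⊎ Descent i w
  ascent? i w with Fin.<-cmp (w ⟨$⟩ˡ inject₁ i) (w ⟨$⟩ˡ suc i)
  ... | tri< a _ _ = inj₁ a
  ... | tri> _ _ c = inj₂ c
  ... | tri≈ _ e _ = ⊥-elim (i≢1+i i (trans (sym (Perm.inverseʳ w)) (trans (cong (w ⟨$⟩ʳ_) e) (Perm.inverseʳ w))))

  inv-ascent : ∀ i w → Ascent i w → inv (s i ∙ w) ≡ suc (inv w)
  inv-ascent i w p<q = sum-bump p (sum-bump q at-pq λ y y≢q → away p y (y≢q ∘ proj₂)) λ x x≢p → Sum.sum-cong-≗ λ y → away x y (x≢p ∘ proj₁)
    where
    p = w ⟨$⟩ˡ inject₁ i
    q = w ⟨$⟩ˡ suc i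
    f = w ⟨$⟩ʳ_
    g = (s i ∙ w) ⟨$⟩ʳ_
    fp : f p ≡ inject₁ i
    fp = Perm.inverseʳ w
    fq : f q ≡ suc i
    fq = Perm.inverseʳ w
    gp : g p ≡ suc i
    gp = trans (cong (s i ⟨$⟩ʳ_) fp) (s-i i)
    gq : g q ≡ inject₁ i
    gq = trans (cong (s i ⟨$⟩ʳ_) fq) (s-1+i i)
    at-pq : isInversion g p q ≡ suc (isInversion f p q)
    at-pq = trans
      (cong₂ ℕ._*_ (𝟙-yes (p Fin.<? q) p<q) (𝟙-yes (g q Fin.<? g p) (subst₂ Fin._<_ (sym gq) (sym gp) (i<1+i i))))
      (cong suc (sym (cong₂ ℕ._*_ (𝟙-yes (p Fin.<? q) p<q)
        (𝟙-no (f q Fin.<? f p) (λ l → Fin.<-asym (i<1+i i) (subst₂ Fin._<_ fq fp l))))))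
    away : ∀ x y → ¬ (x ≡ p × y ≡ q) → isInversion g x y ≡ isInversion f x y
    away x y ne = gate (x Fin.<? y) λ x<y → 𝟙-iff (g y Fin.<? g x) (f y Fin.<? f x) (to x<y) (from x<y)
      where
      from : x Fin.< y → f y Fin.< f x → g y Fin.< g x
      from x<y l = s-mono i l λ (e₁ , e₂) →
        Fin.<-asym p<q (subst₂ Fin._<_ (w-inj w (trans e₂ (sym fq))) (w-inj w (trans e₁ (sym fp))) x<y)
      to : x Fin.< y → g y Fin.< g x → f y Fin.< f x
      to x<y l = subst₂ Fin._<_ (s-invol i _) (s-invol i _) (s-mono i l λ (e₁ , e₂) →
        ne (w-inj w (s-inj i (trans e₂ (sym gp))) , w-inj w (s-inj i (trans e₁ (sym gq)))))

  descent-s : ∀ i w → Descent i w → Ascent i (s i ∙ w)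
  descent-s i w d = subst₂ Fin._<_ (cong (w ⟨$⟩ˡ_) (sym (trans (s-inv i (inject₁ i)) (s-i i)))) (cong (w ⟨$⟩ˡ_) (sym (trans (s-inv i (suc i)) (s-1+i i)))) d

  inv-cong : ∀ {u v} → u ≈ₛ v → inv u ≡ inv v
  inv-cong e = inversions-cong e

  inv-descent : ∀ i w → Descent i w → inv w ≡ suc (inv (s i ∙ w))
  inv-descent i w d = trans (inv-cong {w} {s i ∙ (s i ∙ w)} (≈ₛ-sym {s i ∙ (s i ∙ w)} {w} (ss i w))) (inv-ascent i (s i ∙ w) (descent-s i w d))

  inv-step : ∀ i w → inv (s i ∙ w) ℕ.≤ suc (inv w)
  inv-step i w with ascent? i w
  ... | inj₁ a = ℕ.≤-reflexive (inv-ascent i w a)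
  ... | inj₂ d = ℕ.≤-trans (ℕ.n≤1+n _) (ℕ.≤-trans (ℕ.≤-reflexive (sym (inv-descent i w d))) (ℕ.n≤1+n _))

  inv-id : inv Perm.id ≡ 0
  inv-id = trans (Sum.sum-cong-≗ λ x → trans (Sum.sum-cong-≗ λ y → z x y) (Sum.sum-replicate-zero n)) (Sum.sum-replicate-zero n)
    where
    z : ∀ x y → isInversion (λ x → x) x y ≡ 0
    z x y = trans (gate (x Fin.<? y) λ l → 𝟙-no (y Fin.<? x) (Fin.<-asym l)) (ℕ.*-zeroʳ 𝟙[ x Fin.<? y ])

  inv-⟦⟧ : ∀ a → inv ⟦ a ⟧ ℕ.≤ length a
  inv-⟦⟧ [] = ℕ.≤-reflexive inv-id
  inv-⟦⟧ (i ∷ a) = ℕ.≤-trans (inv-step i ⟦ a ⟧) (s≤s (inv-⟦⟧ a))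

  inv-flip : ∀ w → inv (flip w) ≡ inv w
  inv-flip w = begin
      inv (flip w)
    ≡⟨ Sum.sum-permute (λ x → Sum.sum λ y → isInversion wˡ x y) w ⟩
      Sum.sum (λ x → Sum.sum λ y → isInversion wˡ (w ⟨$⟩ʳ x) y)
    ≡⟨ Sum.sum-cong-≗ (λ x → Sum.sum-permute (λ y → isInversion wˡ (w ⟨$⟩ʳ x) y) w) ⟩
      Sum.sum (λ x → Sum.sum λ y → isInversion wˡ (w ⟨$⟩ʳ x) (w ⟨$⟩ʳ y))
    ≡⟨ Sum.sum-cong-≗ (λ x → Sum.sum-cong-≗ λ y → lem x y) ⟩
      Sum.sum (λ x → Sum.sum λ y → isInversion (w ⟨$⟩ʳ_) y x)
    ≡⟨ Sum.∑-comm (λ x y → isInversion (w ⟨$⟩ʳ_) y x) ⟩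
      inv w ∎
    where
    open ≡-Reasoning
    wˡ = w ⟨$⟩ˡ_
    lem : ∀ x y → isInversion wˡ (w ⟨$⟩ʳ x) (w ⟨$⟩ʳ y) ≡ isInversion (w ⟨$⟩ʳ_) y x
    lem x y rewrite Perm.inverseˡ w {x} | Perm.inverseˡ w {y} = ℕ.*-comm 𝟙[ (w ⟨$⟩ʳ x) Fin.<? (w ⟨$⟩ʳ y) ] _

  increasing⇒id : (f : Fin n → Fin n) → (∀ i → f (inject₁ i) Fin.< f (suc i)) → ∀ x → f x ≡ x
  increasing⇒id f inc x = Fin.toℕ-injective (ℕ.≤-antisym (upper x) (lower′ x))
    where
    lower′ : ∀ x → toℕ x ℕ.≤ toℕ (f x)
    lower′ = Fin.<-weakInduction (λ x → toℕ x ℕ.≤ toℕ (f x)) z≤n λ i h →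
      ℕ.≤-trans (s≤s (subst (ℕ._≤ toℕ (f (inject₁ i))) (Fin.toℕ-inject₁ i) h)) (inc i)
    upper : ∀ x → toℕ (f x) ℕ.≤ toℕ x
    upper = Fin.>-weakInduction (λ x → toℕ (f x) ℕ.≤ toℕ x)
      (subst (toℕ (f (fromℕ m)) ℕ.≤_) (sym (Fin.toℕ-fromℕ m)) (ℕ.s≤s⁻¹ (Fin.toℕ<n _))) λ i h →
      subst (toℕ (f (inject₁ i)) ℕ.≤_) (sym (Fin.toℕ-inject₁ i)) (ℕ.s≤s⁻¹ (ℕ.≤-trans (inc i) h))

  shortWord : ∀ k w → inv w ≡ k → ∃ λ a → ⟦ a ⟧ ≈ₛ w × length a ≡ k
  shortWord k w e with Fin.any? (λ i → (w ⟨$⟩ˡ suc i) Fin.<? (w ⟨$⟩ˡ inject₁ i))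
  shortWord zero w e | yes (i , d) = ⊥-elim (ℕ.0≢1+n (trans (sym e) (inv-descent i w d)))
  shortWord (suc k) w e | yes (i , d) with shortWord k (s i ∙ w) (ℕ.suc-injective (trans (sym (inv-descent i w d)) e))
  ... | a , p , q = i ∷ a , ≈ₛ-trans {⟦ i ∷ a ⟧} {s i ∙ (s i ∙ w)} {w} (∙-congˡ (s i) {⟦ a ⟧} {s i ∙ w} p) (ss i w) , cong suc q
  shortWord k w e | no nd = [] , w≈id , trans (sym inv-id) (trans (inv-cong {Perm.id} {w} w≈id) e)
    where
    asc : ∀ i → Ascent i w
    asc i with ascent? i w
    ... | inj₁ a = a
    ... | inj₂ d = ⊥-elim (nd (i , d))
    w≈id : Perm.id ≈ₛ w
    w≈id x = trans (sym (Perm.inverseʳ w)) (cong (w ⟨$⟩ʳ_) (increasing⇒id (w ⟨$⟩ˡ_) asc x))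

  reducedExpression : ∀ w → ReducedExpression w
  reducedExpression w with shortWord (inv w) w refl
  ... | a , p , q = record { word = a ; word-≈ = p ; minimal = λ c r →
          ℕ.≤-trans (ℕ.≤-reflexive (trans q (sym (inv-cong {⟦ c ⟧} {w} r)))) (inv-⟦⟧ c) }

  open ReducedExpression

  ℓ : S → ℕ
  ℓ w = length (word (reducedExpression w))

  ℓ≡inv : ∀ w → ℓ w ≡ inv w
  ℓ≡inv w = proj₂ (proj₂ (shortWord (inv w) w refl))

module AffineHecke (m : ℕ) where

  open SymmetricGroup m public

  infix  4 _≈_
  infixl 6 _+_
  infixl 7 _*_
  infix  8 -_

  -- The ℤ[t, t⁻¹]-algebra H is presented as the ring generated by a central
  -- unit t together with the algebra generators: H is the type of ring
  -- expressions in these, and _≈_ the congruence generated by the ring axioms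
  -- and the defining relations.

  data H : Set where
    0# 1# t t⁻¹ : H
    T           : Fin m → H
    X X⁻¹       : Fin n → H
    _+_ _*_     : H → H → H
    -_          : H → H

  data _≈_ : H → H → Set where
    ≈-refl       : ∀ {x} → x ≈ x
    ≈-sym        : ∀ {x y} → x ≈ y → y ≈ x
    ≈-trans      : ∀ {x y z} → x ≈ y → y ≈ z → x ≈ z
    +-cong       : ∀ {x x′ y y′} → x ≈ x′ → y ≈ y′ → x + y ≈ x′ + y′
    *-cong       : ∀ {x x′ y y′} → x ≈ x′ → y ≈ y′ → x * y ≈ x′ * y′
    -‿cong       : ∀ {x x′} → x ≈ x′ → - x ≈ - x′
    +-assoc      : ∀ x y z → (x + y) + z ≈ x + (y + z)
    +-comm       : ∀ x y → x + y ≈ y + x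
    +-identityˡ  : ∀ x → 0# + x ≈ x
    -‿inverseˡ   : ∀ x → - x + x ≈ 0#
    *-assoc      : ∀ x y z → (x * y) * z ≈ x * (y * z)
    *-identityˡ  : ∀ x → 1# * x ≈ x
    *-identityʳ  : ∀ x → x * 1# ≈ x
    distribˡ     : ∀ x y z → x * (y + z) ≈ x * y + x * z
    distribʳ     : ∀ x y z → (y + z) * x ≈ y * x + z * x
    t-central    : ∀ x → t * x ≈ x * t
    t-inverse    : t * t⁻¹ ≈ 1#
    X-inverseˡ   : ∀ i → X⁻¹ i * X i ≈ 1#
    X-inverseʳ   : ∀ i → X i * X⁻¹ i ≈ 1#
    T-quadratic  : ∀ i → T i * T i ≈ (t + - 1#) * T i + t
    T-braid      : ∀ i j → toℕ j ≡ suc (toℕ i) → T i * T j * T i ≈ T j * T i * T j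
    T-comm       : ∀ i j → 1 ℕ.< ℕ.∣ toℕ i - toℕ j ∣ → T i * T j ≈ T j * T i
    X-comm       : ∀ i j → X i * X j ≈ X j * X i
    TXT          : ∀ i → T i * X (inject₁ i) * T i ≈ t * X (suc i)
    TX-comm      : ∀ i j → j ≢ inject₁ i → j ≢ suc i → T i * X j ≈ X j * T i

  H-ring : Ring 0ℓ 0ℓ
  H-ring = record
    { Carrier = H ; _≈_ = _≈_ ; _+_ = _+_ ; _*_ = _*_ ; -_ = -_ ; 0# = 0# ; 1# = 1#
    ; isRing = record
      { +-isAbelianGroup = record
        { isGroup = record
          { isMonoid = record
            { isSemigroup = record
              { isMagma = record { isEquivalence = record { refl = ≈-refl ; sym = ≈-sym ; trans = ≈-trans } ; ∙-cong = +-cong }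
              ; assoc = +-assoc }
            ; identity = +-identityˡ , λ x → ≈-trans (+-comm x 0#) (+-identityˡ x) }
          ; inverse = -‿inverseˡ , λ x → ≈-trans (+-comm x (- x)) (-‿inverseˡ x)
          ; ⁻¹-cong = -‿cong }
        ; comm = +-comm }
      ; *-cong = *-cong
      ; *-assoc = *-assoc
      ; *-identity = *-identityˡ , *-identityʳ
      ; distrib = distribˡ , distribʳ
      } }

  private module R = Ring H-ring
  private module RP = Algebra.Properties.Ring H-ring
  open Algebra.Properties.Semiring.Exp R.semiring public using (_^_)
  private module ≈-R = Relation.Binary.Reasoning.Setoid R.setoid

  ∑ ∏ : ∀ {A : Set} → List A → (A → H) → H
  ∑ xs f = foldr (λ x y → f x + y) 0# xs
  ∏ xs f = foldr (λ x y → f x * y) 1# xs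

  infixr 5 ∑
  syntax ∑ xs (λ x → f) = ∑[ x ∈ xs ] f

  -- By T-well-defined, T[ w ] does not depend on the reduced expression used.

  T-word : Word → H
  T-word a = ∏ a T

  T[_] : S → H
  T[ w ] = T-word (ReducedExpression.word (reducedExpression w))

  T⁻¹ : Fin m → H
  T⁻¹ i = t⁻¹ * (T i + (1# + - t))

  T-word⁻¹ : Word → H
  T-word⁻¹ []      = 1#
  T-word⁻¹ (i ∷ a) = T-word⁻¹ a * T⁻¹ i

  T[_]⁻¹ : S → H
  T[ w ]⁻¹ = T-word⁻¹ (ReducedExpression.word (reducedExpression w))

  t⁻¹-central : ∀ x → t⁻¹ * x ≈ x * t⁻¹
  t⁻¹-central x = begin
    t⁻¹ * x                 ≈⟨ *-identityʳ _ ⟨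
    t⁻¹ * x * 1#            ≈⟨ R.*-congˡ t-inverse ⟨
    t⁻¹ * x * (t * t⁻¹)     ≈⟨ *-assoc _ _ _ ⟨
    t⁻¹ * x * t * t⁻¹       ≈⟨ R.*-congʳ (*-assoc _ _ _) ⟩
    t⁻¹ * (x * t) * t⁻¹     ≈⟨ R.*-congʳ (R.*-congˡ (t-central x)) ⟨
    t⁻¹ * (t * x) * t⁻¹     ≈⟨ R.*-congʳ (*-assoc _ _ _) ⟨
    t⁻¹ * t * x * t⁻¹       ≈⟨ R.*-congʳ (R.*-congʳ (t-central t⁻¹)) ⟨
    t * t⁻¹ * x * t⁻¹       ≈⟨ R.*-congʳ (R.*-congʳ t-inverse) ⟩
    1# * x * t⁻¹            ≈⟨ R.*-congʳ (*-identityˡ x) ⟩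
    x * t⁻¹                 ∎
    where open ≈-R

  private
    t⁻¹t : t⁻¹ * t ≈ 1#
    t⁻¹t = ≈-trans (≈-sym (t-central t⁻¹)) t-inverse

    cancel : ∀ i → (T i * T i) + (1# + - t) * T i ≈ t
    cancel i = begin
      T i * T i + (1# + - t) * T i                     ≈⟨ R.+-congʳ (T-quadratic i) ⟩
      (t + - 1#) * T i + t + (1# + - t) * T i          ≈⟨ R.+-congʳ (+-comm _ _) ⟩
      t + (t + - 1#) * T i + (1# + - t) * T i          ≈⟨ +-assoc _ _ _ ⟩
      t + ((t + - 1#) * T i + (1# + - t) * T i)        ≈⟨ R.+-congˡ (distribʳ _ _ _) ⟨
      t + ((t + - 1#) + (1# + - t)) * T i              ≈⟨ R.+-congˡ (R.*-congʳ z) ⟩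
      t + 0# * T i                                     ≈⟨ R.+-congˡ (R.zeroˡ _) ⟩
      t + 0#                                           ≈⟨ R.+-identityʳ _ ⟩
      t                                                ∎
      where
      open ≈-R
      z : (t + - 1#) + (1# + - t) ≈ 0#
      z = begin
        (t + - 1#) + (1# + - t)   ≈⟨ +-assoc _ _ _ ⟩
        t + (- 1# + (1# + - t))   ≈⟨ R.+-congˡ (+-assoc _ _ _) ⟨
        t + (- 1# + 1# + - t)     ≈⟨ R.+-congˡ (R.+-congʳ (-‿inverseˡ _)) ⟩
        t + (0# + - t)            ≈⟨ R.+-congˡ (+-identityˡ _) ⟩
        t + - t                   ≈⟨ R.-‿inverseʳ t ⟩
        0#                        ∎

    [1-t]-comm : ∀ x → (1# + - t) * x ≈ x * (1# + - t)
    [1-t]-comm x = begin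
      (1# + - t) * x       ≈⟨ distribʳ _ _ _ ⟩
      1# * x + - t * x     ≈⟨ +-cong (*-identityˡ x) (≈-sym (RP.-‿distribˡ-* t x)) ⟩
      x + - (t * x)        ≈⟨ +-cong (≈-sym (*-identityʳ x)) (-‿cong (t-central x)) ⟩
      x * 1# + - (x * t)   ≈⟨ R.+-congˡ (RP.-‿distribʳ-* x t) ⟩
      x * 1# + x * - t     ≈⟨ distribˡ _ _ _ ⟨
      x * (1# + - t)       ∎
      where open ≈-R

  T⁻¹-inverseˡ : ∀ i → T⁻¹ i * T i ≈ 1#
  T⁻¹-inverseˡ i = begin
    t⁻¹ * (T i + (1# + - t)) * T i              ≈⟨ *-assoc _ _ _ ⟩
    t⁻¹ * ((T i + (1# + - t)) * T i)            ≈⟨ R.*-congˡ (≈-trans (distribʳ _ _ _) (cancel i)) ⟩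
    t⁻¹ * t                                     ≈⟨ t⁻¹t ⟩
    1#                                          ∎
    where open ≈-R

  T⁻¹-inverseʳ : ∀ i → T i * T⁻¹ i ≈ 1#
  T⁻¹-inverseʳ i = begin
    T i * (t⁻¹ * (T i + (1# + - t)))            ≈⟨ *-assoc _ _ _ ⟨
    T i * t⁻¹ * (T i + (1# + - t))              ≈⟨ R.*-congʳ (t⁻¹-central _) ⟨
    t⁻¹ * T i * (T i + (1# + - t))              ≈⟨ *-assoc _ _ _ ⟩
    t⁻¹ * (T i * (T i + (1# + - t)))            ≈⟨ R.*-congˡ (≈-trans (distribˡ _ _ _) (R.+-congˡ (≈-sym ([1-t]-comm _)))) ⟩
    t⁻¹ * (T i * T i + (1# + - t) * T i)        ≈⟨ R.*-congˡ (cancel i) ⟩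
    t⁻¹ * t                                     ≈⟨ t⁻¹t ⟩
    1#                                          ∎
    where open ≈-R

  T[]⁻¹-inverseˡ : ∀ w → T[ w ]⁻¹ * T[ w ] ≈ 1#
  T[]⁻¹-inverseˡ w = go (ReducedExpression.word (reducedExpression w))
    where
    open ≈-R
    go : ∀ a → T-word⁻¹ a * T-word a ≈ 1#
    go []      = *-identityˡ 1#
    go (i ∷ a) = begin
      T-word⁻¹ a * T⁻¹ i * (T i * T-word a)     ≈⟨ *-assoc _ _ _ ⟩
      T-word⁻¹ a * (T⁻¹ i * (T i * T-word a))   ≈⟨ R.*-congˡ (*-assoc _ _ _) ⟨
      T-word⁻¹ a * (T⁻¹ i * T i * T-word a)     ≈⟨ R.*-congˡ (R.*-congʳ (T⁻¹-inverseˡ i)) ⟩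
      T-word⁻¹ a * (1# * T-word a)              ≈⟨ R.*-congˡ (*-identityˡ _) ⟩
      T-word⁻¹ a * T-word a                     ≈⟨ go a ⟩
      1#                                        ∎

  T[]⁻¹-inverseʳ : ∀ w → T[ w ] * T[ w ]⁻¹ ≈ 1#
  T[]⁻¹-inverseʳ w = go (ReducedExpression.word (reducedExpression w))
    where
    open ≈-R
    go : ∀ a → T-word a * T-word⁻¹ a ≈ 1#
    go []      = *-identityˡ 1#
    go (i ∷ a) = begin
      T i * T-word a * (T-word⁻¹ a * T⁻¹ i)     ≈⟨ *-assoc _ _ _ ⟩
      T i * (T-word a * (T-word⁻¹ a * T⁻¹ i))   ≈⟨ R.*-congˡ (*-assoc _ _ _) ⟨
      T i * (T-word a * T-word⁻¹ a * T⁻¹ i)     ≈⟨ R.*-congˡ (R.*-congʳ (go a)) ⟩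
      T i * (1# * T⁻¹ i)                        ≈⟨ R.*-congˡ (*-identityˡ _) ⟩
      T i * T⁻¹ i                               ≈⟨ T⁻¹-inverseʳ i ⟩
      1#                                        ∎

  descent-tail : ∀ i a w → ⟦ i ∷ a ⟧ ≈ₛ w → inv w ≡ suc (length a) → Descent i w × (⟦ a ⟧ ≈ₛ s i ∙ w) × inv ⟦ a ⟧ ≡ length a
  descent-tail i a w e l with ascent? i w
  ... | inj₂ d = d , tail , trans (inv-cong {⟦ a ⟧} {s i ∙ w} tail) (ℕ.suc-injective (trans (sym (inv-descent i w d)) l))
    where
    tail : ⟦ a ⟧ ≈ₛ s i ∙ w
    tail x = trans (sym (s-invol i (⟦ a ⟧ ⟨$⟩ʳ x))) (cong (s i ⟨$⟩ʳ_) (e x))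
  ... | inj₁ asc = ⊥-elim (ℕ.<⇒≱ (ℕ.n<1+n (suc (length a)))
      (ℕ.≤-trans (ℕ.≤-reflexive (sym (trans (trans (inv-cong {⟦ a ⟧} {s i ∙ w} tail) (inv-ascent i w asc)) (cong suc l))))
        (ℕ.≤-trans (inv-⟦⟧ a) (ℕ.n≤1+n _))))
    where
    tail : ⟦ a ⟧ ≈ₛ s i ∙ w
    tail x = trans (sym (s-invol i (⟦ a ⟧ ⟨$⟩ʳ x))) (cong (s i ⟨$⟩ʳ_) (e x))

  record Diamond (i j : Fin m) (w : S) : Set where
    field
      a d : Word
      a≈  : ⟦ a ⟧ ≈ₛ s i ∙ w
      d≈  : ⟦ d ⟧ ≈ₛ s j ∙ w
      |a| : suc (length a) ≡ inv w
      |d| : suc (length d) ≡ inv w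
      eq  : T i * T-word a ≈ T j * T-word d

  diamond-sym : ∀ {i j w} → Diamond i j w → Diamond j i w
  diamond-sym D = record { a = d ; d = a ; a≈ = d≈ ; d≈ = a≈ ; |a| = |d| ; |d| = |a| ; eq = ≈-sym eq }
    where open Diamond D

  private
    toℕ-≢ : ∀ {k} {x y : Fin k} → toℕ x ≢ toℕ y → x ≢ y
    toℕ-≢ ne e = ne (cong toℕ e)

  module Far (i j : Fin m) (far : suc (toℕ i) ℕ.< toℕ j) where
    j₀≢i₀ : inject₁ j ≢ inject₁ i
    j₀≢i₀ = toℕ-≢ λ e → ℕ.<⇒≢ (ℕ.<-trans (ℕ.n<1+n _) far) (sym (trans (sym (Fin.toℕ-inject₁ j)) (trans e (Fin.toℕ-inject₁ i))))
    j₀≢i₁ : inject₁ j ≢ suc i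
    j₀≢i₁ = toℕ-≢ λ e → ℕ.<⇒≢ far (sym (trans (sym (Fin.toℕ-inject₁ j)) e))
    j₁≢i₀ : suc j ≢ inject₁ i
    j₁≢i₀ = toℕ-≢ λ e → ℕ.<⇒≢ (ℕ.<-trans (ℕ.n<1+n _) (ℕ.<-trans far (ℕ.n<1+n _))) (sym (trans e (Fin.toℕ-inject₁ i)))
    j₁≢i₁ : suc j ≢ suc i
    j₁≢i₁ = toℕ-≢ λ e → ℕ.<⇒≢ (ℕ.<-trans (ℕ.n<1+n _) far) (sym (ℕ.suc-injective e))

    commute : ∀ x → s i ⟨$⟩ʳ (s j ⟨$⟩ʳ x) ≡ s j ⟨$⟩ʳ (s i ⟨$⟩ʳ x)
    commute x with view i x
    ... | at-i   = trans (cong (s i ⟨$⟩ʳ_) (s-fix j (j₀≢i₀ ∘ sym) (j₁≢i₀ ∘ sym))) (trans (s-i i)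
                    (trans (sym (s-fix j (j₀≢i₁ ∘ sym) (j₁≢i₁ ∘ sym))) (cong (s j ⟨$⟩ʳ_) (sym (s-i i)))))
    ... | at-1+i = trans (cong (s i ⟨$⟩ʳ_) (s-fix j (j₀≢i₁ ∘ sym) (j₁≢i₁ ∘ sym))) (trans (s-1+i i)
                    (trans (sym (s-fix j (j₀≢i₀ ∘ sym) (j₁≢i₀ ∘ sym))) (cong (s j ⟨$⟩ʳ_) (sym (s-1+i i)))))
    ... | other p q with view j x
    ...   | at-i   = trans (cong (s i ⟨$⟩ʳ_) (s-i j)) (trans (s-fix i j₁≢i₀ j₁≢i₁) (trans (sym (s-i j)) (cong (s j ⟨$⟩ʳ_) (sym (s-fix i p q)))))
    ...   | at-1+i = trans (cong (s i ⟨$⟩ʳ_) (s-1+i j)) (trans (s-fix i j₀≢i₀ j₀≢i₁) (trans (sym (s-1+i j)) (cong (s j ⟨$⟩ʳ_) (sym (s-fix i p q)))))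
    ...   | other p' q' = trans (cong (s i ⟨$⟩ʳ_) (s-fix j p' q')) (trans (s-fix i p q) (trans (sym (s-fix j p' q')) (cong (s j ⟨$⟩ʳ_) (sym (s-fix i p q)))))

    diamond : ∀ w → Descent i w → Descent j w → Diamond i j w
    diamond w di dj = record
      { a = j ∷ c ; d = i ∷ c
      ; a≈ = λ x → trans (cong (s j ⟨$⟩ʳ_) (c≈ x)) (s-invol j _)
      ; d≈ = λ x → trans (cong (s i ⟨$⟩ʳ_) (c≈ x)) (trans (commute (s i ∙ w ⟨$⟩ʳ x)) (cong (s j ⟨$⟩ʳ_) (s-invol i (w ⟨$⟩ʳ x))))
      ; |a| = len ; |d| = len
      ; eq = ≈-trans (≈-sym (*-assoc _ _ _)) (≈-trans (R.*-congʳ (T-comm i j dist)) (*-assoc _ _ _))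
      }
      where
      v = s j ∙ (s i ∙ w)
      short = shortWord (inv v) v refl
      c = proj₁ short
      c≈ = proj₁ (proj₂ short)
      dj′ : Descent j (s i ∙ w)
      dj′ = subst₂ Fin._<_ (cong (w ⟨$⟩ˡ_) (sym (trans (s-inv i (suc j)) (s-fix i j₁≢i₀ j₁≢i₁))))
              (cong (w ⟨$⟩ˡ_) (sym (trans (s-inv i (inject₁ j)) (s-fix i j₀≢i₀ j₀≢i₁)))) dj
      len : suc (suc (length c)) ≡ inv w
      len = trans (cong (2 ℕ.+_) (proj₂ (proj₂ short))) (sym (trans (inv-descent i w di) (cong suc (inv-descent j (s i ∙ w) dj′))))
      dist : 1 ℕ.< ℕ.∣ toℕ i - toℕ j ∣
      dist = subst (1 ℕ.<_) (sym (ℕ.m≤n⇒∣m-n∣≡n∸m (ℕ.<⇒≤ (ℕ.<-trans (ℕ.n<1+n _) far)))) (ℕ.m+n≤o⇒m≤o∸n 2 far)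

  module Near (i j : Fin m) (near : toℕ j ≡ suc (toℕ i)) where
    mid : suc i ≡ inject₁ j
    mid = Fin.toℕ-injective (sym (trans (Fin.toℕ-inject₁ j) near))
    top≢i₀ : suc j ≢ inject₁ i
    top≢i₀ = toℕ-≢ λ e → ℕ.<⇒≢ (ℕ.m≤n⇒m≤1+n (ℕ.≤-reflexive (sym near))) (sym (trans e (Fin.toℕ-inject₁ i)))
    top≢i₁ : suc j ≢ suc i
    top≢i₁ = toℕ-≢ λ e → ℕ.1+n≢n (trans (sym near) (ℕ.suc-injective e))
    bot≢j₀ : inject₁ i ≢ inject₁ j
    bot≢j₀ e = ℕ.1+n≢n (trans (sym near) (sym (trans (sym (Fin.toℕ-inject₁ i)) (trans (cong toℕ e) (Fin.toℕ-inject₁ j)))))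

    B M E : Fin n
    B = inject₁ i
    M = suc i
    E = suc j

    σ τ : Fin n → Fin n
    σ = s i ⟨$⟩ʳ_
    τ = s j ⟨$⟩ʳ_

    σB : σ B ≡ M
    σB = s-i i
    σM : σ M ≡ B
    σM = s-1+i i
    σE : σ E ≡ E
    σE = s-fix i top≢i₀ top≢i₁
    τB : τ B ≡ B
    τB = s-fix j bot≢j₀ (top≢i₀ ∘ sym)
    τM : τ M ≡ E
    τM = trans (cong τ mid) (s-i j)
    τE : τ E ≡ M
    τE = trans (s-1+i j) (sym mid)

    chain : ∀ (f g h : Fin n → Fin n) {x y z v} → h x ≡ y → g y ≡ z → f z ≡ v → f (g (h x)) ≡ v
    chain _ _ _ refl refl refl = refl

    braid : ∀ x → σ (τ (σ x)) ≡ τ (σ (τ x))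
    braid x with view i x
    ... | at-i   = trans (chain σ τ σ {B} σB τM σE) (sym (chain τ σ τ {B} τB σB τM))
    ... | at-1+i = trans (chain σ τ σ {M} σM τB σB) (sym (chain τ σ τ {M} τM σE τE))
    ... | other p q with view j x
    ...   | at-i   = ⊥-elim (q (sym mid))
    ...   | at-1+i = trans (chain σ τ σ {E} σE τE σM) (sym (chain τ σ τ {E} τE σM τB))
    ...   | other p' q' = trans (chain σ τ σ {x} σx τx σx) (sym (chain τ σ τ {x} τx σx τx))
      where
      σx = s-fix i p q
      τx = s-fix j p' q'

    diamond : ∀ w → Descent i w → Descent j w → Diamond i j w
    diamond w di dj = record
      { a = j ∷ i ∷ c ; d = i ∷ j ∷ c
      ; a≈ = λ x → trans (cong (τ ∘ σ) (c≈ x)) (trans (cong τ (s-invol i (v₂ ⟨$⟩ʳ x))) (s-invol j (v₁ ⟨$⟩ʳ x)))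
      ; d≈ = λ x → trans (cong (σ ∘ τ) (c≈ x)) (trans (cong (σ ∘ τ) (braid (w ⟨$⟩ʳ x))) (trans (cong σ (s-invol j (σ (τ (w ⟨$⟩ʳ x))))) (s-invol i (τ (w ⟨$⟩ʳ x)))))
      ; |a| = len ; |d| = len
      ; eq = begin
          T i * (T j * (T i * T-word c))  ≈⟨ *-assoc _ _ _ ⟨
          T i * T j * (T i * T-word c)    ≈⟨ *-assoc _ _ _ ⟨
          T i * T j * T i * T-word c      ≈⟨ R.*-congʳ (T-braid i j near) ⟩
          T j * T i * T j * T-word c      ≈⟨ *-assoc _ _ _ ⟩
          T j * T i * (T j * T-word c)    ≈⟨ *-assoc _ _ _ ⟩
          T j * (T i * (T j * T-word c))  ∎
      }
      where
      open ≈-R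
      v₁ = s i ∙ w
      v₂ = s j ∙ v₁
      v = s i ∙ v₂
      short = shortWord (inv v) v refl
      c = proj₁ short
      c≈ = proj₁ (proj₂ short)
      wˡ = w ⟨$⟩ˡ_
      B>M : wˡ M Fin.< wˡ B
      B>M = di
      M>E : wˡ E Fin.< wˡ M
      M>E = subst (λ z → wˡ E Fin.< wˡ z) (sym mid) dj
      v₁ˡ : ∀ x {y} → σ x ≡ y → v₁ ⟨$⟩ˡ x ≡ wˡ y
      v₁ˡ x e = cong wˡ (trans (s-inv i x) e)
      v₂ˡ : ∀ x {y z} → τ x ≡ y → σ y ≡ z → v₂ ⟨$⟩ˡ x ≡ wˡ z
      v₂ˡ x {y} e f = trans (cong (v₁ ⟨$⟩ˡ_) (trans (s-inv j x) e)) (v₁ˡ y f)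
      d₁ : Descent j v₁
      d₁ = subst₂ Fin._<_ (sym (v₁ˡ E σE)) (trans (sym (v₁ˡ M σM)) (cong (v₁ ⟨$⟩ˡ_) mid)) (ℕ.<-trans M>E B>M)
      d₂ : Descent i v₂
      d₂ = subst₂ Fin._<_ (sym (v₂ˡ M τM σE)) (sym (v₂ˡ B τB σB)) M>E
      len : suc (suc (suc (length c))) ≡ inv w
      len = trans (cong (3 ℕ.+_) (proj₂ (proj₂ short)))
        (sym (trans (inv-descent i w di) (cong suc (trans (inv-descent j v₁ d₁) (cong suc (inv-descent i v₂ d₂))))))

  diamond : ∀ i j w → i ≢ j → Descent i w → Descent j w → Diamond i j w
  diamond i j w i≢j di dj with ℕ.<-cmp (toℕ i) (toℕ j)
  ... | tri≈ _ e _ = ⊥-elim (i≢j (Fin.toℕ-injective e))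
  ... | tri< l _ _ with ℕ.m≤n⇒m<n∨m≡n l
  ...   | inj₁ far  = Far.diamond i j far w di dj
  ...   | inj₂ near = Near.diamond i j (sym near) w di dj
  diamond i j w i≢j di dj | tri> _ _ l with ℕ.m≤n⇒m<n∨m≡n l
  ...   | inj₁ far  = diamond-sym (Far.diamond j i far w dj di)
  ...   | inj₂ near = diamond-sym (Near.diamond j i (sym near) w dj di)

  -- Matsumoto's theorem: any two reduced words of w give the same product.

  matsumoto : ∀ k a d w → length a ≡ k → length d ≡ k → inv w ≡ k → ⟦ a ⟧ ≈ₛ w → ⟦ d ⟧ ≈ₛ w → T-word a ≈ T-word d
  matsumoto zero [] [] w _ _ _ _ _ = ≈-refl
  matsumoto (suc k) (i ∷ a) (j ∷ d) w la ld e p q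
    with descent-tail i a w p (trans e (sym la)) | descent-tail j d w q (trans e (sym ld))
  ... | di , a≈ , ra | dj , d≈ , rd with i Fin.≟ j
  ...   | yes refl = R.*-congˡ (matsumoto k a d (s i ∙ w) (ℕ.suc-injective la) (ℕ.suc-injective ld)
            (ℕ.suc-injective (trans (sym (inv-descent i w di)) e)) a≈ d≈)
  ...   | no i≢j = ≈-trans (R.*-congˡ (matsumoto k a D.a (s i ∙ w) (ℕ.suc-injective la) (ℕ.suc-injective (trans D.|a| e))
                     (ℕ.suc-injective (trans (sym (inv-descent i w di)) e)) a≈ D.a≈))
                   (≈-trans D.eq (R.*-congˡ (matsumoto k D.d d (s j ∙ w) (ℕ.suc-injective (trans D.|d| e)) (ℕ.suc-injective ld)
                     (ℕ.suc-injective (trans (sym (inv-descent j w dj)) e)) D.d≈ d≈)))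
    where module D = Diamond (diamond i j w i≢j di dj)

  redword : S → Word
  redword w = ReducedExpression.word (reducedExpression w)

  redword-≈ : ∀ w → ⟦ redword w ⟧ ≈ₛ w
  redword-≈ w = ReducedExpression.word-≈ (reducedExpression w)

  T-reduced : ∀ a w → ⟦ a ⟧ ≈ₛ w → length a ≡ inv w → T-word a ≈ T[ w ]
  T-reduced a w p l = matsumoto (inv w) a (redword w) w l (ℓ≡inv w) refl p (redword-≈ w)

  T-well-defined : ∀ {w} (r : ReducedExpression w) → T-word (ReducedExpression.word r) ≈ T[ w ]
  T-well-defined {w} r = T-reduced word w word-≈ (ℕ.≤-antisym
    (ℕ.≤-trans (minimal (redword w) (redword-≈ w)) (ℕ.≤-reflexive (ℓ≡inv w)))
    (ℕ.≤-trans (ℕ.≤-reflexive (sym (inv-cong {⟦ word ⟧} {w} word-≈))) (inv-⟦⟧ word)))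
    where open ReducedExpression r

  T-cong : ∀ {w v} → w ≈ₛ v → T[ w ] ≈ T[ v ]
  T-cong {w} {v} e = T-reduced (redword w) v (λ x → trans (redword-≈ w x) (e x)) (trans (ℓ≡inv w) (inv-cong {w} {v} e))

  T-id : T[ Perm.id ] ≈ 1#
  T-id = ≈-sym (T-reduced [] Perm.id (λ _ → refl) (sym inv-id))

  T-ascent : ∀ i w → Ascent i w → T i * T[ w ] ≈ T[ s i ∙ w ]
  T-ascent i w a = T-reduced (i ∷ redword w) (s i ∙ w) (λ x → cong (s i ⟨$⟩ʳ_) (redword-≈ w x))
    (trans (cong suc (ℓ≡inv w)) (sym (inv-ascent i w a)))

  T-descent : ∀ i w → Descent i w → T i * T[ w ] ≈ (t + - 1#) * T[ w ] + t * T[ s i ∙ w ]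
  T-descent i w d = begin
    T i * T[ w ]                                    ≈⟨ R.*-congˡ Tw ⟨
    T i * (T i * T[ s i ∙ w ])                      ≈⟨ *-assoc _ _ _ ⟨
    T i * T i * T[ s i ∙ w ]                        ≈⟨ R.*-congʳ (T-quadratic i) ⟩
    ((t + - 1#) * T i + t) * T[ s i ∙ w ]           ≈⟨ distribʳ _ _ _ ⟩
    (t + - 1#) * T i * T[ s i ∙ w ] + t * T[ s i ∙ w ]    ≈⟨ R.+-congʳ (*-assoc _ _ _) ⟩
    (t + - 1#) * (T i * T[ s i ∙ w ]) + t * T[ s i ∙ w ]  ≈⟨ R.+-congʳ (R.*-congˡ Tw) ⟩
    (t + - 1#) * T[ w ] + t * T[ s i ∙ w ]          ∎
    where
    open ≈-R
    Tw : T i * T[ s i ∙ w ] ≈ T[ w ]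
    Tw = ≈-trans (T-ascent i (s i ∙ w) (descent-s i w d)) (T-cong {s i ∙ (s i ∙ w)} {w} (ss i w))

  T-right : ∀ j w → w ⟨$⟩ʳ inject₁ j Fin.< w ⟨$⟩ʳ suc j → T[ w ] * T j ≈ T[ w ∙ s j ]
  T-right j w l = ≈-trans (≈-sym (++j a)) (T-reduced (a ++ j ∷ []) (w ∙ s j) (λ x → trans (⟦++j⟧ a x) (word-≈ (s j ⟨$⟩ʳ x))) len)
    where
    open ReducedExpression (reducedExpression w) renaming (word to a)
    ++j : ∀ a → T-word (a ++ j ∷ []) ≈ T-word a * T j
    ++j []      = ≈-trans (*-identityʳ _) (≈-sym (*-identityˡ _))
    ++j (i ∷ a) = ≈-trans (R.*-congˡ (++j a)) (≈-sym (*-assoc _ _ _))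
    ⟦++j⟧ : ∀ a x → ⟦ a ++ j ∷ [] ⟧ ⟨$⟩ʳ x ≡ ⟦ a ⟧ ⟨$⟩ʳ (s j ⟨$⟩ʳ x)
    ⟦++j⟧ []      x = refl
    ⟦++j⟧ (i ∷ a) x = cong (s i ⟨$⟩ʳ_) (⟦++j⟧ a x)
    flip≈ : flip (w ∙ s j) ≈ₛ s j ∙ flip w
    flip≈ x = s-inv j (w ⟨$⟩ˡ x)
    len : length (a ++ j ∷ []) ≡ inv (w ∙ s j)
    len = trans (List.length-++ a) (trans (ℕ.+-comm _ 1) (trans (cong suc (trans (ℓ≡inv w) (sym (inv-flip w))))
      (trans (sym (inv-ascent j (flip w) l)) (trans (sym (inv-cong {flip (w ∙ s j)} {s j ∙ flip w} flip≈)) (inv-flip (w ∙ s j))))))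

  Weight : Set
  Weight = Fin n → ℤ

  infixr 8 _·_
  _·_ : S → Weight → Weight
  (w · μ) x = μ (w ⟨$⟩ˡ x)

  ϖ : ℕ → Weight
  ϖ k x = if does (toℕ x ℕ.<? k) then 1ℤ else 0ℤ

  Stabilizes : Weight → S → Set
  Stabilizes μ w = ∀ x → (w · μ) x ≡ μ x

  stabilizes? : ∀ μ → Decidable (Stabilizes μ)
  stabilizes? μ w = Fin.all? λ x → (w · μ) x ℤ.≟ μ x

  𝟏 : Weight → H
  𝟏 μ = ∑[ w ∈ filter (stabilizes? μ) (permutations n) ] T[ w ]

  𝟏₀ : H
  𝟏₀ = ∑[ w ∈ permutations n ] T[ w ]

  -- The ℤ[t, t⁻¹]-subalgebra generated by the T i.

  data Hₙ : H → Set where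
    resp : ∀ {x y} → x ≈ y → Hₙ x → Hₙ y
    gen  : ∀ i → Hₙ (T i)
    t∈   : Hₙ t
    t⁻¹∈ : Hₙ t⁻¹
    0∈   : Hₙ 0#
    1∈   : Hₙ 1#
    +∈   : ∀ {x y} → Hₙ x → Hₙ y → Hₙ (x + y)
    *∈   : ∀ {x y} → Hₙ x → Hₙ y → Hₙ (x * y)
    -∈   : ∀ {x} → Hₙ x → Hₙ (- x)

  -- H⟨ μ ⟩ is H_{n,μ}, the ℤ[t, t⁻¹]-span of the T[ w ] with w μ = μ.

  data H⟨_⟩ (μ : Weight) : H → Set where
    resp : ∀ {x y} → x ≈ y → H⟨ μ ⟩ x → H⟨ μ ⟩ y
    gen  : ∀ w → Stabilizes μ w → H⟨ μ ⟩ T[ w ]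
    0∈   : H⟨ μ ⟩ 0#
    +∈   : ∀ {x y} → H⟨ μ ⟩ x → H⟨ μ ⟩ y → H⟨ μ ⟩ (x + y)
    -∈   : ∀ {x} → H⟨ μ ⟩ x → H⟨ μ ⟩ (- x)
    t*∈   : ∀ {x} → H⟨ μ ⟩ x → H⟨ μ ⟩ (t * x)
    t⁻¹*∈ : ∀ {x} → H⟨ μ ⟩ x → H⟨ μ ⟩ (t⁻¹ * x)

  -- An expression h = ∑_F T_{u_F} h_F with h_F ∈ H_{n,ϖ_ℓ}.  Existence for
  -- h ∈ Hₙ is decompose below.  The components are unique up to _≈_ because
  -- the T[ w ] are a basis of Hₙ, so Ψ does not depend on the choice made there.

  record Decomposition (ℓ : ℕ) (h : H) : Set where
    constructor decomposition
    field
      component   : Column n ℓ → H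
      component∈  : ∀ F → H⟨ ϖ ℓ ⟩ (component F)
      recompose   : h ≈ ∑[ F ∈ columns n ℓ ] (T[ u F ] * component F)

  open Decomposition

  ∑-cong : ∀ {A : Set} {f g : A → H} xs → (∀ x → f x ≈ g x) → ∑ xs f ≈ ∑ xs g
  ∑-cong []       e = ≈-refl
  ∑-cong (x ∷ xs) e = +-cong (e x) (∑-cong xs e)

  ∑-zero : ∀ {A : Set} {f : A → H} xs → (∀ {x} → x ∈ xs → f x ≈ 0#) → ∑ xs f ≈ 0#
  ∑-zero []       e = ≈-refl
  ∑-zero (x ∷ xs) e = ≈-trans (+-cong (e (here refl)) (∑-zero xs (e ∘ there))) (+-identityˡ 0#)

  ∑-single : ∀ {A : Set} {f : A → H} {xs} {x} → Unique xs → x ∈ xs → (∀ {y} → y ≢ x → f y ≈ 0#) → ∑ xs f ≈ f x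
  ∑-single {xs = _ ∷ xs} (ne ∷ uq) (here refl) z = ≈-trans (R.+-congˡ (∑-zero xs λ y∈ → z λ e → All.lookup ne y∈ (sym e))) (R.+-identityʳ _)
  ∑-single (ne ∷ uq) (there x∈) z = ≈-trans (+-cong (z λ e → All.lookup ne x∈ e) (∑-single uq x∈ z)) (+-identityˡ _)

  ∑-+ : ∀ {A : Set} (f g : A → H) xs → ∑ xs f + ∑ xs g ≈ ∑[ x ∈ xs ] (f x + g x)
  ∑-+ f g []       = +-identityˡ 0#
  ∑-+ f g (x ∷ xs) = begin
    (f x + ∑ xs f) + (g x + ∑ xs g)    ≈⟨ +-assoc _ _ _ ⟩
    f x + (∑ xs f + (g x + ∑ xs g))    ≈⟨ R.+-congˡ (+-assoc _ _ _) ⟨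
    f x + (∑ xs f + g x + ∑ xs g)      ≈⟨ R.+-congˡ (R.+-congʳ (+-comm _ _)) ⟩
    f x + (g x + ∑ xs f + ∑ xs g)      ≈⟨ R.+-congˡ (+-assoc _ _ _) ⟩
    f x + (g x + (∑ xs f + ∑ xs g))    ≈⟨ +-assoc _ _ _ ⟨
    (f x + g x) + (∑ xs f + ∑ xs g)    ≈⟨ R.+-congˡ (∑-+ f g xs) ⟩
    (f x + g x) + (∑[ x ∈ xs ] (f x + g x))  ∎
    where open ≈-R

  ∑-*ˡ : ∀ {A : Set} y (f : A → H) xs → y * ∑ xs f ≈ ∑[ x ∈ xs ] (y * f x)
  ∑-*ˡ y f []       = R.zeroʳ y
  ∑-*ˡ y f (x ∷ xs) = ≈-trans (distribˡ _ _ _) (R.+-congˡ (∑-*ˡ y f xs))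

  ∑-neg : ∀ {A : Set} (f : A → H) xs → - ∑ xs f ≈ ∑[ x ∈ xs ] (- f x)
  ∑-neg f []       = RP.-0#≈0#
  ∑-neg f (x ∷ xs) = ≈-trans (≈-sym (RP.-‿+-comm _ _)) (R.+-congˡ (∑-neg f xs))

  private
    variable
      ℓ′ : ℕ

  D-resp : ∀ {x y} → x ≈ y → Decomposition ℓ′ x → Decomposition ℓ′ y
  D-resp e (decomposition c c∈ r) = decomposition c c∈ (≈-trans (≈-sym e) r)

  private
    term : (Column n ℓ′ → H) → Column n ℓ′ → H
    term c F = T[ u F ] * c F

  D-0 : Decomposition ℓ′ 0#
  D-0 {ℓ′} = decomposition (λ _ → 0#) (λ _ → 0∈) (≈-sym (∑-zero {f = term (λ _ → 0#)} (columns n ℓ′) λ _ → R.zeroʳ _))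

  D-+ : ∀ {x y} → Decomposition ℓ′ x → Decomposition ℓ′ y → Decomposition ℓ′ (x + y)
  D-+ {ℓ′} (decomposition c c∈ r) (decomposition d d∈ q) = decomposition (λ F → c F + d F) (λ F → +∈ (c∈ F) (d∈ F))
    (≈-trans (+-cong r q) (≈-trans (∑-+ (term c) (term d) (columns n ℓ′))
      (∑-cong {f = λ F → term c F + term d F} {g = term λ F → c F + d F} (columns n ℓ′) λ F → ≈-sym (distribˡ _ _ _))))

  D-neg : ∀ {x} → Decomposition ℓ′ x → Decomposition ℓ′ (- x)
  D-neg {ℓ′} (decomposition c c∈ r) = decomposition (λ F → - c F) (λ F → -∈ (c∈ F))
    (≈-trans (-‿cong r) (≈-trans (∑-neg (term c) (columns n ℓ′))
      (∑-cong {f = λ F → - term c F} {g = term λ F → - c F} (columns n ℓ′) λ F → RP.-‿distribʳ-* _ _)))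

  D-scale : ∀ z → (∀ x → z * x ≈ x * z) → (∀ {x} → H⟨ ϖ ℓ′ ⟩ x → H⟨ ϖ ℓ′ ⟩ (z * x)) → ∀ {x} → Decomposition ℓ′ x → Decomposition ℓ′ (z * x)
  D-scale {ℓ′} z central z∈ (decomposition c c∈ r) = decomposition (λ F → z * c F) (λ F → z∈ (c∈ F))
    (≈-trans (R.*-congˡ r) (≈-trans (∑-*ˡ z (term c) (columns n ℓ′))
      (∑-cong {f = λ F → z * term c F} {g = term λ F → z * c F} (columns n ℓ′) λ F →
        ≈-trans (≈-sym (*-assoc _ _ _)) (≈-trans (R.*-congʳ (central _)) (*-assoc _ _ _)))))

  D-single : ∀ (F : Column n ℓ′) {x} → H⟨ ϖ ℓ′ ⟩ x → Decomposition ℓ′ (T[ u F ] * x)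
  D-single {ℓ′} F {x} x∈ = decomposition c c∈ (≈-sym (≈-trans
      (∑-single {f = term c} (columns-unique n ℓ′) (columns-complete F) λ {G} G≢F → ≈-trans (R.*-congˡ (≈-reflexive (off G G≢F))) (R.zeroʳ _))
      (R.*-congˡ (≈-reflexive on))))
    where
    ≈-reflexive : ∀ {x y} → x ≡ y → x ≈ y
    ≈-reflexive refl = ≈-refl
    c : Column n ℓ′ → H
    c G = if does (G ≟ᶜ F) then x else 0#
    c∈ : ∀ G → H⟨ ϖ ℓ′ ⟩ (c G)
    c∈ G with does (G ≟ᶜ F)
    ... | true  = x∈
    ... | false = 0∈
    off : ∀ G → G ≢ F → c G ≡ 0#
    off G ne rewrite dec-false (G ≟ᶜ F) ne = refl
    on : c F ≡ x
    on rewrite dec-true (F ≟ᶜ F) refl = refl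

  D-∑ : ∀ {A : Set} {f : A → H} xs → (∀ x → Decomposition ℓ′ (f x)) → Decomposition ℓ′ (∑ xs f)
  D-∑ []       D = D-0
  D-∑ (x ∷ xs) D = D-+ (D x) (D-∑ xs D)

  s-stabilizes : ∀ j {ℓ} → suc (toℕ j) ≢ ℓ → Stabilizes (ϖ ℓ) (s j)
  s-stabilizes j {ℓ} ne x = trans (cong (ϖ ℓ) (s-inv j x)) go
    where
    same : ϖ ℓ (inject₁ j) ≡ ϖ ℓ (suc j)
    same with ℕ.<-cmp (suc (toℕ j)) ℓ
    ... | tri< l _ _ rewrite Fin.toℕ-inject₁ j | dec-true (toℕ j ℕ.<? ℓ) (ℕ.<-trans (ℕ.n<1+n _) l) | dec-true (suc (toℕ j) ℕ.<? ℓ) l = refl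
    ... | tri≈ _ e _ = ⊥-elim (ne e)
    ... | tri> _ _ g rewrite Fin.toℕ-inject₁ j | dec-false (toℕ j ℕ.<? ℓ) (ℕ.≤⇒≯ (ℕ.s≤s⁻¹ g)) | dec-false (suc (toℕ j) ℕ.<? ℓ) (ℕ.<-asym g) = refl
    go : ϖ ℓ (s j ⟨$⟩ʳ x) ≡ ϖ ℓ x
    go with view j x
    ... | at-i = trans (cong (ϖ ℓ) (s-i j)) (sym same)
    ... | at-1+i = trans (cong (ϖ ℓ) (s-1+i j)) same
    ... | other p q = cong (ϖ ℓ) (s-fix j p q)

  T*∈ : ∀ {μ} j → Stabilizes μ (s j) → ∀ {x} → H⟨ μ ⟩ x → H⟨ μ ⟩ (T j * x)
  T*∈ j st (resp e x∈) = resp (R.*-congˡ e) (T*∈ j st x∈)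
  T*∈ {μ} j st (gen w stw) = go (ascent? j w)
    where
    st′ : Stabilizes μ (s j ∙ w)
    st′ x = trans (stw (s j ⟨$⟩ˡ x)) (st x)
    go : Ascent j w ⊎ Descent j w → H⟨ μ ⟩ (T j * T[ w ])
    go (inj₁ a) = resp (≈-sym (T-ascent j w a)) (gen (s j ∙ w) st′)
    go (inj₂ d) = resp (≈-sym (≈-trans (T-descent j w d) (R.+-congʳ (≈-trans (distribʳ _ _ _)
        (R.+-congˡ (≈-trans (≈-sym (RP.-‿distribˡ-* _ _)) (-‿cong (*-identityˡ _))))))))
      (+∈ (+∈ (t*∈ (gen w stw)) (-∈ (gen w stw))) (t*∈ (gen (s j ∙ w) st′)))
  T*∈ j st 0∈ = resp (≈-sym (R.zeroʳ _)) 0∈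
  T*∈ j st (+∈ x∈ y∈) = resp (≈-sym (distribˡ _ _ _)) (+∈ (T*∈ j st x∈) (T*∈ j st y∈))
  T*∈ j st (-∈ x∈) = resp (RP.-‿distribʳ-* _ _) (-∈ (T*∈ j st x∈))
  T*∈ j st (t*∈ x∈) = resp (≈-trans (≈-sym (*-assoc _ _ _)) (≈-trans (R.*-congʳ (t-central _)) (*-assoc _ _ _))) (t*∈ (T*∈ j st x∈))
  T*∈ j st (t⁻¹*∈ x∈) = resp (≈-trans (≈-sym (*-assoc _ _ _)) (≈-trans (R.*-congʳ (t⁻¹-central _)) (*-assoc _ _ _))) (t⁻¹*∈ (T*∈ j st x∈))

  D-T-column : ∀ i (F : Column n ℓ′) {x} → H⟨ ϖ ℓ′ ⟩ x → Decomposition ℓ′ (T i * (T[ u F ] * x))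
  D-T-column {ℓ′} i F {x} x∈ with step i F
  ... | up G e a = D-resp (≈-trans (R.*-congʳ (≈-sym (≈-trans (T-ascent i (u F) a) (T-cong {s i ∙ u F} {u G} su)))) (*-assoc _ _ _)) (D-single G x∈)
    where
    su : s i ∙ u F ≈ₛ u G
    su y = trans (sym (Perm.inverseʳ (u G))) (cong (u G ⟨$⟩ʳ_) (trans (e _) (trans (cong (u F ⟨$⟩ˡ_) (s-invol i (u F ⟨$⟩ʳ y))) (Perm.inverseˡ (u F)))))
  ... | down G e d = D-resp eq (D-+ (D-+ (D-scale t t-central t*∈ (D-single F x∈)) (D-neg (D-single F x∈))) (D-scale t t-central t*∈ (D-single G x∈)))
    where
    open ≈-R
    su : s i ∙ u F ≈ₛ u G
    su y = trans (sym (Perm.inverseʳ (u G))) (cong (u G ⟨$⟩ʳ_) (trans (e _) (trans (cong (u F ⟨$⟩ˡ_) (s-invol i (u F ⟨$⟩ʳ y))) (Perm.inverseˡ (u F)))))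
    eq : t * (T[ u F ] * x) + - (T[ u F ] * x) + t * (T[ u G ] * x) ≈ T i * (T[ u F ] * x)
    eq = begin
      t * (T[ u F ] * x) + - (T[ u F ] * x) + t * (T[ u G ] * x)          ≈⟨ R.+-congʳ (R.+-congˡ (RP.-1*x≈-x _)) ⟨
      t * (T[ u F ] * x) + - 1# * (T[ u F ] * x) + t * (T[ u G ] * x)     ≈⟨ R.+-congʳ (distribʳ _ _ _) ⟨
      (t + - 1#) * (T[ u F ] * x) + t * (T[ u G ] * x)                    ≈⟨ +-cong (*-assoc _ _ _) (*-assoc _ _ _) ⟨
      (t + - 1#) * T[ u F ] * x + t * T[ u G ] * x                        ≈⟨ distribʳ _ _ _ ⟨
      ((t + - 1#) * T[ u F ] + t * T[ u G ]) * x                          ≈⟨ R.*-congʳ (R.+-congˡ (R.*-congˡ (T-cong {s i ∙ u F} {u G} su))) ⟨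
      ((t + - 1#) * T[ u F ] + t * T[ s i ∙ u F ]) * x                    ≈⟨ R.*-congʳ (T-descent i (u F) d) ⟨
      T i * T[ u F ] * x                                                  ≈⟨ *-assoc _ _ _ ⟩
      T i * (T[ u F ] * x)                                                ∎
  ... | stay j p q ne = D-resp eq (D-single F (T*∈ j (s-stabilizes j ne) x∈))
    where
    open ≈-R
    uj : u F ⟨$⟩ʳ inject₁ j ≡ inject₁ i
    uj = trans (cong (u F ⟨$⟩ʳ_) (sym p)) (Perm.inverseʳ (u F))
    uj+1 : u F ⟨$⟩ʳ suc j ≡ suc i
    uj+1 = trans (cong (u F ⟨$⟩ʳ_) (sym q)) (Perm.inverseʳ (u F))
    i<i+1 : inject₁ i Fin.< suc i
    i<i+1 = s≤s (ℕ.≤-reflexive (Fin.toℕ-inject₁ i))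
    j<j+1 : inject₁ j Fin.< suc j
    j<j+1 = s≤s (ℕ.≤-reflexive (Fin.toℕ-inject₁ j))
    us≈su : u F ∙ s j ≈ₛ s i ∙ u F
    us≈su y with view j y
    ... | at-i   = trans (cong (u F ⟨$⟩ʳ_) (s-i j)) (trans uj+1 (sym (trans (cong (s i ⟨$⟩ʳ_) uj) (s-i i))))
    ... | at-1+i = trans (cong (u F ⟨$⟩ʳ_) (s-1+i j)) (trans uj (sym (trans (cong (s i ⟨$⟩ʳ_) uj+1) (s-1+i i))))
    ... | other a b = trans (cong (u F ⟨$⟩ʳ_) (s-fix j a b))
            (sym (s-fix i (λ e → a (w-inj (u F) (trans e (sym uj)))) (λ e → b (w-inj (u F) (trans e (sym uj+1))))))
    eq : T[ u F ] * (T j * x) ≈ T i * (T[ u F ] * x)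
    eq = begin
      T[ u F ] * (T j * x)   ≈⟨ *-assoc _ _ _ ⟨
      T[ u F ] * T j * x     ≈⟨ R.*-congʳ (T-right j (u F) (subst₂ Fin._<_ (sym uj) (sym uj+1) i<i+1)) ⟩
      T[ u F ∙ s j ] * x     ≈⟨ R.*-congʳ (T-cong {u F ∙ s j} {s i ∙ u F} us≈su) ⟩
      T[ s i ∙ u F ] * x     ≈⟨ R.*-congʳ (T-ascent i (u F) (subst₂ Fin._<_ (sym p) (sym q) j<j+1)) ⟨
      T i * T[ u F ] * x     ≈⟨ *-assoc _ _ _ ⟩
      T i * (T[ u F ] * x)   ∎

  D-1 : ℓ′ ℕ.≤ n → Decomposition ℓ′ 1#
  D-1 {ℓ′} ℓ≤n = D-resp (≈-trans (*-cong (≈-trans (T-cong {u F} {Perm.id} u≈id) T-id) T-id) (*-identityˡ 1#)) (D-single F (gen Perm.id λ _ → refl))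
    where
    F = highest ℓ≤n
    u≈id : u F ≈ₛ Perm.id
    u≈id x = trans (cong (u F ⟨$⟩ʳ_) (sym (u⁻¹-highest ℓ≤n x))) (Perm.inverseʳ (u F))

  D-* : ∀ {x} → Hₙ x → ∀ {y} → Decomposition ℓ′ y → Decomposition ℓ′ (x * y)
  D-* (resp e x∈) D = D-resp (R.*-congʳ e) (D-* x∈ D)
  D-* {ℓ′} (gen i) (decomposition c c∈ r) = D-resp (≈-sym (≈-trans (R.*-congˡ r) (∑-*ˡ (T i) (term c) (columns n ℓ′))))
    (D-∑ (columns n ℓ′) λ F → D-T-column i F (c∈ F))
  D-* t∈ D = D-scale t t-central t*∈ D
  D-* t⁻¹∈ D = D-scale t⁻¹ t⁻¹-central t⁻¹*∈ D
  D-* 0∈ D = D-resp (≈-sym (R.zeroˡ _)) D-0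
  D-* 1∈ D = D-resp (≈-sym (*-identityˡ _)) D
  D-* (+∈ x∈ y∈) D = D-resp (≈-sym (distribʳ _ _ _)) (D-+ (D-* x∈ D) (D-* y∈ D))
  D-* (*∈ x∈ y∈) D = D-resp (≈-sym (*-assoc _ _ _)) (D-* x∈ (D-* y∈ D))
  D-* (-∈ x∈) D = D-resp (RP.-‿distribˡ-* _ _) (D-neg (D-* x∈ D))

  decompose : ∀ {ℓ h} → ℓ ℕ.≤ n → Hₙ h → Decomposition ℓ h
  decompose ℓ≤n h∈ = D-resp (*-identityʳ _) (D-* h∈ (D-1 ℓ≤n))

  T-word∈Hₙ : ∀ a → Hₙ (T-word a)
  T-word∈Hₙ []      = 1∈
  T-word∈Hₙ (i ∷ a) = *∈ (gen i) (T-word∈Hₙ a)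

  T-word⁻¹∈Hₙ : ∀ a → Hₙ (T-word⁻¹ a)
  T-word⁻¹∈Hₙ []      = 1∈
  T-word⁻¹∈Hₙ (i ∷ a) = *∈ (T-word⁻¹∈Hₙ a) (*∈ t⁻¹∈ (+∈ (gen i) (+∈ 1∈ (-∈ t∈))))

  ∑∈Hₙ : ∀ {A : Set} {f : A → H} xs → (∀ x → Hₙ (f x)) → Hₙ (∑ xs f)
  ∑∈Hₙ []       f∈ = 0∈
  ∑∈Hₙ (x ∷ xs) f∈ = +∈ (f∈ x) (∑∈Hₙ xs f∈)

  t^∈Hₙ : ∀ k → Hₙ (t ^ k)
  t^∈Hₙ zero    = 1∈
  t^∈Hₙ (suc k) = *∈ t∈ (t^∈Hₙ k)

  H⟨⟩⊆Hₙ : ∀ {μ x} → H⟨ μ ⟩ x → Hₙ x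
  H⟨⟩⊆Hₙ (resp e x∈)  = resp e (H⟨⟩⊆Hₙ x∈)
  H⟨⟩⊆Hₙ (gen w _)    = T-word∈Hₙ (redword w)
  H⟨⟩⊆Hₙ 0∈           = 0∈
  H⟨⟩⊆Hₙ (+∈ x∈ y∈)   = +∈ (H⟨⟩⊆Hₙ x∈) (H⟨⟩⊆Hₙ y∈)
  H⟨⟩⊆Hₙ (-∈ x∈)      = -∈ (H⟨⟩⊆Hₙ x∈)
  H⟨⟩⊆Hₙ (t*∈ x∈)     = *∈ t∈ (H⟨⟩⊆Hₙ x∈)
  H⟨⟩⊆Hₙ (t⁻¹*∈ x∈)   = *∈ t⁻¹∈ (H⟨⟩⊆Hₙ x∈)

  -- Tensor (ℓ_r ∷ … ∷ ℓ_1 ∷ []) is B(ϖ_{ℓ_r}) ⊗ … ⊗ B(ϖ_{ℓ_1}).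

  Tensor : List ℕ → Set
  Tensor = All (Column n)

  infixr 5 _⊗_
  _⊗_ : ∀ {k ks} → Column n k → Tensor ks → Tensor (k ∷ ks)
  _⊗_ = _∷_

  -- t^{ℓ(u_C)} (T_{u_C⁻¹})⁻¹

  leading : ∀ {k} → Column n k → H
  leading C = t ^ ℓ (u C) * T[ flip (u C) ]⁻¹

  leading∈ : ∀ {k} (C : Column n k) → Hₙ (leading C)
  leading∈ C = *∈ (t^∈Hₙ (ℓ (u C))) (T-word⁻¹∈Hₙ (redword (flip (u C))))

  -- Ψ of the empty tensor product, which is needed for λ = 0, is 𝟏₀.  The
  -- one-column clause is consistent with it: h_{C,∅} = 𝟏 (ϖ k), since
  -- 𝟏₀ = ∑_E T_{u_E} 𝟏 (ϖ k).

  Ψ    : ∀ {ks} → Tensor ks → H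
  Ψ∈Hₙ : ∀ {ks} (P : Tensor ks) → Hₙ (Ψ P)

  Ψ []                    = 𝟏₀
  Ψ (_∷_ {k} C [])        = leading C * 𝟏 (ϖ k)
  Ψ (C ∷ P@(_ ∷ _))       = leading C * component (decompose (length≤ C) (Ψ∈Hₙ P)) C

  Ψ∈Hₙ []                 = ∑∈Hₙ (permutations n) λ w → T-word∈Hₙ (redword w)
  Ψ∈Hₙ (_∷_ {k} C [])     = *∈ (leading∈ C) (∑∈Hₙ (filter (stabilizes? (ϖ k)) (permutations n)) λ w → T-word∈Hₙ (redword w))
  Ψ∈Hₙ (C ∷ P@(_ ∷ _))    = *∈ (leading∈ C) (H⟨⟩⊆Hₙ (component∈ (decompose (length≤ C) (Ψ∈Hₙ P)) C))

  X^ℤ : Fin n → ℤ → H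
  X^ℤ i (+ k)      = X i ^ k
  X^ℤ i (-[1+ k ]) = X⁻¹ i ^ suc k

  X^ : Weight → H
  X^ μ = ∏ (allFin n) λ i → X^ℤ i (μ i)

  Xᶜ : ∀ {k} → Column n k → H
  Xᶜ {k} C = ∏ (allFin k) λ i → X (entry C i)

  Xᵀ : ∀ {ks} → Tensor ks → H
  Xᵀ []      = 1#
  Xᵀ (C ∷ P) = Xᶜ C * Xᵀ P

  -- Weak increase along the rows of two adjacent columns.

  _≼_ : ∀ {k l} → Column n k → Column n l → Set
  C ≼ D = ∀ i j → toℕ i ≡ toℕ j → entry C i Fin.≤ entry D j

  _≼?_ : ∀ {k l} (C : Column n k) (D : Column n l) → Dec (C ≼ D)
  C ≼? D = Fin.all? λ i → Fin.all? λ j → (toℕ i ℕ.≟ toℕ j) →-dec (entry C i Fin.≤? entry D j)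

  data Semistandard : ∀ {ks} → Tensor ks → Set where
    []  : Semistandard []
    [-] : ∀ {k} {C : Column n k} → Semistandard (C ∷ [])
    _∷_ : ∀ {k l ks} {C : Column n k} {D : Column n l} {P : Tensor ks} →
          C ≼ D → Semistandard (D ∷ P) → Semistandard (C ∷ D ∷ P)

  semistandard? : ∀ {ks} (P : Tensor ks) → Dec (Semistandard P)
  semistandard? []          = yes []
  semistandard? (C ∷ [])    = yes [-]
  semistandard? (C ∷ D ∷ P) = map′ (λ (p , q) → p ∷ q) (λ { (p ∷ q) → p , q }) (C ≼? D ×-dec semistandard? (D ∷ P))

  tensors : ∀ ks → List (Tensor ks)
  tensors []       = [] ∷ []
  tensors (k ∷ ks) = cartesianProductWith _⊗_ (columns n k) (tensors ks)

  tensors-complete : ∀ {ks} (P : Tensor ks) → P ∈ tensors ks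
  tensors-complete []      = here refl
  tensors-complete (C ∷ P) = ∈.∈-cartesianProductWith⁺ _⊗_ (columns-complete C) (tensors-complete P)

  tensors-unique : ∀ ks → Unique (tensors ks)
  tensors-unique []       = [] ∷ []
  tensors-unique (k ∷ ks) = Unique.cartesianProductWith⁺ _⊗_ (λ { refl → refl , refl }) (columns-unique n k) (tensors-unique ks)

  -- The admissible lists ℓ_r ∷ … ∷ ℓ_1 ∷ [] of column lengths, left to right.

  ColumnLengths : List ℕ → Set
  ColumnLengths ks = All (λ k → 1 ℕ.≤ k × k ℕ.≤ n) ks × Linked ℕ._≥_ ks

  Dominant : Weight → Set
  Dominant μ = (∀ x → 0ℤ ℤ.≤ μ x) × (∀ i → μ (suc i) ℤ.≤ μ (inject₁ i))

  -- The (j+1)-st column of the diagram of μ has length #{x : μ x ≥ j+1}.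

  columnLength : Weight → ℕ → ℕ
  columnLength μ j = length (filter (λ x → + suc j ℤ.≤? μ x) (allFin n))

  columnLengths : Weight → List ℕ
  columnLengths μ = applyUpTo (columnLength μ) ℤ.∣ μ zero ∣

  B : (μ : Weight) → List (Tensor (columnLengths μ))
  B μ = filter semistandard? (tensors (columnLengths μ))

  ∑ϖ : List ℕ → Weight
  ∑ϖ ks x = foldr (λ k z → ϖ k x ℤ.+ z) 0ℤ ks

  private
    initial-segment : ∀ {A : Set} {P : A → Set} (P? : Decidable P) {k} (f : Fin k → A) →
      (∀ x y → x Fin.≤ y → P (f y) → P (f x)) → ∀ x →
      (toℕ x ℕ.< length (filter P? (tabulate f)) → P (f x)) × (P (f x) → toℕ x ℕ.< length (filter P? (tabulate f)))
    initial-segment P? {suc k} f closed x with P? (f zero)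
    initial-segment P? {suc k} f closed zero | yes p = (λ _ → p) , (λ _ → s≤s z≤n)
    initial-segment P? {suc k} f closed (suc x) | yes p
      with initial-segment P? (f ∘ suc) (λ x y l → closed (suc x) (suc y) (s≤s l)) x
    ... | to , from = to ∘ ℕ.s<s⁻¹ , s≤s ∘ from
    initial-segment P? {suc k} f closed x | no ¬p =
        (λ l → ⊥-elim (ℕ.n≮0 (subst (toℕ x ℕ.<_) (cong length (List.filter-none P? (All.tabulate⁺ λ y → none (suc y)))) l)))
      , (λ p → ⊥-elim (none x p))
      where
      none : ∀ y → ¬ _
      none y p = ¬p (closed zero y z≤n p)

    sum-initial : ∀ N a (c : ℕ → ℕ) x → a ℕ.≤ N → (∀ j → (toℕ x ℕ.< c j → j ℕ.< a) × (j ℕ.< a → toℕ x ℕ.< c j)) →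
      ∑ϖ (applyUpTo c N) x ≡ + a
    sum-initial zero    zero    c x _ _ = refl
    sum-initial (suc N) zero    c x _ h
      rewrite dec-false (toℕ x ℕ.<? c 0) (λ l → ℕ.n≮0 (proj₁ (h 0) l))
            | sum-initial N zero (c ∘ suc) x z≤n (λ j → (λ l → ⊥-elim (ℕ.n≮0 (proj₁ (h (suc j)) l))) , λ ()) = refl
    sum-initial (suc N) (suc a) c x (s≤s l) h
      rewrite dec-true (toℕ x ℕ.<? c 0) (proj₂ (h 0) (s≤s z≤n))
            | sum-initial N a (c ∘ suc) x l (λ j → ℕ.s<s⁻¹ ∘ proj₁ (h (suc j)) , proj₂ (h (suc j)) ∘ s≤s) = refl

  module _ (μ : Weight) (dominant : Dominant μ) where
    private
      decreasing : ∀ x y → x Fin.≤ y → μ y ℤ.≤ μ x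
      decreasing x y x≤y = Fin.<-weakInduction-startingFrom (λ y → μ y ℤ.≤ μ x) ℤ.≤-refl
        (λ j h → ℤ.≤-trans (proj₂ dominant j) h) x≤y

      +∣μ∣ : ∀ x → + ℤ.∣ μ x ∣ ≡ μ x
      +∣μ∣ x = ℤ.0≤i⇒+∣i∣≡i (proj₁ dominant x)

      segment : ∀ j x → (toℕ x ℕ.< columnLength μ j → + suc j ℤ.≤ μ x) × (+ suc j ℤ.≤ μ x → toℕ x ℕ.< columnLength μ j)
      segment j = initial-segment (λ x → + suc j ℤ.≤? μ x) (λ x → x) (λ x y x≤y p → ℤ.≤-trans p (decreasing x y x≤y))

      columnLength≤n : ∀ j → columnLength μ j ℕ.≤ n
      columnLength≤n j = ℕ.≤-trans (List.length-filter (λ x → + suc j ℤ.≤? μ x) (allFin n)) (ℕ.≤-reflexive (List.length-tabulate {n = n} (λ x → x)))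

    columnLengths-valid : ColumnLengths (columnLengths μ)
    columnLengths-valid =
        All.applyUpTo⁺₁ (columnLength μ) ℤ.∣ μ zero ∣ (λ {j} j< →
          proj₂ (segment j zero) (subst (+ suc j ℤ.≤_) (+∣μ∣ zero) (ℤ.+≤+ j<)) , columnLength≤n j)
      , Linked.applyUpTo⁺₂ (columnLength μ) ℤ.∣ μ zero ∣ (λ j → ℕ.≮⇒≥ (antitone j))
      where
      antitone : ∀ j → ¬ columnLength μ j ℕ.< columnLength μ (suc j)
      antitone j l = ℕ.<-irrefl (Fin.toℕ-fromℕ< c<n) (proj₂ (segment j x)
          (ℤ.≤-trans (ℤ.+≤+ (ℕ.n≤1+n _)) (proj₁ (segment (suc j) x) (subst (ℕ._< columnLength μ (suc j)) (sym (Fin.toℕ-fromℕ< c<n)) l))))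
        where
        c<n = ℕ.<-≤-trans l (columnLength≤n (suc j))
        x = fromℕ< c<n

    ∑ϖ-columnLengths : ∀ x → ∑ϖ (columnLengths μ) x ≡ μ x
    ∑ϖ-columnLengths x = trans
      (sum-initial ℤ.∣ μ zero ∣ ℤ.∣ μ x ∣ (columnLength μ) x
        (ℤ.drop‿+≤+ (subst₂ ℤ._≤_ (sym (+∣μ∣ x)) (sym (+∣μ∣ zero)) (decreasing zero x z≤n)))
        (λ j → (λ l → ℤ.drop‿+≤+ (subst (+ suc j ℤ.≤_) (sym (+∣μ∣ x)) (proj₁ (segment j x) l)))
             , (λ l → proj₂ (segment j x) (subst (+ suc j ℤ.≤_) (+∣μ∣ x) (ℤ.+≤+ l)))))
      (+∣μ∣ x)

{-# OPTIONS --safe #-}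
module Submission where

-- For a column E reached from the highest weight column by upward steps,
-- T_i X^G = t X^D T_i⁻¹ at each step G → D gives T_{u_E} X^{ϖ_ℓ} = X^E t^{ℓ(u_E)} (T_{u_E⁻¹})⁻¹.
-- As H_{n,ϖ_ℓ} commutes with X^{ϖ_ℓ}, multiplying Ψ_S = ∑_E T_{u_E} h_{E,S} by X^{ϖ_ℓ}
-- yields (b), and 𝟏₀ = ∑_E T_{u_E} 𝟏_{ϖ_ℓ} starts the induction for (c).
-- For (a), let D be the first column of S.  Decompose Ψ_S = t^{ℓ(u_D)} (T_{u_D⁻¹})⁻¹ h
-- with h ∈ H_{n,ϖ_k}: the factor h only produces columns containing 1, …, k, and
-- each factor T_i⁻¹ on an upward step G → G′ turns columns row-wise below G into
-- columns row-wise below G′.  Hence h_{C,S} = 0 unless C is row-wise below D.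

open import Defs
open import Algebra.Bundles using (Ring)
import Algebra.Properties.Ring
import Algebra.Properties.Semiring.Exp
open import Data.Bool.Base using (true; false; if_then_else_)
open import Data.Empty using (⊥; ⊥-elim)
open import Data.Fin.Base as Fin using (Fin; zero; suc; toℕ; inject₁; punchIn)
open import Data.Fin.Permutation as Perm using (_⟨$⟩ʳ_; _⟨$⟩ˡ_; flip)
import Data.Fin.Properties as Fin
open import Data.Integer.Base as ℤ using (+_; 0ℤ; 1ℤ)
open import Data.List.Base using (List; []; _∷_; length; reverse; _∷ʳ_; _++_; filter; map; tabulate; allFin; cartesianProductWith)
open import Data.List.Membership.Propositional using (_∈_)
import Data.List.Properties as List
open import Data.List.Relation.Unary.All as All using (All; []; _∷_)
import Data.List.Relation.Unary.All.Properties as All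
open import Data.List.Relation.Unary.AllPairs as AllPairs using (AllPairs; []; _∷_)
import Data.List.Relation.Unary.AllPairs.Properties as AllPairs
open import Data.List.Relation.Unary.Any as Any using (Any; here; there)
import Data.List.Relation.Unary.Any.Properties as Any
open import Data.List.Relation.Unary.Linked using (Linked; _∷_)
open import Data.List.Relation.Unary.Unique.Propositional using (Unique)
open import Data.Nat.Base as ℕ using (ℕ; zero; suc; z≤n; s≤s; _≤_; _<_)
import Data.Nat.Properties as ℕ
open import Data.Product.Base using (∃; _×_; _,_; proj₁; proj₂)
open import Data.Sum.Base as Sum using (_⊎_; inj₁; inj₂)
open import Data.Unit.Base using (⊤; tt)
open import Function.Base using (_∘_; id; case_of_)
open import Relation.Binary.Definitions using (tri<; tri≈; tri>)
open import Relation.Binary.PropositionalEquality using (_≡_; _≢_; refl; sym; trans; cong; cong₂; subst; subst₂; setoid)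
import Relation.Binary.Reasoning.Setoid
open import Relation.Nullary using (¬_; Dec; does; yes; no)
open import Relation.Nullary.Decidable using (dec-true; dec-false)
open import Relation.Unary using (Decidable)

-- The components of an element of `Hₙ` are unique only because the `T[ w ]` are linearly
-- independent, which is hard to see in a ring given by generators and relations. `Ψ` takes the
-- components that `decompose` computes by recursion on the derivation `Ψ∈Hₙ`, and that derivation
-- contains the membership derivation of the previous component. So (a) becomes a statement about
-- this computation: a vanishing component must be visible in its derivation, and not only hold up
-- to `_≈_`, to be seen by the next `decompose`. This is also how a row violation far to the right
-- reaches the first column. The price is that the words, and the order in which their letters act,
-- must be those built into `leading`.

module Columns where

  -- Columns as indicator words and their row-wise order

  private
    variable
      n m k l : ℕ

  -- `Step` describes moves by permutations. `Up` and `Level` describe the same moves on indicator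
  -- words, where later proofs can recurse.
  data Up : Fin m → Column (suc m) k → Column (suc m) k → Set where
    here : {G : Column n k} → Up zero (take (skip G)) (skip (take G))
    take : {i : Fin m} {F G : Column (suc m) k} → Up i F G → Up (suc i) (take F) (take G)
    skip : {i : Fin m} {F G : Column (suc m) k} → Up i F G → Up (suc i) (skip F) (skip G)

  data Level : Fin m → Column (suc m) k → Set where
    both    : {G : Column n k} → Level zero (take (take G))
    neither : {G : Column n k} → Level zero (skip (skip G))
    take    : {i : Fin m} {F : Column (suc m) k} → Level i F → Level (suc i) (take F)
    skip    : {i : Fin m} {F : Column (suc m) k} → Level i F → Level (suc i) (skip F)

  -- Splitting on `step` and `step-shape` together refines the word along with the permutation. In
  -- the `down` case F is the upper column.
  StepShape : {i : Fin m} {F : Column (suc m) k} → Step i F → Set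
  StepShape {i = i} {F} (up G _ _)     = Up i F G
  StepShape {i = i} {F} (down G _ _)   = Up i G F
  StepShape {i = i} {F} (stay _ _ _ _) = Level i F

  step-shape : (i : Fin m) (F : Column (suc m) k) → StepShape (step i F)
  step-shape zero (take (take G)) = both
  step-shape zero (take (skip G)) = here
  step-shape zero (skip (take G)) = here
  step-shape zero (skip (skip G)) = neither
  step-shape (suc i) (take F) with step i F | step-shape i F
  ... | up _ _ _     | s = take s
  ... | down _ _ _   | s = take s
  ... | stay _ _ _ _ | s = take s
  step-shape {k = k} (suc i) (skip F) with step i F | step-shape i F
  ... | up _ _ _     | s = skip s
  ... | down _ _ _   | s = skip s
  ... | stay j _ _ r | s with ℕ.<-cmp (suc (toℕ j)) k
  ...   | tri< _ _ _ = skip s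
  ...   | tri≈ _ e _ = ⊥-elim (r e)
  ...   | tri> _ _ _ = skip s

  Level-highest : (p : k ≤ suc m) (i : Fin m) → suc (toℕ i) ≢ k → Level i (highest p)
  Level-highest {m = suc m} z≤n           zero    ne = neither
  Level-highest {m = suc m} z≤n           (suc i) ne = skip (Level-highest z≤n i λ ())
  Level-highest {m = suc m} (s≤s z≤n)     zero    ne = ⊥-elim (ne refl)
  Level-highest {m = suc m} (s≤s (s≤s p)) zero    ne = both
  Level-highest {m = suc m} (s≤s p)       (suc i) ne = take (Level-highest p i (ne ∘ cong suc))

  below : Column n k → ℕ → ℕ
  below []       y       = 0
  below (take C) zero    = 0
  below (take C) (suc y) = suc (below C y)
  below (skip C) zero    = 0
  below (skip C) (suc y) = below C y

  below-zero : (C : Column n k) → below C 0 ≡ 0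
  below-zero []       = refl
  below-zero (take C) = refl
  below-zero (skip C) = refl

  below-suc : (C : Column n k) (y : ℕ) → below C y ≤ below C (suc y) × below C (suc y) ≤ suc (below C y)
  below-suc []       y       = z≤n , z≤n
  below-suc (take C) zero    = z≤n , s≤s (ℕ.≤-reflexive (below-zero C))
  below-suc (take C) (suc y) = s≤s (proj₁ (below-suc C y)) , s≤s (proj₂ (below-suc C y))
  below-suc (skip C) zero    = z≤n , ℕ.≤-trans (ℕ.≤-reflexive (below-zero C)) z≤n
  below-suc (skip C) (suc y) = below-suc C y

  below-mono : (C : Column n k) {x y : ℕ} → x ≤ y → below C x ≤ below C y
  below-mono C x≤y = go (ℕ.≤⇒≤′ x≤y)
    where
    go : ∀ {x y} → x ℕ.≤′ y → below C x ≤ below C y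
    go (ℕ.≤′-reflexive refl) = ℕ.≤-refl
    go (ℕ.≤′-step p)         = ℕ.≤-trans (go p) (proj₁ (below-suc C _))

  below-entry : (C : Column n k) (i : Fin k) →
    below C (toℕ (entry C i)) ≡ toℕ i × below C (suc (toℕ (entry C i))) ≡ suc (toℕ i)
  below-entry (take C) zero    = refl , cong suc (below-zero C)
  below-entry (take C) (suc i) = cong suc (proj₁ (below-entry C i)) , cong suc (proj₂ (below-entry C i))
  below-entry (skip C) i       = below-entry C i

  -- The row-wise order on columns of possibly different lengths, expressed through
  -- the numbers of entries among the first y letters.

  infix 4 _⊴_
  _⊴_ : Column n k → Column n l → Set
  C ⊴ D = ∀ y → below D y ≤ below C y

  -- If the entry of D were smaller, then among the letters up to that entry D would have j+1
  -- entries but C at most i = j.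
  ⊴⇒entry≤ : (C : Column n k) (D : Column n l) → C ⊴ D → ∀ i j → toℕ i ≡ toℕ j → entry C i Fin.≤ entry D j
  ⊴⇒entry≤ C D C⊴D i j i≡j = ℕ.≮⇒≥ λ d<c → ℕ.<-irrefl (sym i≡j) (begin-strict
    toℕ j                             <⟨ ℕ.n<1+n _ ⟩
    suc (toℕ j)                       ≡⟨ proj₂ (below-entry D j) ⟨
    below D (suc (toℕ (entry D j)))   ≤⟨ C⊴D _ ⟩
    below C (suc (toℕ (entry D j)))   ≤⟨ below-mono C d<c ⟩
    below C (toℕ (entry C i))         ≡⟨ proj₁ (below-entry C i) ⟩
    toℕ i                             ∎)
    where open ℕ.≤-Reasoning

  -- The counts are min(y,k) and min(y,l). This is where the weak decrease of column lengths enters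
  -- (a).
  highest-⊴ : (p : k ≤ n) (q : l ≤ n) → l ≤ k → highest p ⊴ highest q
  highest-⊴ {n = zero}  z≤n     z≤n     _       y       = z≤n
  highest-⊴ {n = suc n} p       z≤n     _       zero    = z≤n
  highest-⊴ {n = suc n} z≤n     z≤n     _       (suc y) = ℕ.≤-refl
  highest-⊴ {n = suc n} (s≤s p) z≤n     _       (suc y) = ℕ.m≤n⇒m≤1+n (highest-⊴ p z≤n z≤n y)
  highest-⊴ {n = suc n} (s≤s p) (s≤s q) _       zero    = z≤n
  highest-⊴ {n = suc n} (s≤s p) (s≤s q) (s≤s r) (suc y) = s≤s (highest-⊴ p q r y)

  -- F ~[ i ] G: F and G agree up to exchanging the letters i and i+1.

  infix 4 _~[_]_
  record _~[_]_ (F : Column (suc m) k) (i : Fin m) (G : Column (suc m) k) : Set where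
    constructor agree
    field
      below-≡ : ∀ y → y ≢ suc (toℕ i) → below F y ≡ below G y
  open _~[_]_

  ~-refl : {i : Fin m} {F : Column (suc m) k} → F ~[ i ] F
  ~-refl = agree λ _ _ → refl

  ~-sym : {i : Fin m} {F G : Column (suc m) k} → F ~[ i ] G → G ~[ i ] F
  ~-sym F~G = agree λ y ne → sym (below-≡ F~G y ne)

  Up⇒~ : {i : Fin m} {F G : Column (suc m) k} → Up i F G → F ~[ i ] G
  Up⇒~ U = agree (go U)
    where
    go : {i : Fin m} {F G : Column (suc m) k} → Up i F G → ∀ y → y ≢ suc (toℕ i) → below F y ≡ below G y
    go here     zero          ne = refl
    go here     (suc zero)    ne = ⊥-elim (ne refl)
    go here     (suc (suc y)) ne = refl
    go (take U) zero          ne = refl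
    go (take U) (suc y)       ne = cong suc (go U y (ne ∘ cong suc))
    go (skip U) zero          ne = refl
    go (skip U) (suc y)       ne = go U y (ne ∘ cong suc)

  Up-below : {i : Fin m} {F G : Column (suc m) k} → Up i F G → below G (suc (toℕ i)) ≡ below G (toℕ i)
  Up-below here     = refl
  Up-below (take U)       = cong suc (Up-below U)
  Up-below (skip U)       = Up-below U

  -- The alternatives are the two ways to control the middle count: by its left neighbour if letter
  -- i is absent, by its right neighbour if letter i+1 is present.
  Level-below : {i : Fin m} {F : Column (suc m) k} → Level i F →
    below F (suc (toℕ i)) ≡ below F (toℕ i) ⊎ below F (suc (suc (toℕ i))) ≡ suc (below F (suc (toℕ i)))
  Level-below (both {G = G}) = inj₂ (cong (2 ℕ.+_) (below-zero G))
  Level-below neither        = inj₁ refl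
  Level-below (take L) with Level-below L
  ... | inj₁ e = inj₁ (cong suc e)
  ... | inj₂ e = inj₂ (cong suc e)
  Level-below (skip L) = Level-below L

  module _ {i : Fin m} {F G : Column (suc m) k} (F~G : F ~[ i ] G) where

    -- Only the value at i+1 has to be compared; there it is squeezed between its
    -- neighbours, which F and G share.

    private
      squeeze-left : (E : Column (suc m) l) → below E (suc (toℕ i)) ≤ below F (toℕ i) →
        below E (suc (toℕ i)) ≤ below G (suc (toℕ i))
      squeeze-left E h = ℕ.≤-trans h (ℕ.≤-trans (ℕ.≤-reflexive (below-≡ F~G _ (ℕ.1+n≢n ∘ sym))) (proj₁ (below-suc G _)))

      at : (E : Column (suc m) l) → (∀ y → y ≢ suc (toℕ i) → below E y ≤ below F y) →
        below E (suc (toℕ i)) ≤ below G (suc (toℕ i)) → G ⊴ E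
      at E off on y with y ℕ.≟ suc (toℕ i)
      ... | yes refl = on
      ... | no ne    = ℕ.≤-trans (off y ne) (ℕ.≤-reflexive (below-≡ F~G y ne))

    -- G may be F or its exchange, so every term of T_i T_{u_F} is covered. Letter i is missing from
    -- E′, which ties the middle count of E′ to its left neighbour, where E and E′ agree.
    ⊴-Up : {E E′ : Column (suc m) l} → Up i E E′ → F ⊴ E → G ⊴ E′
    ⊴-Up {E = E} {E′} U F⊴E = at E′ (λ y ne → ℕ.≤-trans (ℕ.≤-reflexive (sym (below-≡ (Up⇒~ U) y ne))) (F⊴E y))
      (squeeze-left E′ (ℕ.≤-trans (ℕ.≤-reflexive (trans (Up-below U) (sym (below-≡ (Up⇒~ U) _ (ℕ.1+n≢n ∘ sym))))) (F⊴E _)))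

    ⊴-Level : {E : Column (suc m) l} → Level i E → F ⊴ E → G ⊴ E
    ⊴-Level {E = E} L F⊴E = at E (λ y _ → F⊴E y) (on (Level-below L))
      where
      on : _ ⊎ _ → below E (suc (toℕ i)) ≤ below G (suc (toℕ i))
      on (inj₁ e) = squeeze-left E (ℕ.≤-trans (ℕ.≤-reflexive e) (F⊴E _))
      on (inj₂ e) = ℕ.s≤s⁻¹ (ℕ.≤-trans (ℕ.≤-reflexive (sym e)) (ℕ.≤-trans (F⊴E _)
        (ℕ.≤-trans (ℕ.≤-reflexive (below-≡ F~G _ ℕ.1+n≢n)) (proj₂ (below-suc G _)))))

  private
    punchIn-pos-< : (C : Column n k) (x : Fin n) → toℕ x < k → toℕ (punchIn (pos C) x) < k
    punchIn-pos-< C x x<k = subst (_< _) (sym (punchIn-< (pos C) x (subst (toℕ x <_) (sym (toℕ-pos C)) x<k))) x<k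

    punchIn-pos-≥ : (C : Column n k) (x : Fin n) → k ≤ toℕ x → k ≤ toℕ (punchIn (pos C) x)
    punchIn-pos-≥ C x k≤x = ℕ.≤-trans k≤x (ℕ.≤-trans (ℕ.n≤1+n _)
      (ℕ.≤-reflexive (sym (punchIn-≥ (pos C) x (subst (_≤ toℕ x) (sym (toℕ-pos C)) k≤x)))))

    punchIn-pos-<⁻¹ : (C : Column n k) (x : Fin n) → toℕ (punchIn (pos C) x) < k → toℕ x < k
    punchIn-pos-<⁻¹ C x p = ℕ.≰⇒> λ k≤x → ℕ.<⇒≱ p (punchIn-pos-≥ C x k≤x)

  -- The letter x is an entry of C: u_C maps the first k positions to the entries.

  infix 4 _∈ᶜ_
  _∈ᶜ_ : Fin n → Column n k → Set
  _∈ᶜ_ {k = k} x C = toℕ (u C ⟨$⟩ˡ x) < k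

  ∈ᶜ-ext : (C D : Column n k) → (∀ x → x ∈ᶜ C → x ∈ᶜ D) → (∀ x → x ∈ᶜ D → x ∈ᶜ C) → C ≡ D
  ∈ᶜ-ext []       []       f g = refl
  ∈ᶜ-ext (take C) (take D) f g = cong take (∈ᶜ-ext C D (λ x → ℕ.s<s⁻¹ ∘ f (suc x) ∘ s≤s) (λ x → ℕ.s<s⁻¹ ∘ g (suc x) ∘ s≤s))
  ∈ᶜ-ext (skip C) (skip D) f g = cong skip (∈ᶜ-ext C D
    (λ x → punchIn-pos-<⁻¹ D _ ∘ f (suc x) ∘ punchIn-pos-< C _) (λ x → punchIn-pos-<⁻¹ C _ ∘ g (suc x) ∘ punchIn-pos-< D _))
  -- In `skip D` the letter zero sits at position `pos D`, whose value k is the first one past the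
  -- entries.
  ∈ᶜ-ext (take C) (skip D) f g = ⊥-elim (ℕ.<-irrefl (toℕ-pos D) (f zero (s≤s z≤n)))
  ∈ᶜ-ext (skip C) (take D) f g = ⊥-elim (ℕ.<-irrefl (toℕ-pos C) (g zero (s≤s z≤n)))

  Up-∈ᶜ : {i : Fin m} {F G : Column (suc m) k} → Up i F G → inject₁ i ∈ᶜ F × ¬ suc i ∈ᶜ F
  Up-∈ᶜ (here {G = G}) = s≤s z≤n , λ p → ℕ.<-irrefl (cong suc (toℕ-pos G)) p
  Up-∈ᶜ (take U) = s≤s (proj₁ (Up-∈ᶜ U)) , proj₂ (Up-∈ᶜ U) ∘ ℕ.s<s⁻¹
  Up-∈ᶜ (skip {F = F} U) = punchIn-pos-< F _ (proj₁ (Up-∈ᶜ U)) , proj₂ (Up-∈ᶜ U) ∘ punchIn-pos-<⁻¹ F _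

open Columns

module Expansion (m : ℕ) where

  open AffineHecke m
  open Decomposition

  private
    module R = Ring H-ring
    module RP = Algebra.Properties.Ring H-ring
    module Exp = Algebra.Properties.Semiring.Exp R.semiring
    open Relation.Binary.Reasoning.Setoid R.setoid
    variable
      k l : ℕ
      μ : Weight
      h x y z : H
      I J : Set

  -- Stabilizers of fundamental weights

  ϖ-< : ∀ {x} → toℕ x < k → ϖ k x ≡ 1ℤ
  ϖ-< {k} {x} x<k = cong (if_then 1ℤ else 0ℤ) (dec-true (toℕ x ℕ.<? k) x<k)

  ϖ-≮ : ∀ {x} → ¬ toℕ x < k → ϖ k x ≡ 0ℤ
  ϖ-≮ {k} {x} x≮k = cong (if_then 1ℤ else 0ℤ) (dec-false (toℕ x ℕ.<? k) x≮k)

  ϖ≡⇒< : ∀ {x y} → ϖ k x ≡ ϖ k y → toℕ x < k → toℕ y < k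
  ϖ≡⇒< {k} {x} {y} e x<k with toℕ y ℕ.<? k
  ... | yes y<k = y<k
  ... | no y≮k with () ← trans (sym (ϖ-< {k} {x} x<k)) (trans e (ϖ-≮ {k} {y} y≮k))

  Stabilizes-cong : ∀ {v w} → v ≈ₛ w → Stabilizes μ w → Stabilizes μ v
  Stabilizes-cong {μ} {v} {w} e st x = trans (cong μ (inverse-cong {v} {w} e x)) (st x)

  Stabilizes-∙ : ∀ {v w} → Stabilizes μ v → Stabilizes μ w → Stabilizes μ (v ∙ w)
  Stabilizes-∙ {v = v} sv sw x = trans (sw (v ⟨$⟩ˡ x)) (sv x)

  Parabolic : ℕ → Fin m → Set
  Parabolic k i = suc (toℕ i) ≢ k

  -- The first letter of a reduced word is a left descent. For s_k this would make w⁻¹ carry the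
  -- letter just past the first k into the first k, which no stabilizer of ϖ_k does. The tail is
  -- again reduced and stabilizing.
  parabolic-word : ∀ a w → ⟦ a ⟧ ≈ₛ w → inv w ≡ length a → Stabilizes (ϖ k) w → All (Parabolic k) a
  parabolic-word []      w _ _ _ = []
  parabolic-word {k} (i ∷ a) w e len st with descent-tail i a w e len
  ... | d , a≈ , la = i≢ ∷ parabolic-word a (s i ∙ w) a≈ (trans (sym (inv-cong {⟦ a ⟧} {s i ∙ w} a≈)) la)
                            (Stabilizes-∙ {v = s i} {w} (s-stabilizes i i≢) st)
    where
    i≢ : Parabolic k i
    i≢ refl = ℕ.<-irrefl refl (ϖ≡⇒< {x = w ⟨$⟩ˡ suc i} {suc i} (st (suc i)) (ℕ.<-trans d
      (ϖ≡⇒< {x = inject₁ i} {w ⟨$⟩ˡ inject₁ i} (sym (st (inject₁ i))) (s≤s (ℕ.≤-reflexive (Fin.toℕ-inject₁ i))))))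

  parabolic-redword : ∀ w → Stabilizes (ϖ k) w → All (Parabolic k) (redword w)
  parabolic-redword w = parabolic-word (redword w) w (redword-≈ w) (sym (ℓ≡inv w))

  -- Derivations of membership that are built from 0∈ only.  Every operation used
  -- in decompose preserves them, so that vanishing of components can be tracked
  -- without appealing to the linear independence of the T[ w ].

  data Null {μ : Weight} : ∀ {x} → H⟨ μ ⟩ x → Set where
    resp  : ∀ {x y} (e : x ≈ y) {x∈ : H⟨ μ ⟩ x} → Null x∈ → Null (resp e x∈)
    0∈    : Null 0∈
    +∈    : ∀ {x y} {x∈ : H⟨ μ ⟩ x} {y∈ : H⟨ μ ⟩ y} → Null x∈ → Null y∈ → Null (+∈ x∈ y∈)
    -∈    : ∀ {x} {x∈ : H⟨ μ ⟩ x} → Null x∈ → Null (-∈ x∈)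
    t*∈   : ∀ {x} {x∈ : H⟨ μ ⟩ x} → Null x∈ → Null (t*∈ x∈)
    t⁻¹*∈ : ∀ {x} {x∈ : H⟨ μ ⟩ x} → Null x∈ → Null (t⁻¹*∈ x∈)

  Null⇒≈0 : {x∈ : H⟨ μ ⟩ x} → Null x∈ → x ≈ 0#
  Null⇒≈0 (resp e ν)  = ≈-trans (≈-sym e) (Null⇒≈0 ν)
  Null⇒≈0 0∈          = ≈-refl
  Null⇒≈0 (+∈ ν ν′)   = ≈-trans (+-cong (Null⇒≈0 ν) (Null⇒≈0 ν′)) (+-identityˡ 0#)
  Null⇒≈0 (-∈ ν)      = ≈-trans (-‿cong (Null⇒≈0 ν)) RP.-0#≈0#
  Null⇒≈0 (t*∈ ν)     = ≈-trans (R.*-congˡ (Null⇒≈0 ν)) (R.zeroʳ t)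
  Null⇒≈0 (t⁻¹*∈ ν)   = ≈-trans (R.*-congˡ (Null⇒≈0 ν)) (R.zeroʳ t⁻¹)

  Null-T* : ∀ j (st : Stabilizes μ (s j)) {x∈ : H⟨ μ ⟩ x} → Null x∈ → Null (T*∈ j st x∈)
  Null-T* j st (resp e ν) = resp _ (Null-T* j st ν)
  Null-T* j st 0∈         = resp _ 0∈
  Null-T* j st (+∈ ν ν′)  = resp _ (+∈ (Null-T* j st ν) (Null-T* j st ν′))
  Null-T* j st (-∈ ν)     = resp _ (-∈ (Null-T* j st ν))
  Null-T* j st (t*∈ ν)    = resp _ (t*∈ (Null-T* j st ν))
  Null-T* j st (t⁻¹*∈ ν)  = resp _ (t⁻¹*∈ (Null-T* j st ν))

  -- Supports of decompositions under left multiplication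

  Support : (Column n k → Set) → Decomposition k h → Set
  Support A D = ∀ F → A F ⊎ Null (component∈ D F)

  private
    variable
      A : Column n k → Set

  Support-0 : {A : Column n k → Set} → Support A D-0
  Support-0 F = inj₂ 0∈

  Support-+ : {D : Decomposition k x} {E : Decomposition k y} → Support A D → Support A E → Support A (D-+ D E)
  Support-+ p q F with p F | q F
  ... | inj₁ a | _      = inj₁ a
  ... | inj₂ _ | inj₁ a = inj₁ a
  ... | inj₂ ν | inj₂ ν′ = inj₂ (+∈ ν ν′)

  Support-neg : {D : Decomposition k x} → Support A D → Support A (D-neg D)
  Support-neg p F = Sum.map₂ -∈ (p F)

  Support-t : {D : Decomposition k x} → Support A D → Support A (D-scale t t-central t*∈ D)
  Support-t p F = Sum.map₂ t*∈ (p F)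

  Support-t⁻¹ : {D : Decomposition k x} → Support A D → Support A (D-scale t⁻¹ t⁻¹-central t⁻¹*∈ D)
  Support-t⁻¹ p F = Sum.map₂ t⁻¹*∈ (p F)

  Support-single : (F : Column n k) {x∈ : H⟨ ϖ k ⟩ x} → A F ⊎ Null x∈ → Support A (D-single F x∈)
  Support-single F p G with G ≟ᶜ F
  ... | yes refl = p
  ... | no _     = inj₂ 0∈

  Support-∑ : ∀ {I : Set} {f : I → H} {A : Column n k → Set} xs {D : ∀ i → Decomposition k (f i)} →
    (∀ i → Support A (D i)) → Support A (D-∑ xs D)
  Support-∑ []               p = Support-0
  Support-∑ {A = A} (x ∷ xs) {D} p = Support-+ {A = A} {D = D x} {E = D-∑ xs D} (p x) (Support-∑ {A = A} xs p)

  -- Each outcome of `step` lands on F or on its exchange, hence the closure asked of A.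
  -- `D-T-column` splits on `step`, so the proof repeats that split.
  Support-T-column : ∀ i (F : Column n k) {x∈ : H⟨ ϖ k ⟩ x} →
    (∀ G → F ~[ i ] G → A G) ⊎ Null x∈ → Support A (D-T-column i F x∈)
  Support-T-column {A = A} i F {x∈} p with step i F | step-shape i F
  ... | up G _ _     | U = Support-single {A = A} G (at G (Up⇒~ U))
    where
    at : ∀ G → F ~[ i ] G → A G ⊎ Null x∈
    at G e = Sum.map₁ (λ a → a G e) p
  ... | down G _ _   | U =
      Support-+ {A = A} {D = D-+ (D-scale t t-central t*∈ (D-single F x∈)) (D-neg (D-single F x∈))} {E = D-scale t t-central t*∈ (D-single G x∈)}
        (Support-+ {A = A} {D = D-scale t t-central t*∈ (D-single F x∈)} {E = D-neg (D-single F x∈)}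
          (Support-t {A = A} {D = D-single F x∈} (Support-single {A = A} F (at F ~-refl)))
          (Support-neg {A = A} {D = D-single F x∈} (Support-single {A = A} F (at F ~-refl))))
        (Support-t {A = A} {D = D-single G x∈} (Support-single {A = A} G (at G (~-sym (Up⇒~ U)))))
    where
    at : ∀ G → F ~[ i ] G → A G ⊎ Null x∈
    at G e = Sum.map₁ (λ a → a G e) p
  ... | stay j _ _ ne | _ = Support-single {A = A} F (Sum.map (λ a → a F ~-refl) (Null-T* j (s-stabilizes j ne)) p)

  infix 4 _∶_↦_
  -- A calculus for `D-*`: as it recurses on the derivation, each constructor of `Hₙ` gets its own
  -- rule below.
  record _∶_↦_ {h : H} (h∈ : Hₙ h) (A B : Column n k → Set) : Set where
    constructor maps
    field
      transport : ∀ {y} (D : Decomposition k y) → Support A D → Support B (D-* h∈ D)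
  open _∶_↦_

  module _ {k : ℕ} {A : Column n k → Set} where

    ↦-gen : ∀ i {B : Column n k → Set} → (∀ {F G} → F ~[ i ] G → A F → B G) → gen i ∶ A ↦ B
    ↦-gen i {B} f = maps λ D p → Support-∑ {A = B} (columns n k) λ F →
      Support-T-column {A = B} i F (Sum.map₁ (λ a G e → f e a) (p F))

    ↦-weaken : ∀ {B C} {h∈ : Hₙ h} → (∀ {F} → B F → C F) → h∈ ∶ A ↦ B → h∈ ∶ A ↦ C
    ↦-weaken f p = maps λ D q F → Sum.map₁ f (transport p D q F)

    ↦-t : t∈ ∶ A ↦ A
    ↦-t = maps λ D → Support-t {A = A} {D = D}

    ↦-t⁻¹ : t⁻¹∈ ∶ A ↦ A
    ↦-t⁻¹ = maps λ D → Support-t⁻¹ {A = A} {D = D}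

    ↦-0 : ∀ {B} → 0∈ ∶ A ↦ B
    ↦-0 = maps λ _ _ _ → inj₂ 0∈

    ↦-1 : 1∈ ∶ A ↦ A
    ↦-1 = maps λ _ p → p

    ↦-+ : ∀ {B} {x∈ : Hₙ x} {y∈ : Hₙ y} → x∈ ∶ A ↦ B → y∈ ∶ A ↦ B → +∈ x∈ y∈ ∶ A ↦ B
    ↦-+ {B = B} {x∈} {y∈} p q = maps λ D r → Support-+ {A = B} {D = D-* x∈ D} {E = D-* y∈ D} (transport p D r) (transport q D r)

    ↦-neg : ∀ {B} {x∈ : Hₙ x} → x∈ ∶ A ↦ B → -∈ x∈ ∶ A ↦ B
    ↦-neg {B = B} {x∈} p = maps λ D r → Support-neg {A = B} {D = D-* x∈ D} (transport p D r)

    ↦-* : ∀ {B C} {x∈ : Hₙ x} {y∈ : Hₙ y} → x∈ ∶ B ↦ C → y∈ ∶ A ↦ B → *∈ x∈ y∈ ∶ A ↦ C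
    ↦-* {y∈ = y∈} p q = maps λ D r → transport p (D-* y∈ D) (transport q D r)

    ↦-resp : ∀ {B} {x∈ : Hₙ x} (e : x ≈ y) → x∈ ∶ A ↦ B → resp e x∈ ∶ A ↦ B
    ↦-resp e p = maps λ D r → transport p D r

  module _ {k : ℕ} {A : Column n k → Set} where

    ↦-∑ : ∀ {I : Set} {f : I → H} {f∈ : ∀ i → Hₙ (f i)} {B xs} → All (λ i → f∈ i ∶ A ↦ B) xs → ∑∈Hₙ xs f∈ ∶ A ↦ B
    ↦-∑ []       = ↦-0
    ↦-∑ (p ∷ ps) = ↦-+ p (↦-∑ ps)

    ↦-T-word : ∀ {a} → All (λ i → gen i ∶ A ↦ A) a → T-word∈Hₙ a ∶ A ↦ A
    ↦-T-word []       = ↦-1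
    ↦-T-word (p ∷ ps) = ↦-* p (↦-T-word ps)

    ↦-t^ : ∀ j → t^∈Hₙ j ∶ A ↦ A
    ↦-t^ zero    = ↦-1
    ↦-t^ (suc j) = ↦-* ↦-t (↦-t^ j)

    -- A and B are arbitrary: a null derivation bottoms out in `0∈`, which `D-*` turns into `D-0`.
    ↦-Null : ∀ {B} {x∈ : H⟨ μ ⟩ x} → Null x∈ → H⟨⟩⊆Hₙ x∈ ∶ A ↦ B
    ↦-Null (resp e ν)  = ↦-resp e (↦-Null ν)
    ↦-Null 0∈          = ↦-0
    ↦-Null (+∈ ν ν′)   = ↦-+ (↦-Null ν) (↦-Null ν′)
    ↦-Null (-∈ ν)      = ↦-neg (↦-Null ν)
    ↦-Null (t*∈ ν)     = ↦-* ↦-t (↦-Null ν)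
    ↦-Null (t⁻¹*∈ ν)   = ↦-* ↦-t⁻¹ (↦-Null ν)

    ↦-H⟨⟩ : (∀ w → Stabilizes μ w → T-word∈Hₙ (redword w) ∶ A ↦ A) → (x∈ : H⟨ μ ⟩ x) → H⟨⟩⊆Hₙ x∈ ∶ A ↦ A
    ↦-H⟨⟩ g (resp e x∈)  = ↦-resp e (↦-H⟨⟩ g x∈)
    ↦-H⟨⟩ g (gen w st)   = g w st
    ↦-H⟨⟩ g 0∈           = ↦-0
    ↦-H⟨⟩ g (+∈ x∈ y∈)   = ↦-+ (↦-H⟨⟩ g x∈) (↦-H⟨⟩ g y∈)
    ↦-H⟨⟩ g (-∈ x∈)      = ↦-neg (↦-H⟨⟩ g x∈)
    ↦-H⟨⟩ g (t*∈ x∈)     = ↦-* ↦-t (↦-H⟨⟩ g x∈)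
    ↦-H⟨⟩ g (t⁻¹*∈ x∈)   = ↦-* ↦-t⁻¹ (↦-H⟨⟩ g x∈)

    -- Applied below to the empty set: left multiplication cannot create support out of nothing.
    ↦-Hₙ : (∀ {i F G} → F ~[ i ] G → A F → A G) → (h∈ : Hₙ h) → h∈ ∶ A ↦ A
    ↦-Hₙ f (resp e x∈) = ↦-resp e (↦-Hₙ f x∈)
    ↦-Hₙ f (gen i)     = ↦-gen i f
    ↦-Hₙ f t∈          = ↦-t
    ↦-Hₙ f t⁻¹∈        = ↦-t⁻¹
    ↦-Hₙ f 0∈          = ↦-0
    ↦-Hₙ f 1∈          = ↦-1
    ↦-Hₙ f (+∈ x∈ y∈)  = ↦-+ (↦-Hₙ f x∈) (↦-Hₙ f y∈)
    ↦-Hₙ f (*∈ x∈ y∈)  = ↦-* (↦-Hₙ f x∈) (↦-Hₙ f y∈)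
    ↦-Hₙ f (-∈ x∈)     = ↦-neg (↦-Hₙ f x∈)

  -- Spelled exactly as inside `T-word⁻¹∈Hₙ`, so that the two derivations agree definitionally.
  T⁻¹∈Hₙ : ∀ i → Hₙ (T⁻¹ i)
  T⁻¹∈Hₙ i = *∈ t⁻¹∈ (+∈ (gen i) (+∈ 1∈ (-∈ t∈)))

  ↦-T⁻¹ : ∀ i {A B : Column n k → Set} → (∀ {F G} → F ~[ i ] G → A F → B G) → T⁻¹∈Hₙ i ∶ A ↦ B
  ↦-T⁻¹ i f = ↦-* ↦-t⁻¹ (↦-+ (↦-gen i f) (↦-weaken (f ~-refl) (↦-+ ↦-1 (↦-neg ↦-t))))

  -- `↦-*` does not apply directly, since this derivation nests its products the other way, with the
  -- factor of i innermost. Peeling letters off the front shows that i acts last; the intervening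
  -- `D-resp` leave the components untouched.
  ↦-T-word⁻¹-∷ʳ : ∀ a i {A B C : Column n k → Set} →
    T-word⁻¹∈Hₙ a ∶ A ↦ B → T⁻¹∈Hₙ i ∶ B ↦ C → T-word⁻¹∈Hₙ (a ∷ʳ i) ∶ A ↦ C
  ↦-T-word⁻¹-∷ʳ a i {A} {B} {C} p q = maps λ D r → go a D (transport p D r)
    where
    go : ∀ a {y} (D : Decomposition _ y) → Support B (D-* (T-word⁻¹∈Hₙ a) D) → Support C (D-* (T-word⁻¹∈Hₙ (a ∷ʳ i)) D)
    go []      D r = transport q D r
    go (j ∷ a) D r = go a (D-* (T⁻¹∈Hₙ j) D) r

  -- The word b, read from right to left, moves the highest weight column to D by
  -- steps that all go up.

  data Reach {k : ℕ} : Word → Column n k → Set where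
    origin : ∀ p → Reach [] (highest p)
    up    : ∀ {i b} {G D : Column n k} → Up i G D → s i ∙ u G ≈ₛ u D → Reach b G → Reach (i ∷ b) D

  -- Reduced words as upward paths from the highest weight column

  u-move : ∀ i (F G : Column n k) → (∀ x → u G ⟨$⟩ˡ x ≡ u F ⟨$⟩ˡ (s i ⟨$⟩ʳ x)) → s i ∙ u F ≈ₛ u G
  u-move i F G g y = trans (sym (Perm.inverseʳ (u G))) (cong (u G ⟨$⟩ʳ_)
    (trans (g _) (trans (cong (u F ⟨$⟩ˡ_) (s-invol i (u F ⟨$⟩ʳ y))) (Perm.inverseˡ (u F)))))

  u-stay : ∀ i (F : Column n k) j → u F ⟨$⟩ˡ inject₁ i ≡ inject₁ j → u F ⟨$⟩ˡ suc i ≡ suc j → s i ∙ u F ≈ₛ u F ∙ s j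
  u-stay i F j p q y = go (view j y)
    where
    uj : u F ⟨$⟩ʳ inject₁ j ≡ inject₁ i
    uj = trans (cong (u F ⟨$⟩ʳ_) (sym p)) (Perm.inverseʳ (u F))
    uj+1 : u F ⟨$⟩ʳ suc j ≡ suc i
    uj+1 = trans (cong (u F ⟨$⟩ʳ_) (sym q)) (Perm.inverseʳ (u F))
    go : ∀ {y} → View j y → s i ⟨$⟩ʳ (u F ⟨$⟩ʳ y) ≡ u F ⟨$⟩ʳ (s j ⟨$⟩ʳ y)
    go at-i        = trans (cong (s i ⟨$⟩ʳ_) uj) (trans (s-i i) (sym (trans (cong (u F ⟨$⟩ʳ_) (s-i j)) uj+1)))
    go at-1+i      = trans (cong (s i ⟨$⟩ʳ_) uj+1) (trans (s-1+i i) (sym (trans (cong (u F ⟨$⟩ʳ_) (s-1+i j)) uj)))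
    go (other a b) = trans (s-fix i (λ e → a (w-inj (u F) (trans e (sym uj)))) (λ e → b (w-inj (u F) (trans e (sym uj+1)))))
                           (cong (u F ⟨$⟩ʳ_) (sym (s-fix j a b)))

  -- The first letter of a reduced word of u_D is a left descent, whereas `up` and `stay` are
  -- ascents. So `step` goes down, to a column reached by the tail.
  reach : ∀ b (D : Column n k) → ⟦ b ⟧ ≈ₛ u D → inv (u D) ≡ length b → Reach b D
  reach {k} [] D e len = subst (Reach []) (∈ᶜ-ext (highest p) D
      (λ x → subst (_< k) (cong toℕ (trans (u⁻¹-highest p x) (id≡ x))))
      (λ x → subst (_< k) (cong toℕ (sym (trans (u⁻¹-highest p x) (id≡ x)))))) (origin p)
    where
    p = length≤ D
    id≡ : ∀ x → x ≡ u D ⟨$⟩ˡ x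
    id≡ = inverse-cong {Perm.id} {u D} e
  reach (i ∷ b) D e len with descent-tail i b (u D) e len
  ... | d , b≈ , lb with step i D | step-shape i D
  ...   | up _ _ a       | _ = ⊥-elim (Fin.<-asym a d)
  ...   | stay j p q _   | _ = ⊥-elim (Fin.<-asym (subst₂ Fin._<_ (sym p) (sym q) (s≤s (ℕ.≤-reflexive (Fin.toℕ-inject₁ j)))) d)
  ...   | down G g _     | U = up U su (reach b G b≈G (trans (sym (inv-cong {⟦ b ⟧} {u G} b≈G)) lb))
    where
    b≈G : ⟦ b ⟧ ≈ₛ u G
    b≈G y = trans (b≈ y) (u-move i D G g y)
    su : s i ∙ u G ≈ₛ u D
    su y = trans (cong (s i ⟨$⟩ʳ_) (sym (u-move i D G g y))) (s-invol i _)

  ⟦∷ʳ⟧ : ∀ a i x → ⟦ a ∷ʳ i ⟧ ⟨$⟩ʳ x ≡ ⟦ a ⟧ ⟨$⟩ʳ (s i ⟨$⟩ʳ x)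
  ⟦∷ʳ⟧ []      i x = refl
  ⟦∷ʳ⟧ (j ∷ a) i x = cong (s j ⟨$⟩ʳ_) (⟦∷ʳ⟧ a i x)

  ⟦reverse⟧ : ∀ a → ⟦ reverse a ⟧ ≈ₛ flip ⟦ a ⟧
  ⟦reverse⟧ []      x = refl
  ⟦reverse⟧ (i ∷ a) x = trans (cong (λ b → ⟦ b ⟧ ⟨$⟩ʳ x) (List.unfold-reverse i a)) (trans (⟦∷ʳ⟧ (reverse a) i x)
    (trans (⟦reverse⟧ a (s i ⟨$⟩ʳ x)) (cong (⟦ a ⟧ ⟨$⟩ˡ_) (sym (s-inv i x)))))

  -- Not the chosen word of u_D but that of u_D⁻¹ read backwards: reversing it returns the very word
  -- inside `leading D`, whose derivation the support argument follows.
  upWord : Column n k → Word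
  upWord D = reverse (redword (flip (u D)))

  upWord-≈ : (D : Column n k) → ⟦ upWord D ⟧ ≈ₛ u D
  upWord-≈ D x = trans (⟦reverse⟧ a x) (inverse-cong {⟦ a ⟧} {flip (u D)} (redword-≈ (flip (u D))) x)
    where a = redword (flip (u D))

  upWord-length : (D : Column n k) → length (upWord D) ≡ inv (u D)
  upWord-length D = trans (List.length-reverse (redword (flip (u D)))) (trans (ℓ≡inv (flip (u D))) (inv-flip (u D)))

  reach-upWord : (D : Column n k) → Reach (upWord D) D
  reach-upWord D = reach (upWord D) D (upWord-≈ D) (sym (upWord-length D))

  -- Row-wise bound on the support of Ψ, and part (a)

  module _ {l : ℕ} where

    Below : Column n k → Column n l → Set
    Below D F = F ⊴ D

    ↦-reach : ∀ {b} {D : Column n k} (p : k ≤ n) → Reach b D → T-word⁻¹∈Hₙ (reverse b) ∶ Below (highest p) ↦ Below D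
    ↦-reach p (origin q) = subst (λ q → 1∈ ∶ Below (highest p) ↦ Below (highest q)) (ℕ.≤-irrelevant p q) ↦-1
    ↦-reach {D = D} p (up {i} {b} U _ r) = subst (λ a → T-word⁻¹∈Hₙ a ∶ Below (highest p) ↦ Below D) (sym (List.unfold-reverse i b))
      (↦-T-word⁻¹-∷ʳ (reverse b) i (↦-reach p r) (↦-T⁻¹ i λ e → ⊴-Up e U))

    ↦-leading : (D : Column n k) (p : k ≤ n) → leading∈ D ∶ Below (highest p) ↦ Below D
    ↦-leading D p = ↦-* (↦-t^ (ℓ (u D))) (subst (λ a → T-word⁻¹∈Hₙ a ∶ Below (highest p) ↦ Below D)
      (List.reverse-involutive (redword (flip (u D)))) (↦-reach p (reach-upWord D)))

    -- Lying below `highest p` means containing the first k letters, which is unaffected by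
    -- exchanging two letters on the same side of k.
    ↦-stabilizer : (p : k ≤ n) → ∀ w → Stabilizes (ϖ k) w → T-word∈Hₙ (redword w) ∶ Below (highest p) ↦ Below (highest p)
    ↦-stabilizer p w st = ↦-T-word (All.map (λ {i} ne → ↦-gen i λ e → ⊴-Level e (Level-highest p i ne)) (parabolic-redword w st))

    -- `decompose` lets Ψ act on the decomposition of 1, which sits on the highest column of length
    -- l. By k ≤ l this lies below the highest column of length k, and the factors of Ψ take over
    -- from there.
    Ψ-support : ∀ {ks} (D : Column n k) (P : Tensor ks) (l≤n : l ≤ n) → k ≤ l →
      Support (Below D) (decompose l≤n (Ψ∈Hₙ (D ∷ P)))
    Ψ-support {k} D P l≤n k≤l = transport (factor P) (D-1 l≤n)
      (Support-single {A = Below (highest p)} (highest l≤n) (inj₁ (highest-⊴ l≤n p k≤l)))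
      where
      p = length≤ D
      factor : ∀ {ks} (P : Tensor ks) → Ψ∈Hₙ (D ∷ P) ∶ Below (highest p) ↦ Below D
      factor []        = ↦-* (↦-leading D p) (↦-∑ (All.map (↦-stabilizer p _) (All.all-filter (stabilizes? (ϖ k)) (permutations n))))
      factor P@(_ ∷ _) = ↦-* (↦-leading D p) (↦-H⟨⟩ (↦-stabilizer p) (component∈ (decompose p (Ψ∈Hₙ P)) D))

  -- Either the tail is semistandard and the violation lies between C and D, so C is outside the
  -- support; or the component inside the tail's Ψ is null by induction, and so is everything
  -- computed from it.
  Ψ-Null : ∀ {ks} (C : Column n k) (D : Column n l) (P : Tensor ks) → Linked ℕ._≥_ (k ∷ l ∷ ks) →
    ¬ Semistandard (C ∷ D ∷ P) → Null (component∈ (decompose (length≤ C) (Ψ∈Hₙ (D ∷ P))) C)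
  Ψ-Null C D [] (l≤k ∷ _) ¬ss =
    Sum.fromInj₂ (λ C⊴D → ⊥-elim (¬ss (⊴⇒entry≤ C D C⊴D ∷ [-]))) (Ψ-support D [] (length≤ C) l≤k C)
  Ψ-Null C D (E ∷ P) (l≤k ∷ dec) ¬ss = go (semistandard? (D ∷ E ∷ P))
    where
    go : Dec (Semistandard (D ∷ E ∷ P)) → Null (component∈ (decompose (length≤ C) (Ψ∈Hₙ (D ∷ E ∷ P))) C)
    go (yes ss) = Sum.fromInj₂ (λ C⊴D → ⊥-elim (¬ss (⊴⇒entry≤ C D C⊴D ∷ ss))) (Ψ-support D (E ∷ P) (length≤ C) l≤k C)
    -- The null factor sends the full support to the empty one, and `leading D` keeps it empty.
    go (no ¬ss′) = Sum.fromInj₂ ⊥-elim (transport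
      (↦-* {A = λ _ → ⊤} (↦-Hₙ {A = λ _ → ⊥} (λ _ ()) (leading∈ D))
        (↦-Null {x∈ = component∈ (decompose (length≤ D) (Ψ∈Hₙ (E ∷ P))) D} (Ψ-Null D E P dec ¬ss′)))
      (D-1 (length≤ C)) (λ _ → inj₁ tt) C)

  Ψ-vanishes : ∀ {ks} (P : Tensor ks) → Linked ℕ._≥_ ks → ¬ Semistandard P → Ψ P ≈ 0#
  Ψ-vanishes []          _   ¬ss = ⊥-elim (¬ss [])
  Ψ-vanishes (C ∷ [])    _   ¬ss = ⊥-elim (¬ss [-])
  Ψ-vanishes (C ∷ D ∷ P) dec ¬ss = ≈-trans (R.*-congˡ (Null⇒≈0 (Ψ-Null C D P dec ¬ss))) (R.zeroʳ _)

  -- Commuting elements, finite sums and products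

  Commute : H → H → Set
  Commute x y = x * y ≈ y * x

  commute-1 : Commute x 1#
  commute-1 = ≈-trans (*-identityʳ _) (≈-sym (*-identityˡ _))

  commute-0 : Commute x 0#
  commute-0 = ≈-trans (R.zeroʳ _) (≈-sym (R.zeroˡ _))

  commute-* : Commute x y → Commute x z → Commute x (y * z)
  commute-* {x} {y} {z} p q = begin
    x * (y * z)   ≈⟨ *-assoc _ _ _ ⟨
    x * y * z     ≈⟨ R.*-congʳ p ⟩
    y * x * z     ≈⟨ *-assoc _ _ _ ⟩
    y * (x * z)   ≈⟨ R.*-congˡ q ⟩
    y * (z * x)   ≈⟨ *-assoc _ _ _ ⟨
    y * z * x     ∎

  commute-∏ : {f : I → H} {xs : List I} → All (Commute x ∘ f) xs → Commute x (∏ xs f)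
  commute-∏ []       = commute-1
  commute-∏ (p ∷ ps) = commute-* p (commute-∏ ps)

  commute-^ : Commute x y → ∀ j → Commute x (y ^ j)
  commute-^ p zero    = commute-1
  commute-^ p (suc j) = commute-* p (commute-^ p j)

  x∙yz≈y∙xz : Commute x y → ∀ z → x * (y * z) ≈ y * (x * z)
  x∙yz≈y∙xz p z = ≈-trans (≈-sym (*-assoc _ _ _)) (≈-trans (R.*-congʳ p) (*-assoc _ _ _))

  ∏-cong : {f g : I → H} (xs : List I) → (∀ i → f i ≈ g i) → ∏ xs f ≈ ∏ xs g
  ∏-cong []       e = ≈-refl
  ∏-cong (x ∷ xs) e = *-cong (e x) (∏-cong xs e)

  ∏-* : (f g : I → H) (xs : List I) → (∀ i j → Commute (f i) (g j)) → ∏ xs (λ i → f i * g i) ≈ ∏ xs f * ∏ xs g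
  ∏-* f g []       c = ≈-sym (*-identityˡ 1#)
  ∏-* f g (x ∷ xs) c = begin
    f x * g x * ∏ xs (λ i → f i * g i)   ≈⟨ R.*-congˡ (∏-* f g xs c) ⟩
    f x * g x * (∏ xs f * ∏ xs g)        ≈⟨ *-assoc _ _ _ ⟩
    f x * (g x * (∏ xs f * ∏ xs g))      ≈⟨ R.*-congˡ (x∙yz≈y∙xz (commute-∏ (All.universal (λ i → ≈-sym (c i x)) xs)) _) ⟩
    f x * (∏ xs f * (g x * ∏ xs g))      ≈⟨ *-assoc _ _ _ ⟨
    f x * ∏ xs f * (g x * ∏ xs g)        ∎

  ∏-tabulate : ∀ {p} (f : I → H) (g : Fin p → I) → ∏ (tabulate g) f ≡ ∏ (allFin p) (f ∘ g)
  ∏-tabulate f g = go f g id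
    where
    go : ∀ {p} {I J : Set} (f : I → H) (g : J → I) (h : Fin p → J) → ∏ (tabulate (g ∘ h)) f ≡ ∏ (tabulate h) (f ∘ g)
    go {zero}  f g h = refl
    go {suc p} f g h = cong (f (g (h zero)) *_) (go f g (h ∘ suc))

  ∑-*ʳ : (f : I → H) (xs : List I) (y : H) → ∑ xs f * y ≈ ∑[ x ∈ xs ] (f x * y)
  ∑-*ʳ f []       y = R.zeroˡ y
  ∑-*ʳ f (x ∷ xs) y = ≈-trans (distribʳ _ _ _) (R.+-congˡ (∑-*ʳ f xs y))

  ∑-++ : (f : I → H) (xs ys : List I) → ∑ (xs ++ ys) f ≈ ∑ xs f + ∑ ys f
  ∑-++ f []       ys = ≈-sym (+-identityˡ _)
  ∑-++ f (x ∷ xs) ys = ≈-trans (R.+-congˡ (∑-++ f xs ys)) (≈-sym (+-assoc _ _ _))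

  ∑-cartesianProductWith : {K : Set} (f : K → H) (g : I → J → K) (xs : List I) (ys : List J) →
    ∑ (cartesianProductWith g xs ys) f ≈ ∑[ x ∈ xs ] ∑[ y ∈ ys ] f (g x y)
  ∑-cartesianProductWith f g []       ys = ≈-refl
  ∑-cartesianProductWith f g (x ∷ xs) ys = ≈-trans (∑-++ f (map (g x) ys) _)
    (+-cong (R.reflexive (List.foldr-map (λ z w → f z + w) (g x) 0# ys)) (∑-cartesianProductWith f g xs ys))

  ∑-swap : (f : I → J → H) (xs : List I) (ys : List J) → ∑[ x ∈ xs ] ∑[ y ∈ ys ] f x y ≈ ∑[ y ∈ ys ] ∑[ x ∈ xs ] f x y
  ∑-swap f []       ys = ≈-sym (∑-zero ys λ _ → ≈-refl)
  ∑-swap f (x ∷ xs) ys = ≈-trans (R.+-congˡ (∑-swap f xs ys)) (∑-+ (f x) (λ y → ∑[ x ∈ xs ] f x y) ys)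

  ∑-filter : {P : I → Set} (P? : Decidable P) (f : I → H) (xs : List I) → (∀ x → ¬ P x → f x ≈ 0#) →
    ∑ xs f ≈ ∑ (filter P? xs) f
  ∑-filter P? f []       z = ≈-refl
  ∑-filter P? f (x ∷ xs) z with P? x
  ... | yes p = R.+-congˡ (∑-filter P? f xs z)
  ... | no ¬p = ≈-trans (+-cong (z x ¬p) (∑-filter P? f xs z)) (+-identityˡ _)

  ∑-cong∈ : {f g : I → H} (xs : List I) → All (λ x → f x ≈ g x) xs → ∑ xs f ≈ ∑ xs g
  ∑-cong∈ []       []       = ≈-refl
  ∑-cong∈ (x ∷ xs) (p ∷ ps) = +-cong p (∑-cong∈ xs ps)

  module _ (_~_ : I → I → Set) (_~?_ : ∀ x y → Dec (x ~ y))
    (~-sym : ∀ {x y} → x ~ y → y ~ x) (~-trans : ∀ {x y z} → x ~ y → y ~ z → x ~ z)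
    (f : I → H) (f-cong : ∀ {x y} → x ~ y → f x ≈ f y) where

    private
      δ : I → I → H
      δ x y = if does (x ~? y) then f y else 0#

      δ-off : ∀ {x y} → ¬ x ~ y → δ x y ≈ 0#
      δ-off {x} {y} ne = R.reflexive (cong (if_then f y else 0#) (dec-false (x ~? y) ne))

      δ-on : ∀ {x y} → x ~ y → δ x y ≈ f x
      δ-on {x} {y} e = ≈-trans (R.reflexive (cong (if_then f y else 0#) (dec-true (x ~? y) e))) (f-cong (~-sym e))

      δ-sym : ∀ x y → δ x y ≈ δ y x
      δ-sym x y with x ~? y
      ... | yes e = ≈-sym (δ-on (~-sym e))
      ... | no ne = ≈-sym (δ-off (ne ∘ ~-sym))

      ∑-δ : ∀ x {ys} → AllPairs (λ y z → ¬ y ~ z) ys → Any (x ~_) ys → ∑ ys (δ x) ≈ f x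
      ∑-δ x {y ∷ ys} (ne ∷ d) (here e)  = ≈-trans (+-cong (δ-on e)
        (∑-zero ys λ z∈ → δ-off λ e′ → All.lookup ne z∈ (~-trans (~-sym e) e′))) (R.+-identityʳ _)
      ∑-δ x {y ∷ ys} (ne ∷ d) (there a) = ≈-trans (+-cong (δ-off λ e → All.All¬⇒¬Any ne (Any.map (~-trans (~-sym e)) a))
        (∑-δ x d a)) (+-identityˡ _)

    -- Double counting of the kernel `δ` replaces a bijection between the lists: each row and each
    -- column of `δ` has a single nonzero term.
    ∑-reindex : ∀ {xs ys} → AllPairs (λ x y → ¬ x ~ y) xs → AllPairs (λ x y → ¬ x ~ y) ys →
      (∀ x → Any (x ~_) xs) → (∀ x → Any (x ~_) ys) → ∑ xs f ≈ ∑ ys f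
    ∑-reindex {xs} {ys} dx dy cx cy = begin
      ∑ xs f                               ≈⟨ ∑-cong xs (λ x → ∑-δ x dy (cy x)) ⟨
      (∑[ x ∈ xs ] ∑[ y ∈ ys ] δ x y)      ≈⟨ ∑-swap δ xs ys ⟩
      (∑[ y ∈ ys ] ∑[ x ∈ xs ] δ x y)      ≈⟨ ∑-cong ys (λ y → ∑-cong xs λ x → δ-sym x y) ⟩
      (∑[ y ∈ ys ] ∑[ x ∈ xs ] δ y x)      ≈⟨ ∑-cong ys (λ y → ∑-δ y dx (cx y)) ⟩
      ∑ ys f                               ∎

  -- Relabelling the letters by f makes X^C recursive in C.

  Xᶠ : ∀ {p} → (Fin p → Fin n) → Column p k → H
  Xᶠ f C = ∏ (tabulate (f ∘ entry C)) X

  Xᶠ≡Xᶜ : (C : Column n k) → Xᶠ id C ≡ Xᶜ C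
  Xᶠ≡Xᶜ C = ∏-tabulate X (entry C)

  -- Moving T i past column monomials

  TX≈ : ∀ i → T i * X (inject₁ i) ≈ t * (X (suc i) * T⁻¹ i)
  TX≈ i = begin
    T i * X (inject₁ i)                    ≈⟨ *-identityʳ _ ⟨
    T i * X (inject₁ i) * 1#               ≈⟨ R.*-congˡ (T⁻¹-inverseʳ i) ⟨
    T i * X (inject₁ i) * (T i * T⁻¹ i)    ≈⟨ *-assoc _ _ _ ⟨
    T i * X (inject₁ i) * T i * T⁻¹ i      ≈⟨ R.*-congʳ (TXT i) ⟩
    t * X (suc i) * T⁻¹ i                  ≈⟨ *-assoc _ _ _ ⟩
    t * (X (suc i) * T⁻¹ i)                ∎

  XT≈ : ∀ i → X (inject₁ i) * T i ≈ t * (T⁻¹ i * X (suc i))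
  XT≈ i = begin
    X (inject₁ i) * T i                      ≈⟨ *-identityˡ _ ⟨
    1# * (X (inject₁ i) * T i)               ≈⟨ R.*-congʳ (T⁻¹-inverseˡ i) ⟨
    T⁻¹ i * T i * (X (inject₁ i) * T i)      ≈⟨ *-assoc _ _ _ ⟩
    T⁻¹ i * (T i * (X (inject₁ i) * T i))    ≈⟨ R.*-congˡ (*-assoc _ _ _) ⟨
    T⁻¹ i * (T i * X (inject₁ i) * T i)      ≈⟨ R.*-congˡ (TXT i) ⟩
    T⁻¹ i * (t * X (suc i))                  ≈⟨ x∙yz≈y∙xz (≈-sym (t-central _)) _ ⟩
    t * (T⁻¹ i * X (suc i))                  ∎

  -- Passing X_i turns T_i into t T_i⁻¹, and passing X_{i+1} turns it back.
  commute-T-XX : ∀ i → Commute (T i) (X (inject₁ i) * X (suc i))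
  commute-T-XX i = begin
    T i * (X a * X b)              ≈⟨ *-assoc _ _ _ ⟨
    T i * X a * X b                ≈⟨ R.*-congʳ (TX≈ i) ⟩
    t * (X b * T⁻¹ i) * X b        ≈⟨ *-assoc _ _ _ ⟩
    t * (X b * T⁻¹ i * X b)        ≈⟨ R.*-congˡ (*-assoc _ _ _) ⟩
    t * (X b * (T⁻¹ i * X b))      ≈⟨ x∙yz≈y∙xz (t-central _) _ ⟩
    X b * (t * (T⁻¹ i * X b))      ≈⟨ R.*-congˡ (XT≈ i) ⟨
    X b * (X a * T i)              ≈⟨ *-assoc _ _ _ ⟨
    X b * X a * T i                ≈⟨ R.*-congʳ (X-comm b a) ⟩
    X a * X b * T i                ∎
    where
    a = inject₁ i
    b = suc i

  commute-T-Xᶠ : ∀ {p} i (f : Fin p → Fin n) (C : Column p k) →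
    (∀ x → f x ≢ inject₁ i) → (∀ x → f x ≢ suc i) → Commute (T i) (Xᶠ f C)
  commute-T-Xᶠ i f C p q = commute-∏ (All.tabulate⁺ λ j → TX-comm i (f (entry C j)) (p _) (q _))

  module _ (i : Fin m) where

    private
      zero≢ : ∀ {p} {f : Fin (suc p) → Fin n} → (∀ {x y} → f x ≡ f y → x ≡ y) → ∀ {a} j → f (suc j) ≡ a → f zero ≢ a
      zero≢ inj j refl e with () ← inj e

      commute-tail : ∀ {p} (f : Fin (suc (suc p)) → Fin n) → (∀ {x y} → f x ≡ f y → x ≡ y) →
        f zero ≡ inject₁ i → f (suc zero) ≡ suc i → (G : Column p k) → Commute (T i) (Xᶠ (λ x → f (suc (suc x))) G)
      commute-tail f inj p q G = commute-T-Xᶠ i (λ x → f (suc (suc x))) G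
        (λ x e → case inj (trans e (sym p)) of λ ()) (λ x e → case inj (trans e (sym q)) of λ ())

    -- The recursion strips leading letters and lowers j while T i keeps referring to the full
    -- alphabet, so f records the relabelling. Injectivity of f keeps the remaining letters away
    -- from i and i+1, so their variables commute with T i.
    T-Xᶠ-Up : ∀ {p} {j : Fin p} {E D : Column (suc p) k} (f : Fin (suc p) → Fin n) → (∀ {x y} → f x ≡ f y → x ≡ y) →
      f (inject₁ j) ≡ inject₁ i → f (suc j) ≡ suc i → Up j E D → T i * Xᶠ f E ≈ t * (Xᶠ f D * T⁻¹ i)
    T-Xᶠ-Up f inj p q (here {G = G}) rewrite p | q = begin
      T i * (X (inject₁ i) * Y)          ≈⟨ *-assoc _ _ _ ⟨
      T i * X (inject₁ i) * Y            ≈⟨ R.*-congʳ (TX≈ i) ⟩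
      t * (X (suc i) * T⁻¹ i) * Y        ≈⟨ *-assoc _ _ _ ⟩
      t * (X (suc i) * T⁻¹ i * Y)        ≈⟨ R.*-congˡ (*-assoc _ _ _) ⟩
      t * (X (suc i) * (T⁻¹ i * Y))      ≈⟨ R.*-congˡ (R.*-congˡ T⁻¹Y) ⟩
      t * (X (suc i) * (Y * T⁻¹ i))      ≈⟨ R.*-congˡ (*-assoc _ _ _) ⟨
      t * (X (suc i) * Y * T⁻¹ i)        ∎
      where
      Y = Xᶠ (λ x → f (suc (suc x))) G
      TY : Commute (T i) Y
      TY = commute-tail f inj p q G
      T⁻¹Y : T⁻¹ i * Y ≈ Y * T⁻¹ i
      T⁻¹Y = begin
        T⁻¹ i * Y                      ≈⟨ *-identityʳ _ ⟨
        T⁻¹ i * Y * 1#                 ≈⟨ R.*-congˡ (T⁻¹-inverseʳ i) ⟨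
        T⁻¹ i * Y * (T i * T⁻¹ i)      ≈⟨ *-assoc _ _ _ ⟨
        T⁻¹ i * Y * T i * T⁻¹ i        ≈⟨ R.*-congʳ (*-assoc _ _ _) ⟩
        T⁻¹ i * (Y * T i) * T⁻¹ i      ≈⟨ R.*-congʳ (R.*-congˡ TY) ⟨
        T⁻¹ i * (T i * Y) * T⁻¹ i      ≈⟨ R.*-congʳ (*-assoc _ _ _) ⟨
        T⁻¹ i * T i * Y * T⁻¹ i        ≈⟨ R.*-congʳ (R.*-congʳ (T⁻¹-inverseˡ i)) ⟩
        1# * Y * T⁻¹ i                 ≈⟨ R.*-congʳ (*-identityˡ _) ⟩
        Y * T⁻¹ i                      ∎
    T-Xᶠ-Up {j = suc j} {take E} {take D} f inj p q (take U) = begin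
      T i * (X (f zero) * Xᶠ (f ∘ suc) E)              ≈⟨ x∙yz≈y∙xz (TX-comm i (f zero) (zero≢ inj _ p) (zero≢ inj _ q)) _ ⟩
      X (f zero) * (T i * Xᶠ (f ∘ suc) E)              ≈⟨ R.*-congˡ (T-Xᶠ-Up (f ∘ suc) (Fin.suc-injective ∘ inj) p q U) ⟩
      X (f zero) * (t * (Xᶠ (f ∘ suc) D * T⁻¹ i))      ≈⟨ x∙yz≈y∙xz (≈-sym (t-central _)) _ ⟩
      t * (X (f zero) * (Xᶠ (f ∘ suc) D * T⁻¹ i))      ≈⟨ R.*-congˡ (*-assoc _ _ _) ⟨
      t * (X (f zero) * Xᶠ (f ∘ suc) D * T⁻¹ i)        ∎
    T-Xᶠ-Up f inj p q (skip U) = T-Xᶠ-Up (f ∘ suc) (Fin.suc-injective ∘ inj) p q U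

    commute-T-Xᶠ-Level : ∀ {p} {j : Fin p} {E : Column (suc p) k} (f : Fin (suc p) → Fin n) → (∀ {x y} → f x ≡ f y → x ≡ y) →
      f (inject₁ j) ≡ inject₁ i → f (suc j) ≡ suc i → Level j E → Commute (T i) (Xᶠ f E)
    commute-T-Xᶠ-Level f inj p q (both {G = G}) rewrite p | q = begin
      T i * (X (inject₁ i) * (X (suc i) * Y))    ≈⟨ R.*-congˡ (*-assoc _ _ _) ⟨
      T i * (X (inject₁ i) * X (suc i) * Y)      ≈⟨ commute-* (commute-T-XX i) TY ⟩
      X (inject₁ i) * X (suc i) * Y * T i        ≈⟨ R.*-congʳ (*-assoc _ _ _) ⟩
      X (inject₁ i) * (X (suc i) * Y) * T i      ∎
      where
      Y = Xᶠ (λ x → f (suc (suc x))) G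
      TY : Commute (T i) Y
      TY = commute-tail f inj p q G
    commute-T-Xᶠ-Level f inj p q (neither {G = G}) = commute-tail f inj p q G
    commute-T-Xᶠ-Level {j = suc j} f inj p q (take L) = commute-* (TX-comm i (f zero) (zero≢ inj _ p) (zero≢ inj _ q))
      (commute-T-Xᶠ-Level (f ∘ suc) (Fin.suc-injective ∘ inj) p q L)
    commute-T-Xᶠ-Level f inj p q (skip L) = commute-T-Xᶠ-Level (f ∘ suc) (Fin.suc-injective ∘ inj) p q L

  T-Xᶜ-Up : ∀ {i} {E D : Column n k} → Up i E D → T i * Xᶜ E ≈ t * (Xᶜ D * T⁻¹ i)
  T-Xᶜ-Up {i = i} {E} {D} U rewrite sym (Xᶠ≡Xᶜ E) | sym (Xᶠ≡Xᶜ D) = T-Xᶠ-Up i id id refl refl U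

  commute-T-Xᶜ : ∀ {i} {E : Column n k} → Level i E → Commute (T i) (Xᶜ E)
  commute-T-Xᶜ {i = i} {E} L rewrite sym (Xᶠ≡Xᶜ E) = commute-T-Xᶠ-Level i id id refl refl L

  -- Multiplying a decomposition by X^ϖ

  X^ϖ≈Xᶜ : (p : k ≤ n) → X^ (ϖ k) ≈ Xᶜ (highest p)
  X^ϖ≈Xᶜ p = ≈-trans (go p id) (R.reflexive (Xᶠ≡Xᶜ (highest p)))
    where
    go : ∀ {k q} (p : k ≤ q) (f : Fin q → Fin n) →
      ∏ (allFin q) (λ x → X^ℤ (f x) (if does (toℕ x ℕ.<? k) then 1ℤ else 0ℤ)) ≈ Xᶠ f (highest p)
    go {q = zero}  z≤n     f = ≈-refl
    go {q = suc q} z≤n     f = ≈-trans (*-identityˡ _) (≈-trans (R.reflexive (∏-tabulate (λ x → X^ℤ (f x) 0ℤ) Fin.suc)) (go z≤n (f ∘ suc)))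
    go {q = suc q} (s≤s p) f = *-cong (*-identityʳ _) (≈-trans
      (R.reflexive (∏-tabulate (λ x → X^ℤ (f x) (if does (toℕ x ℕ.<? suc _) then 1ℤ else 0ℤ)) Fin.suc)) (go p (f ∘ suc)))

  -- Reduced words of stabilizing elements avoid s_k, and any other s_i has its two letters both
  -- inside or both outside the highest column.
  commute-H⟨ϖ⟩ : (p : k ≤ n) {h : H} → H⟨ ϖ k ⟩ h → Commute (Xᶜ (highest p)) h
  commute-H⟨ϖ⟩ p (resp e x∈) = ≈-trans (R.*-congˡ (≈-sym e)) (≈-trans (commute-H⟨ϖ⟩ p x∈) (R.*-congʳ e))
  commute-H⟨ϖ⟩ p (gen w st)  = commute-∏ (All.map (λ {i} ne → ≈-sym (commute-T-Xᶜ (Level-highest p i ne))) (parabolic-redword w st))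
  commute-H⟨ϖ⟩ p 0∈          = commute-0
  commute-H⟨ϖ⟩ p (+∈ x∈ y∈)  = ≈-trans (distribˡ _ _ _) (≈-trans (+-cong (commute-H⟨ϖ⟩ p x∈) (commute-H⟨ϖ⟩ p y∈)) (≈-sym (distribʳ _ _ _)))
  commute-H⟨ϖ⟩ p (-∈ x∈)     = ≈-trans (≈-sym (RP.-‿distribʳ-* _ _)) (≈-trans (-‿cong (commute-H⟨ϖ⟩ p x∈)) (RP.-‿distribˡ-* _ _))
  commute-H⟨ϖ⟩ p (t*∈ x∈)    = commute-* (≈-sym (t-central _)) (commute-H⟨ϖ⟩ p x∈)
  commute-H⟨ϖ⟩ p (t⁻¹*∈ x∈)  = commute-* (≈-sym (t⁻¹-central _)) (commute-H⟨ϖ⟩ p x∈)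

  T-word⁻¹-∷ʳ : ∀ a i → T-word⁻¹ (a ∷ʳ i) ≈ T⁻¹ i * T-word⁻¹ a
  T-word⁻¹-∷ʳ []      i = ≈-sym commute-1
  T-word⁻¹-∷ʳ (j ∷ a) i = ≈-trans (R.*-congʳ (T-word⁻¹-∷ʳ a i)) (*-assoc _ _ _)

  T-word-Xᶜ : ∀ {b} {D : Column n k} (p : k ≤ n) → Reach b D →
    T-word b * Xᶜ (highest p) ≈ Xᶜ D * (t ^ length b * T-word⁻¹ (reverse b))
  T-word-Xᶜ p (origin q) rewrite ℕ.≤-irrelevant p q = begin
    1# * Xᶜ (highest q)           ≈⟨ ≈-sym commute-1 ⟩
    Xᶜ (highest q) * 1#           ≈⟨ R.*-congˡ (*-identityˡ 1#) ⟨
    Xᶜ (highest q) * (1# * 1#)    ∎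
  T-word-Xᶜ {D = D} p (up {i} {b} {G} U _ r) = begin
    T i * T-word b * Xᶜ (highest p)                   ≈⟨ *-assoc _ _ _ ⟩
    T i * (T-word b * Xᶜ (highest p))                 ≈⟨ R.*-congˡ (T-word-Xᶜ p r) ⟩
    T i * (Xᶜ G * (c * w))                            ≈⟨ *-assoc _ _ _ ⟨
    T i * Xᶜ G * (c * w)                              ≈⟨ R.*-congʳ (T-Xᶜ-Up U) ⟩
    t * (Xᶜ D * T⁻¹ i) * (c * w)                      ≈⟨ *-assoc _ _ _ ⟩
    t * (Xᶜ D * T⁻¹ i * (c * w))                      ≈⟨ R.*-congˡ (*-assoc _ _ _) ⟩
    t * (Xᶜ D * (T⁻¹ i * (c * w)))                    ≈⟨ x∙yz≈y∙xz (t-central _) _ ⟩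
    Xᶜ D * (t * (T⁻¹ i * (c * w)))                    ≈⟨ R.*-congˡ (R.*-congˡ (x∙yz≈y∙xz (commute-^ (≈-sym (t-central _)) (length b)) _)) ⟩
    Xᶜ D * (t * (c * (T⁻¹ i * w)))                    ≈⟨ R.*-congˡ (*-assoc _ _ _) ⟨
    Xᶜ D * (t * c * (T⁻¹ i * w))                      ≈⟨ R.*-congˡ (R.*-congˡ (T-word⁻¹-∷ʳ (reverse b) i)) ⟨
    Xᶜ D * (t * c * T-word⁻¹ (reverse b ∷ʳ i))        ≡⟨ cong (λ a → Xᶜ D * (t * c * T-word⁻¹ a)) (List.unfold-reverse i b) ⟨
    Xᶜ D * (t * c * T-word⁻¹ (reverse (i ∷ b)))       ∎
    where
    c = t ^ length b
    w = T-word⁻¹ (reverse b)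

  T-u-upWord : (D : Column n k) → T[ u D ] ≈ T-word (upWord D)
  T-u-upWord D = ≈-sym (T-reduced (upWord D) (u D) (upWord-≈ D) (upWord-length D))

  T-u-Xᶜ : (D : Column n k) (p : k ≤ n) → T[ u D ] * Xᶜ (highest p) ≈ Xᶜ D * leading D
  T-u-Xᶜ D p = begin
    T[ u D ] * Xᶜ (highest p)                                         ≈⟨ R.*-congʳ (T-u-upWord D) ⟩
    T-word b * Xᶜ (highest p)                                         ≈⟨ T-word-Xᶜ p (reach-upWord D) ⟩
    Xᶜ D * (t ^ length b * T-word⁻¹ (reverse b))                      ≡⟨ cong (λ j → Xᶜ D * (t ^ j * T-word⁻¹ (reverse b))) (trans (upWord-length D) (sym (ℓ≡inv (u D)))) ⟩
    Xᶜ D * (t ^ ℓ (u D) * T-word⁻¹ (reverse b))                       ≡⟨ cong (λ a → Xᶜ D * (t ^ ℓ (u D) * T-word⁻¹ a)) (List.reverse-involutive (redword (flip (u D)))) ⟩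
    Xᶜ D * leading D                                                  ∎
    where b = upWord D

  -- Stated for any decomposition, to serve both the computed one in Ψ and the explicit one of `𝟏₀`.
  decomposition-X^ϖ : ∀ {h} → k ≤ n → (D : Decomposition k h) →
    h * X^ (ϖ k) ≈ ∑[ C ∈ columns n k ] (Xᶜ C * (leading C * component D C))
  decomposition-X^ϖ {k} {h} p D = begin
    h * X^ (ϖ k)                                                  ≈⟨ *-cong (recompose D) (X^ϖ≈Xᶜ p) ⟩
    (∑[ C ∈ columns n k ] (T[ u C ] * component D C)) * Xᶜ (highest p)      ≈⟨ ∑-*ʳ _ (columns n k) _ ⟩
    (∑[ C ∈ columns n k ] (T[ u C ] * component D C * Xᶜ (highest p)))      ≈⟨ ∑-cong (columns n k) move ⟩
    (∑[ C ∈ columns n k ] (Xᶜ C * (leading C * component D C)))             ∎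
    where
    move : ∀ C → T[ u C ] * component D C * Xᶜ (highest p) ≈ Xᶜ C * (leading C * component D C)
    move C = begin
      T[ u C ] * component D C * Xᶜ (highest p)      ≈⟨ *-assoc _ _ _ ⟩
      T[ u C ] * (component D C * Xᶜ (highest p))    ≈⟨ R.*-congˡ (commute-H⟨ϖ⟩ p (component∈ D C)) ⟨
      T[ u C ] * (Xᶜ (highest p) * component D C)    ≈⟨ *-assoc _ _ _ ⟨
      T[ u C ] * Xᶜ (highest p) * component D C      ≈⟨ R.*-congʳ (T-u-Xᶜ C p) ⟩
      Xᶜ C * leading C * component D C               ≈⟨ *-assoc _ _ _ ⟩
      Xᶜ C * (leading C * component D C)             ∎

  -- Coset decomposition of `𝟏₀`, and part (b)

  T-word-T : ∀ {b} {D : Column n k} {v} → Reach b D → Stabilizes (ϖ k) v → T-word b * T[ v ] ≈ T[ u D ∙ v ]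
  T-word-T {v = v} (origin p) st = ≈-trans (*-identityˡ _) (T-cong {v} {u (highest p) ∙ v}
    (λ x → inverse-cong {flip Perm.id} {flip (u (highest p))} (λ y → sym (u⁻¹-highest p y)) (v ⟨$⟩ʳ x)))
  T-word-T {k} {D = D} {v} (up {i} {b} {G} U su r) st = begin
    T i * T-word b * T[ v ]     ≈⟨ *-assoc _ _ _ ⟩
    T i * (T-word b * T[ v ])   ≈⟨ R.*-congˡ (T-word-T r st) ⟩
    T i * T[ u G ∙ v ]          ≈⟨ T-ascent i (u G ∙ v) ascent ⟩
    T[ s i ∙ (u G ∙ v) ]        ≈⟨ T-cong {s i ∙ (u G ∙ v)} {u D ∙ v} (λ x → su (v ⟨$⟩ʳ x)) ⟩
    T[ u D ∙ v ]                ∎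
    where
    -- G contains letter i but not i+1, so u_G⁻¹ puts them on different sides of k. As v⁻¹ preserves
    -- the two sides, s_i remains an ascent.
    ascent : Ascent i (u G ∙ v)
    ascent = ℕ.<-≤-trans
      (ϖ≡⇒< {x = u G ⟨$⟩ˡ inject₁ i} {v ⟨$⟩ˡ (u G ⟨$⟩ˡ inject₁ i)} (sym (st _)) (proj₁ (Up-∈ᶜ U)))
      (ℕ.≮⇒≥ (proj₂ (Up-∈ᶜ U) ∘ ϖ≡⇒< {x = v ⟨$⟩ˡ (u G ⟨$⟩ˡ suc i)} {u G ⟨$⟩ˡ suc i} (st _)))

  T-u-T : (D : Column n k) {v : S} → Stabilizes (ϖ k) v → T[ u D ] * T[ v ] ≈ T[ u D ∙ v ]
  T-u-T D {v} st = ≈-trans (R.*-congʳ (T-u-upWord D)) (T-word-T {v = v} (reach-upWord D) st)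

  -- A further s_i either moves the column or, in the `stay` case, passes through u_C as an s_j that
  -- the stabilizer absorbs.
  coset : k ≤ n → ∀ a → ∃ λ (C : Column n k) → ∃ λ v → Stabilizes (ϖ k) v × ⟦ a ⟧ ≈ₛ u C ∙ v
  coset p [] = highest p , Perm.id , (λ _ → refl) , inverse-cong {flip Perm.id} {flip (u (highest p))} (λ y → sym (u⁻¹-highest p y))
  coset p (i ∷ a) with coset p a
  ... | C , v , st , e with step i C
  ...   | up G g _      = G , v , st , λ x → trans (cong (s i ⟨$⟩ʳ_) (e x)) (u-move i C G g (v ⟨$⟩ʳ x))
  ...   | down G g _    = G , v , st , λ x → trans (cong (s i ⟨$⟩ʳ_) (e x)) (u-move i C G g (v ⟨$⟩ʳ x))
  ...   | stay j q r ne = C , s j ∙ v , Stabilizes-∙ {v = s j} {v} (s-stabilizes j ne) st ,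
                          λ x → trans (cong (s i ⟨$⟩ʳ_) (e x)) (u-stay i C j q r (v ⟨$⟩ʳ x))

  cosets : ℕ → List S
  cosets k = cartesianProductWith (λ C v → u C ∙ v) (columns n k) (filter (stabilizes? (ϖ k)) (permutations n))

  Any-filter⁺ : {P Q : I → Set} (P? : Decidable P) → (∀ {x} → Q x → P x) → ∀ {xs} → Any Q xs → Any Q (filter P? xs)
  Any-filter⁺ P? Q⊆P {x ∷ _} (here q) with P? x
  ... | yes _ = here q
  ... | no ¬p = ⊥-elim (¬p (Q⊆P q))
  Any-filter⁺ P? Q⊆P {x ∷ _} (there a) with P? x
  ... | yes _ = there (Any-filter⁺ P? Q⊆P a)
  ... | no _  = Any-filter⁺ P? Q⊆P a

  cosets-complete : k ≤ n → ∀ w → Any (w ≈ₛ_) (cosets k)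
  cosets-complete {k} p w with coset p (redword w)
  ... | C , v , st , e = Any.cartesianProductWith⁺ (λ C v → u C ∙ v) {P = C ≡_} {Q = v ≈ₛ_}
    (λ { {v′} refl e′ x → trans (sym (redword-≈ w x)) (trans (e x) (cong (u C ⟨$⟩ʳ_) (e′ x))) })
    (columns-complete C) (Any-filter⁺ (stabilizes? (ϖ k)) (λ {w} e′ → Stabilizes-cong {v = w} {v} (≈ₛ-sym {v} {w} e′) st) (permutations-complete v))

  -- Since v does not move positions across k, the product still determines C; this separates the
  -- cosets.
  coset-∈ᶜ : (C : Column n k) {v : S} → Stabilizes (ϖ k) v → ∀ x →
    (toℕ ((u C ∙ v) ⟨$⟩ˡ x) < k → x ∈ᶜ C) × (x ∈ᶜ C → toℕ ((u C ∙ v) ⟨$⟩ˡ x) < k)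
  coset-∈ᶜ C {v} st x = ϖ≡⇒< {x = v ⟨$⟩ˡ j} {j} (st j) , ϖ≡⇒< {x = j} {v ⟨$⟩ˡ j} (sym (st j))
    where j = u C ⟨$⟩ˡ x

  cosets-distinct : ∀ k → AllPairs (λ w v → ¬ w ≈ₛ v) (cosets k)
  cosets-distinct k = go (columns-unique n k)
    where
    vs = filter (stabilizes? (ϖ k)) (permutations n)
    vs-stabilize : ∀ {v} → v ∈ vs → Stabilizes (ϖ k) v
    vs-stabilize = All.lookup (All.all-filter (stabilizes? (ϖ k)) (permutations n))
    same-column : ∀ {C D : Column n k} {v w} → v ∈ vs → w ∈ vs → u C ∙ v ≈ₛ u D ∙ w → C ≡ D
    same-column {C} {D} {v} {w} v∈ w∈ e = ∈ᶜ-ext C D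
      (λ x → proj₁ (coset-∈ᶜ D {w} (vs-stabilize w∈) x) ∘ subst (λ y → toℕ y < k) (e⁻¹ x) ∘ proj₂ (coset-∈ᶜ C {v} (vs-stabilize v∈) x))
      (λ x → proj₁ (coset-∈ᶜ C {v} (vs-stabilize v∈) x) ∘ subst (λ y → toℕ y < k) (sym (e⁻¹ x)) ∘ proj₂ (coset-∈ᶜ D {w} (vs-stabilize w∈) x))
      where e⁻¹ = inverse-cong {u C ∙ v} {u D ∙ w} e
    row : ∀ C → AllPairs (λ w v → ¬ w ≈ₛ v) (map (u C ∙_) vs)
    row C = AllPairs.map⁺ (AllPairs.map (λ ne e → ne (λ x → w-inj (u C) (e x))) (AllPairs.filter⁺ (stabilizes? (ϖ k)) (permutations-distinct n)))
    go : ∀ {Cs} → Unique Cs → AllPairs (λ w v → ¬ w ≈ₛ v) (cartesianProductWith (λ C v → u C ∙ v) Cs vs)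
    go []                 = []
    go {C ∷ Cs} (C∉ ∷ uq) = AllPairs.++⁺ (row C) (go uq)
      (All.map⁺ (All.tabulate λ v∈ → All.cartesianProductWith⁺ (setoid _) (setoid _) (λ C v → u C ∙ v) Cs vs
        λ D∈ w∈ e → All.lookup C∉ D∈ (same-column v∈ w∈ e)))

  -- The constant component `𝟏 (ϖ k)` is the one in the one-column clause of `Ψ`, so the empty
  -- tensor can be the base case.
  𝟏₀-decomposition : k ≤ n → Decomposition k 𝟏₀
  𝟏₀-decomposition {k} p = decomposition (λ _ → 𝟏 (ϖ k)) (λ _ → 𝟏∈ (All.all-filter (stabilizes? (ϖ k)) (permutations n))) (begin
    𝟏₀                                                      ≈⟨ ∑-reindex _≈ₛ_ (λ v w → Fin.all? λ x → (v ⟨$⟩ʳ x) Fin.≟ (w ⟨$⟩ʳ x))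
                                                                 (λ {v} {w} → ≈ₛ-sym {v} {w}) (λ {v} {w} {z} → ≈ₛ-trans {v} {w} {z}) T[_] (λ {v} {w} → T-cong {v} {w})
                                                                 (permutations-distinct n) (cosets-distinct k) permutations-complete (cosets-complete p) ⟩
    ∑ (cosets k) T[_]                                       ≈⟨ ∑-cartesianProductWith T[_] (λ C v → u C ∙ v) (columns n k) vs ⟩
    (∑[ C ∈ columns n k ] ∑[ v ∈ vs ] T[ u C ∙ v ])         ≈⟨ ∑-cong (columns n k) (λ C → ∑-cong∈ vs (All.map (λ {v} → T-u-T C {v}) (All.all-filter (stabilizes? (ϖ k)) (permutations n)))) ⟨
    (∑[ C ∈ columns n k ] ∑[ v ∈ vs ] (T[ u C ] * T[ v ]))  ≈⟨ ∑-cong (columns n k) (λ C → ∑-*ˡ T[ u C ] T[_] vs) ⟨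
    (∑[ C ∈ columns n k ] (T[ u C ] * 𝟏 (ϖ k)))             ∎)
    where
    vs = filter (stabilizes? (ϖ k)) (permutations n)
    𝟏∈ : ∀ {ws} → All (Stabilizes (ϖ k)) ws → H⟨ ϖ k ⟩ (∑ ws T[_])
    𝟏∈ []       = 0∈
    𝟏∈ (p ∷ ps) = +∈ (gen _ p) (𝟏∈ ps)

  Ψ-X^ϖ : ∀ {ks} → k ≤ n → (P : Tensor ks) → Ψ P * X^ (ϖ k) ≈ ∑[ C ∈ columns n k ] (Xᶜ C * Ψ (C ⊗ P))
  Ψ-X^ϖ     p []          = decomposition-X^ϖ p (𝟏₀-decomposition p)
  Ψ-X^ϖ {k} p P@(_ ∷ _)   = ≈-trans (decomposition-X^ϖ p (decompose p (Ψ∈Hₙ P))) (∑-cong (columns n k) λ C →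
    -- `Ψ (C ⊗ P)` decomposes along `length≤ C` instead of `p`; the bounds are equal proofs, so the
    -- components coincide.
    R.reflexive (cong (λ q → Xᶜ C * (leading C * component (decompose q (Ψ∈Hₙ P)) C)) (ℕ.≤-irrelevant p (length≤ C))))

  -- Monomials of tableaux, and part (c)

  commute-Xᶜ : (C : Column n k) (D : Column n l) → Commute (Xᶜ C) (Xᶜ D)
  commute-Xᶜ {k} {l} C D = commute-∏ (All.universal (λ j → ≈-sym (commute-∏ (All.universal (λ i → X-comm (entry D j) (entry C i)) (allFin k)))) (allFin l))

  commute-Xᶜ-Xᵀ : ∀ {ks} (C : Column n k) (P : Tensor ks) → Commute (Xᶜ C) (Xᵀ P)
  commute-Xᶜ-Xᵀ C []      = commute-1
  commute-Xᶜ-Xᵀ C (D ∷ P) = commute-* (commute-Xᶜ C D) (commute-Xᶜ-Xᵀ C P)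

  X^-cong : ∀ {μ ν : Weight} → (∀ x → μ x ≡ ν x) → X^ μ ≈ X^ ν
  X^-cong e = ∏-cong (allFin n) λ x → R.reflexive (cong (X^ℤ x) (e x))

  -- Natural exponents keep the inverses `X⁻¹` out. The factors are swapped because (b) multiplies
  -- by X^ϖ on the right.
  X^-+ : (a b : Fin n → ℕ) → X^ (λ x → + (a x ℕ.+ b x)) ≈ X^ (λ x → + b x) * X^ (λ x → + a x)
  X^-+ a b = ≈-trans
    (∏-cong (allFin n) λ x → ≈-trans (R.reflexive (cong (X x ^_) (ℕ.+-comm (a x) (b x)))) (Exp.^-homo-* (X x) (b x) (a x)))
    (∏-* (λ x → X x ^ b x) (λ x → X x ^ a x) (allFin n) λ x y →
      commute-^ (≈-sym (commute-^ (X-comm y x) (b x))) (a y))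

  ϖ-nonneg : ∀ k x → + ℤ.∣ ϖ k x ∣ ≡ ϖ k x
  ϖ-nonneg k x with does (toℕ x ℕ.<? k)
  ... | true  = refl
  ... | false = refl

  ∑ϖ-nonneg : ∀ ks x → + ℤ.∣ ∑ϖ ks x ∣ ≡ ∑ϖ ks x
  ∑ϖ-nonneg []       x = refl
  ∑ϖ-nonneg (k ∷ ks) x with ϖ k x | ∑ϖ ks x | ϖ-nonneg k x | ∑ϖ-nonneg ks x
  ... | + _ | + _ | _ | _ = refl

  X^-∑ϖ-∷ : ∀ k ks → X^ (∑ϖ (k ∷ ks)) ≈ X^ (∑ϖ ks) * X^ (ϖ k)
  X^-∑ϖ-∷ k ks = begin
    X^ (∑ϖ (k ∷ ks))                                   ≈⟨ X^-cong (λ x → cong₂ ℤ._+_ (ϖ-nonneg k x) (∑ϖ-nonneg ks x)) ⟨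
    X^ (λ x → + (a x ℕ.+ b x))                         ≈⟨ X^-+ a b ⟩
    X^ (λ x → + b x) * X^ (λ x → + a x)                ≈⟨ *-cong (X^-cong (∑ϖ-nonneg ks)) (X^-cong (ϖ-nonneg k)) ⟩
    X^ (∑ϖ ks) * X^ (ϖ k)                              ∎
    where
    a b : Fin n → ℕ
    a x = ℤ.∣ ϖ k x ∣
    b x = ℤ.∣ ∑ϖ ks x ∣

  X^-0 : X^ (λ _ → 0ℤ) ≈ 1#
  X^-0 = go (allFin n)
    where
    go : ∀ xs → ∏ xs (λ x → X^ℤ x 0ℤ) ≈ 1#
    go []       = ≈-refl
    go (x ∷ xs) = ≈-trans (*-identityˡ _) (go xs)

  -- Each use of (b) attaches a column at the left of the tableau, but its monomial appears to the
  -- right of `Xᵀ P` and is commuted past it. The sum is over all fillings; those not semistandard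
  -- are discarded afterwards.
  𝟏₀-X^ : ∀ {ks} → All (_≤ n) ks → 𝟏₀ * X^ (∑ϖ ks) ≈ ∑[ P ∈ tensors ks ] (Xᵀ P * Ψ P)
  𝟏₀-X^ [] = ≈-trans (R.*-congˡ X^-0) (≈-trans commute-1 (≈-sym (R.+-identityʳ _)))
  𝟏₀-X^ {k ∷ ks} (p ∷ ps) = begin
    𝟏₀ * X^ (∑ϖ (k ∷ ks))                                                         ≈⟨ R.*-congˡ (X^-∑ϖ-∷ k ks) ⟩
    𝟏₀ * (X^ (∑ϖ ks) * X^ (ϖ k))                                                  ≈⟨ *-assoc _ _ _ ⟨
    𝟏₀ * X^ (∑ϖ ks) * X^ (ϖ k)                                                    ≈⟨ R.*-congʳ (𝟏₀-X^ ps) ⟩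
    (∑[ P ∈ tensors ks ] (Xᵀ P * Ψ P)) * X^ (ϖ k)                                 ≈⟨ ∑-*ʳ _ (tensors ks) _ ⟩
    (∑[ P ∈ tensors ks ] (Xᵀ P * Ψ P * X^ (ϖ k)))                                 ≈⟨ ∑-cong (tensors ks) expand ⟩
    -- `tensors (k ∷ ks)` runs through the new column in its outer loop.
    (∑[ P ∈ tensors ks ] ∑[ C ∈ columns n k ] (Xᵀ (C ⊗ P) * Ψ (C ⊗ P)))           ≈⟨ ∑-swap _ (tensors ks) (columns n k) ⟩
    (∑[ C ∈ columns n k ] ∑[ P ∈ tensors ks ] (Xᵀ (C ⊗ P) * Ψ (C ⊗ P)))           ≈⟨ ∑-cartesianProductWith _ _⊗_ (columns n k) (tensors ks) ⟨
    (∑[ P ∈ tensors (k ∷ ks) ] (Xᵀ P * Ψ P))                                      ∎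
    where
    expand : ∀ P → Xᵀ P * Ψ P * X^ (ϖ k) ≈ ∑[ C ∈ columns n k ] (Xᵀ (C ⊗ P) * Ψ (C ⊗ P))
    expand P = begin
      Xᵀ P * Ψ P * X^ (ϖ k)                                   ≈⟨ *-assoc _ _ _ ⟩
      Xᵀ P * (Ψ P * X^ (ϖ k))                                 ≈⟨ R.*-congˡ (Ψ-X^ϖ p P) ⟩
      Xᵀ P * (∑[ C ∈ columns n k ] (Xᶜ C * Ψ (C ⊗ P)))        ≈⟨ ∑-*ˡ (Xᵀ P) _ (columns n k) ⟩
      (∑[ C ∈ columns n k ] (Xᵀ P * (Xᶜ C * Ψ (C ⊗ P))))      ≈⟨ ∑-cong (columns n k) (λ C →
        ≈-trans (≈-sym (*-assoc _ _ _)) (R.*-congʳ (≈-sym (commute-Xᶜ-Xᵀ C P)))) ⟩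
      (∑[ C ∈ columns n k ] (Xᵀ (C ⊗ P) * Ψ (C ⊗ P)))         ∎

  𝟏₀-X^-dominant : ∀ μ → Dominant μ → 𝟏₀ * X^ μ ≈ ∑[ P ∈ B μ ] (Xᵀ P * Ψ P)
  𝟏₀-X^-dominant μ dominant = begin
    𝟏₀ * X^ μ                                                   ≈⟨ R.*-congˡ (X^-cong (∑ϖ-columnLengths μ dominant)) ⟨
    𝟏₀ * X^ (∑ϖ (columnLengths μ))                              ≈⟨ 𝟏₀-X^ (All.map proj₂ (proj₁ valid)) ⟩
    (∑[ P ∈ tensors (columnLengths μ) ] (Xᵀ P * Ψ P))           ≈⟨ ∑-filter semistandard? _ (tensors (columnLengths μ))
                                                                     (λ P ¬ss → ≈-trans (R.*-congˡ (Ψ-vanishes P (proj₂ valid) ¬ss)) (R.zeroʳ _)) ⟩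
    (∑[ P ∈ B μ ] (Xᵀ P * Ψ P))                                 ∎
    where valid = columnLengths-valid μ dominant

theorem5p2 : (m : ℕ) → let open AffineHecke m in
    ((ℓᵣ : ℕ) (ℓs : List ℕ) → ColumnLengths (ℓᵣ ∷ ℓs) → (P : Tensor (ℓᵣ ∷ ℓs)) →
    (¬ Semistandard P → Ψ P ≈ 0#)
    × ((k : ℕ) → 1 ≤ k → k ≤ n → ℓᵣ ≤ k →
    Ψ P * X^ (ϖ k) ≈ ∑[ C ∈ columns n k ] (Xᶜ C * Ψ (C ⊗ P))))
    × ((μ : Weight) → Dominant μ →
    𝟏₀ * X^ μ ≈ ∑[ P ∈ B μ ] (Xᵀ P * Ψ P))
theorem5p2 m =
    (λ ℓᵣ ℓs valid P → Ψ-vanishes P (proj₂ valid) , λ k _ k≤n _ → Ψ-X^ϖ k≤n P)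
  , 𝟏₀-X^-dominant
  where open Expansion m
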